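{- Let $r\ge 2$ and let $a_1,\dots,a_r$ be integers with $a_i\ge 3$ for all $i$. Put $R=R(a_1,\dots,a_r)$. Then $$F_e(a_1,\dots,a_r;R-2)=R+6$$ if and only if either ($R\ge 7$ and $K_{R-7}+Q\to_e(a_1,\dots,a_r)$) or ($R\ge 9$ and $K_{R-9}+C_5+C_5+C_5\to_e(a_1,\dots,a_r)$).
   Context: All graphs are finite, simple and undirected; $\omega(G)$ denotes the clique number. For integers $a_1,\dots,a_r\ge 2$, $G\to_e(a_1,\dots,a_r)$ means: for every partition $E(G)=E_1\cup\dots\cup E_r$ of the edge set into pairwise disjoint classes there exist $i\in\{1,\dots,r\}$ and a set of $a_i$ pairwise adjacent vertices all of whose connecting edges lie in $E_i$. The Ramsey number is $R(a_1,\dots,a_r)=\min\{n: K_n\to_e(a_1,\dots,a_r)\}$. The edge Folkman number is $F_e(a_1,\dots,a_r;q)=\min\{|V(G)|: G\to_e(a_1,\dots,a_r)\text{ and }\omega(G)<q\}$. $K_n$ is the complete graph on $n$ vertices ($K_0+H=H$), $C_5$ is the 5-cycle, and $G_1+G_2$ is the join (disjoint union of $G_1$ and $G_2$ plus all edges between $V(G_1)$ and $V(G_2)$). $Q$ is the graph on $\mathbb{Z}_{13}$ in which distinct $i,j$ are adjacent iff $i-j\notin\{\pm1,\pm5\}\pmod{13}$ (its complement is the circulant graph on $\mathbb{Z}_{13}$ with connection set $\{\pm1,\pm5\}$). -}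

module Defs where

open import Data.Nat using (ℕ; zero; suc; _+_; _∸_; _≤_; _<_; _%_)
open import Data.Fin using (Fin; toℕ; splitAt)
open import Data.Fin.Properties using (all?)
open import Data.Bool using (Bool; true; false; _∧_; not)
open import Data.Bool.Properties renaming (_≟_ to _≟ᵇ_)
open import Data.Sum using (_⊎_; inj₁; inj₂)
open import Data.Product using (Σ; ∃; _×_; _,_)
open import Data.Nat using (_≡ᵇ_)
open import Relation.Binary.PropositionalEquality using (_≡_; _≢_; refl)
open import Relation.Nullary using (¬_)
open import Relation.Nullary.Decidable using (toWitness)
open import Data.Unit using (tt)
open import Function.Definitions using (Injective)

record Graph (n : ℕ) : Set where
  field
    adj    : Fin n → Fin n → Bool
    sym    : ∀ i j → adj i j ≡ adj j i
    irrefl : ∀ i → adj i i ≡ false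
open Graph public

IsClique : ∀ {n} → Graph n → (k : ℕ) → (Fin k → Fin n) → Set
IsClique G k f = Injective _≡_ _≡_ f × (∀ x y → x ≢ y → adj G (f x) (f y) ≡ true)

CliqueLT : ∀ {n} → Graph n → ℕ → Set
CliqueLT {n} G q = ¬ Σ (Fin q → Fin n) (IsClique G q)

-- An r-colouring of the edges (a partition of E(G) into r classes):
-- a symmetric assignment of colours to pairs; only values on edges matter.
record EdgeColouring {n} (G : Graph n) (r : ℕ) : Set where
  field
    col    : Fin n → Fin n → Fin r
    colSym : ∀ i j → col i j ≡ col j i
open EdgeColouring public

Arrows : ∀ {n} (G : Graph n) {r : ℕ} → (Fin r → ℕ) → Set
Arrows {n} G {r} a =
  (c : EdgeColouring G r) →
  Σ (Fin r) λ i → Σ (Fin (a i) → Fin n) λ f →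
    IsClique G (a i) f × (∀ x y → x ≢ y → col c (f x) (f y) ≡ i)

K : (n : ℕ) → Graph n
K n = record { adj = λ i j → not (toℕ i ≡ᵇ toℕ j) ; sym = s ; irrefl = ir }
  where
  s : ∀ (i j : Fin n) → not (toℕ i ≡ᵇ toℕ j) ≡ not (toℕ j ≡ᵇ toℕ i)
  s i j = go (toℕ i) (toℕ j)
    where
    go : ∀ a b → not (a ≡ᵇ b) ≡ not (b ≡ᵇ a)
    go zero zero = refl
    go zero (suc b) = refl
    go (suc a) zero = refl
    go (suc a) (suc b) = go a b
  ir : ∀ (i : Fin n) → not (toℕ i ≡ᵇ toℕ i) ≡ false
  ir i = go (toℕ i)
    where
    go : ∀ a → not (a ≡ᵇ a) ≡ false
    go zero = refl
    go (suc a) = go a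

joinAdj : ∀ {m k} → Graph m → Graph k → Fin (m + k) → Fin (m + k) → Bool
joinAdj {m} G H u v with splitAt m u | splitAt m v
... | inj₁ x | inj₁ y = adj G x y
... | inj₁ x | inj₂ y = true
... | inj₂ x | inj₁ y = true
... | inj₂ x | inj₂ y = adj H x y

_⊕_ : ∀ {m k} → Graph m → Graph k → Graph (m + k)
_⊕_ {m} {k} G H = record { adj = joinAdj G H ; sym = s ; irrefl = ir }
  where
  s : ∀ u v → joinAdj G H u v ≡ joinAdj G H v u
  s u v with splitAt m u | splitAt m v
  ... | inj₁ x | inj₁ y = sym G x y
  ... | inj₁ x | inj₂ y = refl
  ... | inj₂ x | inj₁ y = refl
  ... | inj₂ x | inj₂ y = sym H x y
  ir : ∀ u → joinAdj G H u u ≡ false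
  ir u with splitAt m u
  ... | inj₁ x = irrefl G x
  ... | inj₂ x = irrefl H x

diffMod : (p : ℕ) → ℕ → ℕ → ℕ
diffMod zero _ _ = 0
diffMod (suc p) i j = ((i + suc p) ∸ j) % suc p

qAdj : Fin 13 → Fin 13 → Bool
qAdj i j with diffMod 13 (toℕ i) (toℕ j)
... | 0 = false
... | 1 = false
... | 12 = false
... | 5 = false
... | 8 = false
... | _ = true

Q : Graph 13
Q = record
  { adj = qAdj
  ; sym = λ i j → toWitness {a? = all? (λ i → all? (λ j → qAdj i j ≟ᵇ qAdj j i))} tt i j
  ; irrefl = λ i → toWitness {a? = all? (λ i → qAdj i i ≟ᵇ false)} tt i
  }

c5Adj : Fin 5 → Fin 5 → Bool
c5Adj i j with diffMod 5 (toℕ i) (toℕ j)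
... | 1 = true
... | 4 = true
... | _ = false

C5 : Graph 5
C5 = record
  { adj = c5Adj
  ; sym = λ i j → toWitness {a? = all? (λ i → all? (λ j → c5Adj i j ≟ᵇ c5Adj j i))} tt i j
  ; irrefl = λ i → toWitness {a? = all? (λ i → c5Adj i i ≟ᵇ false)} tt i
  }

IsRamseyNumber : ∀ {r} → (Fin r → ℕ) → ℕ → Set
IsRamseyNumber a R = Arrows (K R) a × (∀ m → Arrows (K m) a → R ≤ m)

IsFolkmanNumber : ∀ {r} → (Fin r → ℕ) → ℕ → ℕ → Set
IsFolkmanNumber a q N =
  Σ (Graph N) (λ G → Arrows G a × CliqueLT G q) ×
  (∀ m (G : Graph m) → Arrows G a → CliqueLT G q → N ≤ m)

{-# OPTIONS --safe #-}
-- Put H for the complement of G. Arrowing forces chi(G) ≥ R, so the theorem reduces to: if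
-- chi(G) ≥ s and omega(G) ≤ s − f with f ≤ 3, then |G| ≥ s + 2f, with equality only for joins of a
-- complete graph with f pentagons or, when f = 3, with Q. If H has a triangle, deleting it leaves a graph
-- extremal for f − 1; in its (s − 1)-colouring every set meeting all classes contains a maximum clique, so the
-- three deleted vertices fit into existing classes, a contradiction. If H is triangle-free, then chi(G) is
-- |G| minus the matching number k ≤ 6 of H, and the claim says that H has a vertex cover of at most 3k/2
-- vertices. By Gallai's lemma the critical case splits into separated classes of size 2kᵢ + 1, and these are
-- handled by R(3,3) ≤ 6, R(3,4) ≤ 9 and the uniqueness of the (3,5)-Ramsey graph on 13 vertices.

module Submission where

open import Defs hiding (sym)
open import Data.Nat
open import Data.Nat.Properties
open import Data.Nat.DivMod using (m≡m%n+[m/n]*n; m%n<n)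
open import Data.Nat.Solver using (module +-*-Solver)
open import Data.Fin as Fin using (Fin; zero; suc; toℕ; fromℕ<; splitAt; _↑ˡ_; _↑ʳ_; inject≤)
open import Data.Fin.Patterns using (0F; 1F; 2F; 3F; 4F)
import Data.Fin.Properties as FinP
open import Data.Bool using (Bool; true; false; _∧_; _∨_; not; if_then_else_; T)
import Data.Bool.Properties as BoolP
open import Data.Product using (Σ; ∃; _×_; _,_; proj₁; proj₂)
open import Data.Sum using (_⊎_; inj₁; inj₂; [_,_]′)
open import Data.Unit using (tt)
open import Data.Empty using (⊥; ⊥-elim)
open import Data.List as List using (List; []; _∷_; length; map; take)
import Data.List.Properties as ListP
open import Data.List.Membership.Propositional.Properties using (∈-lookup)
open import Data.List.Relation.Unary.All as All using (All; []; _∷_)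
import Data.List.Relation.Unary.All.Properties as AllP
open import Data.List.Relation.Unary.AllPairs as AllPairs using (AllPairs; []; _∷_)
import Data.List.Relation.Unary.AllPairs.Properties as AllPairsP
open import Data.List.Relation.Unary.Any as Any using (Any; here; there)
import Data.List.Relation.Unary.Any.Properties as AnyP
open import Data.Vec using (Vec; []; _∷_; lookup)
import Data.Vec.Functional as Vector
open import Algebra.Properties.CommutativeSemigroup +-commutativeSemigroup using (interchange)
open import Function using (_∘_; id; case_of_)
open import Function.Bundles using (_⇔_; mk⇔)
open import Relation.Binary.Definitions using (tri<; tri≈; tri>)
open import Relation.Binary.PropositionalEquality
open import Relation.Nullary using (¬_; Dec; yes; no; does; contradiction)
open import Relation.Nullary.Decidable
  using (dec-true; dec-false; map′; toWitness; ¬?; _×-dec_; _⊎-dec_; _→-dec_)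
open +-*-Solver using (solve; _:+_; _:*_; _:=_; con)

-- Finite subsets and their cardinalities

-- A proper m-colouring is a homomorphism to K_m, and arrowing passes along homomorphisms. This
-- gives chi(G) ≥ R, and it also means that the extremal graphs need to be determined only up to a
-- homomorphism into K_d + Q or K_d + C5 + C5 + C5. In the application s = R and f = 3, as omega(G)
-- < R - 2 means omega(G) ≤ R - 3. The constants have this origin. A class of 2k + 1 vertices
-- satisfies the 3k/2 bound as soon as H has (k + 2)/2 independent vertices in it. For odd k,
-- rounding up makes the bound strict. For even k it is strict if there is one independent vertex
-- more; for k = 2, 4, 6 this asks for R(3,3) ≤ 5, R(3,4) ≤ 9 and R(3,5) ≤ 13. The second holds, the
-- other two fail by one vertex, and these failures are the pentagon and the graph on 13 vertices.
-- The obstacle is a triangle in H: chi(G) is then no longer given by matchings, as a colour class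
-- may have three vertices.

Subset : ℕ → Set
Subset n = Fin n → Bool

infix 4 _∈_
_∈_ : ∀ {n} → Fin n → Subset n → Set
x ∈ X = X x ≡ true

true≢false : true ≢ false
true≢false ()

∈⊎∉ : (b : Bool) → b ≡ true ⊎ b ≡ false
∈⊎∉ true = inj₁ refl
∈⊎∉ false = inj₂ refl

∧-true⁻ : ∀ {a b} → a ∧ b ≡ true → a ≡ true × b ≡ true
∧-true⁻ {true} {true} refl = refl , refl

∧-true : ∀ {a b} → a ≡ true → b ≡ true → a ∧ b ≡ true
∧-true refl refl = refl

not-true⁻ : ∀ {a} → not a ≡ true → a ≡ false
not-true⁻ {false} _ = refl

bool-ext : ∀ {a b} → (a ≡ true → b ≡ true) → (b ≡ true → a ≡ true) → a ≡ b
bool-ext {true} f g = sym (f refl)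
bool-ext {false} {true} f g = g refl
bool-ext {false} {false} f g = refl

does-true⁻ : ∀ {P : Set} (d : Dec P) → does d ≡ true → P
does-true⁻ (yes p) _ = p

does-false⁻ : ∀ {P : Set} (d : Dec P) → does d ≡ false → ¬ P
does-false⁻ (no ¬p) _ = ¬p

_==_ : ∀ {n} → Fin n → Fin n → Bool
x == y = does (x FinP.≟ y)

==-refl : ∀ {n} (x : Fin n) → (x == x) ≡ true
==-refl x = dec-true (x FinP.≟ x) refl

==-≢ : ∀ {n} {x y : Fin n} → x ≢ y → (x == y) ≡ false
==-≢ {x = x} {y} = dec-false (x FinP.≟ y)

_∖_ : ∀ {n} → Subset n → Subset n → Subset n
(X ∖ Y) x = X x ∧ not (Y x)

_∩_ : ∀ {n} → Subset n → Subset n → Subset n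
(X ∩ Y) x = X x ∧ Y x

_-_ : ∀ {n} → Subset n → Fin n → Subset n
(X - a) x = X x ∧ not (x == a)

∈-∖ : ∀ {n} {X Y : Subset n} {x} → x ∈ X → Y x ≡ false → x ∈ (X ∖ Y)
∈-∖ p q = ∧-true p (cong not q)

∈-∖⁻ : ∀ {n} {X Y : Subset n} {x} → x ∈ (X ∖ Y) → x ∈ X × Y x ≡ false
∈-∖⁻ p = proj₁ (∧-true⁻ p) , not-true⁻ (proj₂ (∧-true⁻ p))

∈-delete : ∀ {n} {X : Subset n} {a x} → x ∈ X → x ≢ a → x ∈ (X - a)
∈-delete p q = ∧-true p (cong not (==-≢ q))

∈-delete⁻ : ∀ {n} {X : Subset n} {a x} → x ∈ (X - a) → x ∈ X × x ≢ a
∈-delete⁻ {a = a} {x} p = proj₁ (∧-true⁻ p) , does-false⁻ (x FinP.≟ a) (not-true⁻ (proj₂ (∧-true⁻ p)))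

#b : Bool → ℕ
#b true = 1
#b false = 0

count : ∀ {n} → Subset n → ℕ
count {zero} p = 0
count {suc n} p = #b (p zero) + count (p ∘ suc)

count-cong : ∀ {n} {p q : Subset n} → (∀ x → p x ≡ q x) → count p ≡ count q
count-cong {zero} e = refl
count-cong {suc n} e = cong₂ _+_ (cong #b (e zero)) (count-cong (e ∘ suc))

count-+-cong : ∀ {n} {p q p′ q′ : Subset n} →
  (∀ x → #b (p x) + #b (q x) ≡ #b (p′ x) + #b (q′ x)) →
  count p + count q ≡ count p′ + count q′
count-+-cong {zero} e = refl
count-+-cong {suc n} {p} {q} {p′} {q′} e = begin
  (#b (p zero) + count (p ∘ suc)) + (#b (q zero) + count (q ∘ suc)) ≡⟨ interchange (#b (p zero)) _ _ _ ⟩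
  (#b (p zero) + #b (q zero)) + (count (p ∘ suc) + count (q ∘ suc)) ≡⟨ cong₂ _+_ (e zero) (count-+-cong (e ∘ suc)) ⟩
  (#b (p′ zero) + #b (q′ zero)) + (count (p′ ∘ suc) + count (q′ ∘ suc)) ≡⟨ interchange (#b (p′ zero)) _ _ _ ⟩
  _ ∎
  where open ≡-Reasoning

count-∅ : ∀ n → count {n} (λ _ → false) ≡ 0
count-∅ zero = refl
count-∅ (suc n) = count-∅ n

count-full : ∀ n → count {n} (λ _ → true) ≡ n
count-full zero = refl
count-full (suc n) = cong suc (count-full n)

-- One numerical equation per vertex says at once that `C` and `D` are disjoint and that they cover
-- exactly `X`; summed over all vertices it becomes the equation of cardinalities.
Partition : ∀ {n} → Subset n → Subset n → Subset n → Set
Partition X C D = ∀ x → #b (X x) ≡ #b (C x) + #b (D x)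

count-partition : ∀ {n} {X C D : Subset n} → Partition X C D → count X ≡ count C + count D
count-partition {n} {X} {C} {D} e = begin
  count X ≡⟨ sym (+-identityʳ _) ⟩
  count X + 0 ≡⟨ cong (count X +_) (sym (count-∅ n)) ⟩
  count X + count {n} (λ _ → false) ≡⟨ count-+-cong (λ x → trans (+-identityʳ _) (e x)) ⟩
  count C + count D ∎
  where open ≡-Reasoning

partition-∈ : ∀ {n} {X C D : Subset n} → Partition X C D → ∀ {x} → x ∈ X → x ∈ C ⊎ x ∈ D
partition-∈ {C = C} {D} P {x} xX with C x | D x | P x
... | true | _ | _ = inj₁ refl
... | false | true | _ = inj₂ refl
... | false | false | e = contradiction (trans (sym (cong #b xX)) e) λ ()

partition-⊆ˡ : ∀ {n} {X C D : Subset n} → Partition X C D → ∀ {x} → x ∈ C → x ∈ X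
partition-⊆ˡ {X = X} P {x} xC with X x | P x
... | true | _ = refl
... | false | e = contradiction (trans e (cong (λ b → #b b + _) xC)) λ ()

partition-⊆ʳ : ∀ {n} {X C D : Subset n} → Partition X C D → ∀ {x} → x ∈ D → x ∈ X
partition-⊆ʳ {X = X} {C} P {x} xD with X x | P x
... | true | _ = refl
... | false | e = contradiction (trans e (trans (cong (λ b → #b (C x) + #b b) xD) (+-comm (#b (C x)) 1))) λ ()

partition-disjoint : ∀ {n} {X C D : Subset n} → Partition X C D → ∀ {x} → x ∈ C → x ∈ D → ⊥
partition-disjoint {X = X} P {x} xC xD with X x | trans (P x) (cong₂ (λ b c → #b b + #b c) xC xD)
... | true | ()
... | false | ()

∖-partition : ∀ {n} (X C : Subset n) → (∀ {x} → x ∈ C → x ∈ X) → Partition X C (X ∖ C)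
∖-partition X C C⊆X x with C x in e | X x in e′
... | true | true = refl
... | true | false = contradiction (trans (sym (C⊆X e)) e′) λ ()
... | false | true = refl
... | false | false = refl

∩-partition : ∀ {n} (X C : Subset n) → Partition X (X ∩ C) (X ∖ C)
∩-partition X C x with C x | X x
... | true | true = refl
... | true | false = refl
... | false | true = refl
... | false | false = refl

count-mono : ∀ {n} {p q : Subset n} → (∀ {x} → x ∈ p → x ∈ q) → count p ≤ count q
count-mono {n} {p} {q} h = subst (count p ≤_) (sym (count-partition (∖-partition q p h))) (m≤m+n _ _)

count-suc : ∀ {n} {p q : Subset n} (a : Fin n) → a ∈ p → (∀ x → q x ≡ (p - a) x) → count p ≡ suc (count q)
count-suc {suc n} {p} {q} zero ap e
  rewrite ap | e zero | ap =
  cong suc (count-cong λ x → sym (trans (e (suc x)) (BoolP.∧-identityʳ _)))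
count-suc {suc n} {p} {q} (suc a) ap e = begin
  #b (p zero) + count (p ∘ suc) ≡⟨ cong₂ _+_ (cong #b (sym (trans (e zero) (BoolP.∧-identityʳ _))))
      (count-suc a ap λ x → trans (e (suc x)) (cong (λ b → p (suc x) ∧ not b) (suc== x a))) ⟩
  #b (q zero) + suc (count (q ∘ suc)) ≡⟨ +-suc _ _ ⟩
  suc (#b (q zero) + count (q ∘ suc)) ∎
  where
  open ≡-Reasoning
  suc== : ∀ {m} (x y : Fin m) → (Fin.suc x == suc y) ≡ (x == y)
  suc== x y with x FinP.≟ y
  ... | yes refl = refl
  ... | no _ = refl

count-delete : ∀ {n} {p : Subset n} (a : Fin n) → a ∈ p → count p ≡ suc (count (p - a))
count-delete a ap = count-suc a ap λ _ → refl

count-injection : ∀ {m n} {p : Subset m} {q : Subset n} (f : Fin m → Fin n) →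
  (∀ {x} → x ∈ p → f x ∈ q) → (∀ {x y} → x ∈ p → y ∈ p → f x ≡ f y → x ≡ y) → count p ≤ count q
count-injection {zero} f into inj = z≤n
count-injection {suc m} {n} {p} {q} f into inj with p zero in e
... | false = count-injection (f ∘ suc) into λ xp yp eq → FinP.suc-injective (inj xp yp eq)
... | true = subst (suc (count (p ∘ suc)) ≤_) (sym (count-delete (f zero) (into e)))
  (s≤s (count-injection (f ∘ suc)
    (λ xp → ∈-delete {X = q} (into xp) λ eq → case inj xp e eq of λ ())
    λ xp yp eq → FinP.suc-injective (inj xp yp eq)))

elements : ∀ {n} → Subset n → List (Fin n)
elements {zero} p = []
elements {suc n} p = (if p zero then zero ∷_ else id) (map suc (elements (p ∘ suc)))

length-elements : ∀ {n} (p : Subset n) → length (elements p) ≡ count p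
length-elements {zero} p = refl
length-elements {suc n} p with p zero
... | true = cong suc (trans (ListP.length-map Fin.suc (elements (p ∘ suc))) (length-elements (p ∘ suc)))
... | false = trans (ListP.length-map Fin.suc (elements (p ∘ suc))) (length-elements (p ∘ suc))

elements-∈ : ∀ {n} (p : Subset n) → All (_∈ p) (elements p)
elements-∈ {zero} p = []
elements-∈ {suc n} p with p zero in e
... | true = e ∷ AllP.map⁺ (elements-∈ (p ∘ suc))
... | false = AllP.map⁺ (elements-∈ (p ∘ suc))

elements-unique : ∀ {n} (p : Subset n) → AllPairs _≢_ (elements p)
elements-unique {zero} p = []
elements-unique {suc n} p with p zero
... | true = AllP.map⁺ (All.universal (λ _ ()) _) ∷ rest
  where rest = AllPairsP.map⁺ (AllPairs.map (λ ne eq → ne (FinP.suc-injective eq)) (elements-unique (p ∘ suc)))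
... | false = AllPairsP.map⁺ (AllPairs.map (λ ne eq → ne (FinP.suc-injective eq)) (elements-unique (p ∘ suc)))

length≤count : ∀ {n} {p : Subset n} {xs : List (Fin n)} → AllPairs _≢_ xs → All (_∈ p) xs → length xs ≤ count p
length≤count [] [] = z≤n
length≤count {p = p} {x ∷ xs} (x≢ ∷ u) (xp ∷ xsp) =
  subst (suc (length xs) ≤_) (sym (count-delete x xp))
    (s≤s (length≤count u (All.zipWith (λ (ne , yp) → ∈-delete {X = p} yp (ne ∘ sym)) (x≢ , xsp))))

count>0 : ∀ {n} {p : Subset n} → 0 < count p → ∃ λ x → x ∈ p
count>0 {p = p} h with elements p | length-elements p | elements-∈ p
... | [] | e | _ = contradiction (subst (0 <_) (sym e) h) λ ()
... | x ∷ _ | _ | xp ∷ _ = x , xp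

-- On `p` this is the increasing bijection onto the numbers below `count p`; it supplies colourings
-- in which each chosen vertex has its own colour.
rank : ∀ {n} → Subset n → Fin n → ℕ
rank p zero = 0
rank p (suc x) = #b (p zero) + rank (p ∘ suc) x

rank-< : ∀ {n} (p : Subset n) {x} → x ∈ p → rank p x < count p
rank-< p {zero} xp rewrite xp = s≤s z≤n
rank-< p {suc x} xp = +-monoʳ-< (#b (p zero)) (rank-< (p ∘ suc) xp)

rank-injective : ∀ {n} (p : Subset n) {x y} → x ∈ p → y ∈ p → rank p x ≡ rank p y → x ≡ y
rank-injective p {zero} {zero} xp yp e = refl
rank-injective p {zero} {suc y} xp yp e rewrite xp = contradiction e λ ()
rank-injective p {suc x} {zero} xp yp e rewrite yp = contradiction e λ ()
rank-injective p {suc x} {suc y} xp yp e =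
  cong suc (rank-injective (p ∘ suc) xp yp (+-cancelˡ-≡ (#b (p zero)) _ _ e))

-- Matchings and maximum matchings missing given vertices

-- `P` has to respect pointwise equality, since a function reassembled from its first value and the
-- rest agrees with the original only pointwise. Applied to matchings, this makes `Missing`
-- decidable.
anyFunction? : ∀ {m n} {P : (Fin m → Fin n) → Set} →
  (∀ {f g} → (∀ x → f x ≡ g x) → P f → P g) → (∀ f → Dec (P f)) → Dec (∃ P)
anyFunction? {zero} resp P? = map′ (λ p → _ , p) (λ (f , p) → resp (λ ()) p) (P? λ ())
anyFunction? {suc m} {P = P} resp P? = map′
  (λ (a , f , p) → _ , p)
  (λ (f , p) → f zero , f ∘ suc , resp (λ { zero → refl ; (suc _) → refl }) p)
  (FinP.any? λ a → anyFunction? {P = λ f → P (a Vector.∷ f)}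
    (λ e → resp λ { zero → refl ; (suc x) → e x })
    (λ f → P? (a Vector.∷ f)))

iterate : ∀ {A : Set} → (A → A) → ℕ → A → A
iterate f zero x = x
iterate f (suc m) x = f (iterate f m x)

iterate-+ : ∀ {A : Set} (f : A → A) a b x → iterate f (a + b) x ≡ iterate f a (iterate f b x)
iterate-+ f zero b x = refl
iterate-+ f (suc a) b x = cong f (iterate-+ f a b x)

iterate-* : ∀ {A : Set} (f : A → A) a b {x} → iterate f a x ≡ x → iterate f (b * a) x ≡ x
iterate-* f a zero e = refl
iterate-* f a (suc b) {x} e = trans (iterate-+ f a (b * a) x) (trans (cong (iterate f a) (iterate-* f a b e)) e)

iterate-injective : ∀ {A : Set} {f : A → A} → (∀ {x y} → f x ≡ f y → x ≡ y) →
  ∀ m {x y} → iterate f m x ≡ iterate f m y → x ≡ y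
iterate-injective inj zero e = e
iterate-injective inj (suc m) e = iterate-injective inj m (inj e)

-- The orbit of a fixed point u of the involution M under π = M ∘ N is closed under M and N.
-- If π ^ p fixes u, then M acts on it by j ↦ − j and N by j ↦ − j − 1 modulo p, so a second fixed
-- point of M needs p even and a fixed point of N needs p odd.
module TwoInvolutions {n} (M N : Fin n → Fin n) (MM : ∀ x → M (M x) ≡ x) (NN : ∀ x → N (N x) ≡ x)
  {u : Fin n} (Mu : M u ≡ u) where

  π : Fin n → Fin n
  π x = M (N x)

  π-injective : ∀ {x y} → π x ≡ π y → x ≡ y
  π-injective {x} {y} e = begin
    x ≡⟨ sym (NN x) ⟩
    N (N x) ≡⟨ cong N (sym (MM (N x))) ⟩
    N (M (π x)) ≡⟨ cong (N ∘ M) e ⟩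
    N (M (π y)) ≡⟨ cong N (MM (N y)) ⟩
    N (N y) ≡⟨ NN y ⟩
    y ∎
    where open ≡-Reasoning

  π^ : ℕ → Fin n
  π^ j = iterate π j u

  -- Conjugation by `M` inverts `π`, since M ∘ (M ∘ N) ∘ M = N ∘ M; hence π^j ∘ M ∘ π^j = M.
  reflect : ∀ j x → iterate π j (M (iterate π j x)) ≡ M x
  reflect zero x = refl
  reflect (suc j) x = begin
    π (iterate π j (M (π (iterate π j x)))) ≡⟨ cong (λ t → π (iterate π j t)) (MM _) ⟩
    π (iterate π j (N (iterate π j x))) ≡⟨ π-iterate j _ ⟩
    iterate π j (π (N (iterate π j x))) ≡⟨ cong (iterate π j) (cong M (NN _)) ⟩
    iterate π j (M (iterate π j x)) ≡⟨ reflect j x ⟩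
    M x ∎
    where
    open ≡-Reasoning
    π-iterate : ∀ j y → π (iterate π j y) ≡ iterate π j (π y)
    π-iterate zero y = refl
    π-iterate (suc j) y = cong π (π-iterate j y)

  period : ∃ λ p → iterate π (suc p) u ≡ u
  period with FinP.pigeonhole (n<1+n n) (λ i → π^ (toℕ i))
  ... | i , j , i<j , e = toℕ j ∸ suc (toℕ i) , iterate-injective π-injective (toℕ i) (begin
    iterate π (toℕ i) (iterate π (suc (toℕ j ∸ suc (toℕ i))) u) ≡⟨ sym (iterate-+ π (toℕ i) _ u) ⟩
    π^ (toℕ i + suc (toℕ j ∸ suc (toℕ i))) ≡⟨ cong π^ (trans (+-suc (toℕ i) _) (m+[n∸m]≡n i<j)) ⟩
    π^ (toℕ j) ≡⟨ sym e ⟩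
    π^ (toℕ i) ∎)
    where open ≡-Reasoning

  p : ℕ
  p = suc (proj₁ period)

  π^p : π^ p ≡ u
  π^p = proj₂ period

  orbit? : ∀ x → Dec (∃ λ (j : Fin p) → π^ (toℕ j) ≡ x)
  orbit? x = FinP.any? λ j → π^ (toℕ j) FinP.≟ x

  orbit : Subset n
  orbit x = does (orbit? x)

  π^∈orbit : ∀ j → π^ j ∈ orbit
  π^∈orbit j = dec-true (orbit? _) (fromℕ< (m%n<n j p) , (begin
    π^ (toℕ (fromℕ< (m%n<n j p))) ≡⟨ cong π^ (FinP.toℕ-fromℕ< (m%n<n j p)) ⟩
    π^ (j % p) ≡⟨ cong (iterate π (j % p)) (sym (iterate-* π p (j / p) π^p)) ⟩
    iterate π (j % p) (π^ (j / p * p)) ≡⟨ sym (iterate-+ π (j % p) _ u) ⟩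
    π^ (j % p + j / p * p) ≡⟨ cong π^ (sym (m≡m%n+[m/n]*n j p)) ⟩
    π^ j ∎))
    where open ≡-Reasoning

  orbit⁻ : ∀ {x} → x ∈ orbit → ∃ λ j → π^ j ≡ x
  orbit⁻ {x} xo = let (j , e) = does-true⁻ (orbit? x) xo in toℕ j , e

  -- M (π^j u) is π^(-j) u, because π^j maps it to M u = u. To keep exponents natural, -j is
  -- replaced by j (p - 1), where p - 1 is `proj₁ period`.
  Mπ^∈orbit : ∀ j → M (π^ j) ∈ orbit
  Mπ^∈orbit j = subst (_∈ orbit) (iterate-injective π-injective j (begin
    iterate π j (π^ (j * proj₁ period)) ≡⟨ sym (iterate-+ π j _ u) ⟩
    π^ (j + j * proj₁ period) ≡⟨ cong π^ (sym (*-suc j _)) ⟩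
    π^ (j * p) ≡⟨ iterate-* π p j π^p ⟩
    u ≡⟨ sym Mu ⟩
    M u ≡⟨ sym (reflect j u) ⟩
    iterate π j (M (π^ j)) ∎)) (π^∈orbit (j * proj₁ period))
    where open ≡-Reasoning

  M-orbit : ∀ {x} → x ∈ orbit → M x ∈ orbit
  M-orbit xo with orbit⁻ xo
  ... | j , refl = Mπ^∈orbit j

  N-orbit : ∀ {x} → x ∈ orbit → N x ∈ orbit
  N-orbit xo with orbit⁻ xo
  ... | j , refl = subst (_∈ orbit) (MM _) (Mπ^∈orbit (suc j))

  -- The parity of p need not be discussed: w = π^j u fixed by `M` gives π^(2j) u = u, v = π^i u
  -- fixed by `N` gives π^(2i+1) u = u, and j (2i + 1) = j + i (2j) turns these into u = π^j u = w.
  not-both : ∀ {v w} → N v ≡ v → M w ≡ w → v ∈ orbit → w ∈ orbit → u ≡ w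
  not-both Nv Mw vo wo with orbit⁻ vo | orbit⁻ wo
  ... | i , refl | j , refl = begin
    u ≡⟨ sym (iterate-* π _ j odd) ⟩
    π^ (j * (suc i + i)) ≡⟨ cong π^ (*-suc j (i + i)) ⟩
    π^ (j + j * (i + i)) ≡⟨ iterate-+ π j _ u ⟩
    iterate π j (π^ (j * (i + i))) ≡⟨ cong (iterate π j ∘ π^) swap ⟩
    iterate π j (π^ (i * (j + j))) ≡⟨ cong (iterate π j) (iterate-* π _ i even) ⟩
    π^ j ∎
    where
    open ≡-Reasoning
    even : π^ (j + j) ≡ u
    even = begin
      π^ (j + j) ≡⟨ iterate-+ π j j u ⟩
      iterate π j (π^ j) ≡⟨ cong (iterate π j) (sym Mw) ⟩
      iterate π j (M (π^ j)) ≡⟨ reflect j u ⟩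
      M u ≡⟨ Mu ⟩
      u ∎
    odd : π^ (suc i + i) ≡ u
    odd = begin
      π^ (suc i + i) ≡⟨ iterate-+ π (suc i) i u ⟩
      iterate π (suc i) (π^ i) ≡⟨ cong (iterate π (suc i)) (sym (trans (MM _) Nv)) ⟩
      iterate π (suc i) (M (π^ (suc i))) ≡⟨ reflect (suc i) u ⟩
      M u ≡⟨ Mu ⟩
      u ∎
    swap : j * (i + i) ≡ i * (j + j)
    swap = trans (*-distribˡ-+ j i i) (trans (cong₂ _+_ (*-comm j i) (*-comm j i)) (sym (*-distribˡ-+ i j j)))

_<ᶠ_ : ∀ {n} → Fin n → Fin n → Bool
x <ᶠ y = does (x FinP.<? y)

infix 4 _<ᶠ_

module Matchings {n} (H : Graph n) where

  -- A matching is the involution that exchanges the ends of its edges and fixes all other vertices.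
  -- So `M v ≡ v` says that v is missed, and alternating paths become orbits of two involutions.
  record Matching (X : Subset n) (M : Fin n → Fin n) : Set where
    field
      involutive : ∀ x → M (M x) ≡ x
      edge : ∀ x → M x ≢ x → adj H x (M x) ≡ true
      inside : ∀ x → M x ≢ x → x ∈ X
  open Matching

  -- Each edge is counted once, at its larger end.
  size : (Fin n → Fin n) → ℕ
  size M = count (λ x → M x <ᶠ x)

  image-inside : ∀ {X M} → Matching X M → ∀ x → M x ≢ x → M x ∈ X
  image-inside {X} {M} m x ne = inside m (M x) λ e → ne (trans (sym e) (involutive m x))

  matching-resp : ∀ {X} {M M′ : Fin n → Fin n} → (∀ x → M x ≡ M′ x) → Matching X M → Matching X M′
  matching-resp {M = M} {M′} e m = record
    { involutive = λ x → trans (sym (trans (cong M (e x)) (e (M′ x)))) (involutive m x)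
    ; edge = λ x ne → subst (λ t → adj H x t ≡ true) (e x) (edge m x (ne ∘ trans (sym (e x))))
    ; inside = λ x ne → inside m x (ne ∘ trans (sym (e x)))
    }

  size-resp : ∀ {M M′ : Fin n → Fin n} → (∀ x → M x ≡ M′ x) → size M ≡ size M′
  size-resp e = count-cong λ x → cong (_<ᶠ x) (e x)

  matching? : ∀ X M → Dec (Matching X M)
  matching? X M = map′
    (λ (i , e , s) → record { involutive = i
      ; edge = λ x ne → fromCond x ne (e x) ; inside = λ x ne → fromCond x ne (s x) })
    (λ m → involutive m , (λ x → toCond x (edge m x)) , (λ x → toCond x (inside m x)))
    (FinP.all? (λ x → M (M x) FinP.≟ x) ×-dec
     FinP.all? (λ x → cond? x (adj H x (M x))) ×-dec
     FinP.all? (λ x → cond? x (X x)))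
    where
    Cond : Fin n → Bool → Set
    Cond x b = (M x ≢ x → b ≡ true)
    cond? : ∀ x b → Dec (Cond x b)
    cond? x b with M x FinP.≟ x | b BoolP.≟ true
    ... | yes e | _ = yes λ ne → contradiction e ne
    ... | no _ | yes p = yes λ _ → p
    ... | no ne | no ¬p = no λ f → ¬p (f ne)
    fromCond : ∀ x {b} → M x ≢ x → Cond x b → b ≡ true
    fromCond x ne c = c ne
    toCond : ∀ x {b} → (M x ≢ x → b ≡ true) → Cond x b
    toCond x c = c

  -- Under `MatchingBound X k` the matching is a maximum one. The case u = v says that v alone is
  -- missed.
  Missing : Subset n → ℕ → Fin n → Fin n → Set
  Missing X k u v = ∃ λ M → Matching X M × k ≤ size M × M u ≡ u × M v ≡ v

  abstract
    missing? : ∀ X k u v → Dec (Missing X k u v)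
    missing? X k u v = anyFunction?
      (λ e (m , s , p , q) → matching-resp e m , subst (k ≤_) (size-resp e) s
        , trans (sym (e u)) p , trans (sym (e v)) q)
      (λ M → matching? X M ×-dec (k ≤? size M) ×-dec (M u FinP.≟ u) ×-dec (M v FinP.≟ v))

  empty-matching : ∀ X → Matching X id
  empty-matching X = record
    { involutive = λ _ → refl ; edge = λ x ne → contradiction refl ne ; inside = λ x ne → contradiction refl ne }

  adj⇒≢ : ∀ {x y} → adj H x y ≡ true → x ≢ y
  adj⇒≢ {x} p refl = true≢false (trans (sym p) (irrefl H x))

  private
    addEdge : (Fin n → Fin n) → Fin n → Fin n → Fin n → Fin n
    addEdge M x y z = if z == x then y else if z == y then x else M z

    addEdge-x : ∀ M x y → addEdge M x y x ≡ y
    addEdge-x M x y rewrite ==-refl x = refl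

    addEdge-y : ∀ M {x y} → x ≢ y → addEdge M x y y ≡ x
    addEdge-y M {x} {y} ne rewrite ==-≢ (ne ∘ sym) | ==-refl y = refl

    addEdge-z : ∀ M {x y z} → z ≢ x → z ≢ y → addEdge M x y z ≡ M z
    addEdge-z M p q rewrite ==-≢ p | ==-≢ q = refl

    -- The order of the ends matters for `size`: with x < y the new edge is counted at y, and no
    -- other vertex changes its contribution.
    ordered-augment : ∀ {X M x y} → Matching X M → x ∈ X → y ∈ X → adj H x y ≡ true →
      M x ≡ x → M y ≡ y → x Fin.< y → ∃ λ M′ → Matching X M′ × size M′ ≡ suc (size M)
    ordered-augment {X} {M} {x} {y} m xX yX xy Mx My x<y = M′ , m′ ,
      count-suc y (dec-true (_ FinP.<? _) (subst (Fin._< y) (sym M′y) x<y)) pointwise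
      where
      M′ : Fin n → Fin n
      M′ = addEdge M x y
      x≢y : x ≢ y
      x≢y = adj⇒≢ xy
      M′x : M′ x ≡ y
      M′x = addEdge-x M x y
      M′y : M′ y ≡ x
      M′y = addEdge-y M x≢y
      M-≢ : ∀ {w} → M w ≡ w → ∀ {z} → z ≢ w → M z ≢ w
      M-≢ {w} Mw {z} ne e = ne (trans (sym (involutive m z)) (trans (cong M e) Mw))
      m′ : Matching X M′
      m′ = record { involutive = inv ; edge = ed ; inside = ins }
        where
        inv : ∀ z → M′ (M′ z) ≡ z
        inv z with z FinP.≟ x | z FinP.≟ y
        ... | yes refl | _ = M′y
        ... | no _ | yes refl = M′x
        ... | no p | no q = trans (addEdge-z M (M-≢ Mx p) (M-≢ My q)) (involutive m z)
        ed : ∀ z → M′ z ≢ z → adj H z (M′ z) ≡ true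
        ed z ne with z FinP.≟ x | z FinP.≟ y
        ... | yes refl | _ = xy
        ... | no _ | yes refl = trans (Graph.sym H y x) xy
        ... | no p | no q = edge m z ne
        ins : ∀ z → M′ z ≢ z → z ∈ X
        ins z ne with z FinP.≟ x | z FinP.≟ y
        ... | yes refl | _ = xX
        ... | no _ | yes refl = yX
        ... | no p | no q = inside m z ne
      pointwise : ∀ z → (M z <ᶠ z) ≡ (M′ z <ᶠ z) ∧ not (z == y)
      pointwise z with z FinP.≟ x | z FinP.≟ y
      ... | yes refl | yes e = contradiction e x≢y
      ... | yes refl | no _ = trans (trans (cong (_<ᶠ z) Mx) (dec-false (z FinP.<? z) (FinP.<-irrefl refl)))
            (sym (trans (BoolP.∧-identityʳ _) (dec-false (y FinP.<? z) λ y<z → FinP.<-asym x<y y<z)))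
      ... | no _ | yes refl = trans (trans (cong (_<ᶠ z) My) (dec-false (z FinP.<? z) (FinP.<-irrefl refl)))
            (sym (BoolP.∧-zeroʳ _))
      ... | no p | no q = sym (BoolP.∧-identityʳ _)

  augment : ∀ {X M x y} → Matching X M → x ∈ X → y ∈ X → adj H x y ≡ true →
    M x ≡ x → M y ≡ y → ∃ λ M′ → Matching X M′ × size M′ ≡ suc (size M)
  augment {x = x} {y} m xX yX xy Mx My with FinP.<-cmp x y
  ... | tri< x<y _ _ = ordered-augment m xX yX xy Mx My x<y
  ... | tri≈ _ e _ = contradiction e (adj⇒≢ xy)
  ... | tri> _ _ y<x = ordered-augment m yX xX (trans (Graph.sym H y x) xy) My Mx y<x

  MatchingBound : Subset n → ℕ → Set
  MatchingBound X k = ∀ M → Matching X M → size M ≤ k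

  -- A set closed under both involutions is a union of components of the two matchings together, so
  -- exchanging them there leaves a matching.
  module Swap {X M N} (m : Matching X M) (m′ : Matching X N) (S : Subset n)
    (MS : ∀ {x} → x ∈ S → M x ∈ S) (NS : ∀ {x} → x ∈ S → N x ∈ S) where

    swap : Fin n → Fin n
    swap x = if S x then N x else M x

    swap-in : ∀ {x} → x ∈ S → swap x ≡ N x
    swap-in e rewrite e = refl

    swap-out : ∀ {x} → S x ≡ false → swap x ≡ M x
    swap-out e rewrite e = refl

    swap-matching : Matching X swap
    swap-matching = record { involutive = inv ; edge = ed ; inside = ins }
      where
      inv : ∀ x → swap (swap x) ≡ x
      inv x with S x in e
      ... | true = trans (swap-in (NS e)) (involutive m′ x)
      ... | false = trans (swap-out M∉S) (involutive m x)
        where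
        M∉S : S (M x) ≡ false
        M∉S with S (M x) in e′
        ... | false = refl
        ... | true = contradiction (trans (sym (subst (_∈ S) (involutive m x) (MS e′))) e) λ ()
      ed : ∀ x → swap x ≢ x → adj H x (swap x) ≡ true
      ed x ne with S x
      ... | true = edge m′ x ne
      ... | false = edge m x ne
      ins : ∀ x → swap x ≢ x → x ∈ X
      ins x ne with S x
      ... | true = inside m′ x ne
      ... | false = inside m x ne

  swap-sizes : ∀ (M N : Fin n → Fin n) (S : Subset n) →
    size (λ x → if S x then N x else M x) + size (λ x → if S x then M x else N x) ≡ size M + size N
  swap-sizes M N S = count-+-cong λ x → pointwise x
    where
    pointwise : ∀ x →
      #b ((if S x then N x else M x) <ᶠ x) + #b ((if S x then M x else N x) <ᶠ x) ≡ #b (M x <ᶠ x) + #b (N x <ᶠ x)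
    pointwise x with S x
    ... | true = +-comm (#b (N x <ᶠ x)) _
    ... | false = refl

  -- The orbit is the alternating path of `M` and `N` that starts at u. Exchanging along it keeps
  -- both matchings maximum, as the sum of their sizes is unchanged and each is at most k. If the
  -- path avoids v, the exchanged `N` misses u and v; if it meets v but not w, the exchanged `M`
  -- misses v and w. It cannot meet both, a path having only two ends.
  missing-transitive : ∀ {X k u v w} → MatchingBound X k → u ≢ w →
    Missing X k v v → Missing X k u w → Missing X k u v ⊎ Missing X k v w
  missing-transitive {X} {k} {u} {v} {w} ν u≢w (N , m′ , k≤N , Nv , _) (M , m , k≤M , Mu , Mw) =
    case ∈⊎∉ (orbit v) of λ
      { (inj₂ v∉) → inj₁ (_ , SwapM.swap-matching , +-cancelˡ-≤ k _ _ (begin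
            k + k ≤⟨ 2k≤ ⟩
            size SwapN.swap + size SwapM.swap ≤⟨ +-monoˡ-≤ _ (ν _ SwapN.swap-matching) ⟩
            k + size SwapM.swap ∎)
          , trans (SwapM.swap-in (π^∈orbit 0)) Mu , trans (SwapM.swap-out v∉) Nv)
      ; (inj₁ v∈) → case ∈⊎∉ (orbit w) of λ
        { (inj₁ w∈) → contradiction (not-both Nv Mw v∈ w∈) u≢w
        ; (inj₂ w∉) → inj₂ (_ , SwapN.swap-matching , +-cancelʳ-≤ k _ _ (begin
              k + k ≤⟨ 2k≤ ⟩
              size SwapN.swap + size SwapM.swap ≤⟨ +-monoʳ-≤ (size SwapN.swap) (ν _ SwapM.swap-matching) ⟩
              size SwapN.swap + k ∎)
            , trans (SwapN.swap-in v∈) Nv , trans (SwapN.swap-out w∉) Mw) } }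
    where
    open TwoInvolutions M N (involutive m) (involutive m′) Mu
    module SwapN = Swap m m′ orbit M-orbit N-orbit
    module SwapM = Swap m′ m orbit N-orbit M-orbit
    open ≤-Reasoning
    2k≤ : k + k ≤ size SwapN.swap + size SwapM.swap
    2k≤ = begin
      k + k ≤⟨ +-mono-≤ k≤M k≤N ⟩
      size M + size N ≡⟨ sym (swap-sizes M N orbit) ⟩
      size SwapN.swap + size SwapM.swap ∎

-- Independent sets in triangle-free graphs

count-≤-suc : ∀ {n} (p : Subset n) a → count p ≤ suc (count (p - a))
count-≤-suc p a with p a in e
... | true = ≤-reflexive (count-delete a e)
... | false = ≤-trans (count-mono {p = p} {p - a} (λ {x} xp → ∈-delete {X = p} xp λ { refl → true≢false (trans (sym xp) e) })) (n≤1+n _)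

count≤length : ∀ {n} {p : Subset n} (xs : List (Fin n)) → (∀ {x} → x ∈ p → Any (x ≡_) xs) → count p ≤ length xs
count≤length {p = p} [] cover with count p in e
... | zero = z≤n
... | suc c with () ← cover (proj₂ (count>0 {p = p} (subst (0 <_) (sym e) (s≤s z≤n))))
count≤length {p = p} (a ∷ xs) cover = ≤-trans (count-≤-suc p a) (s≤s (count≤length xs cover′))
  where
  cover′ : ∀ {x} → x ∈ (p - a) → Any (x ≡_) xs
  cover′ xp with ∈-delete⁻ {X = p} xp
  ... | xp′ , ne with cover xp′
  ... | here e = contradiction e ne
  ... | there i = i

module Independence {n} (H : Graph n) where

  Apart : Fin n → Fin n → Set
  Apart x y = x ≢ y × adj H x y ≡ false

  IndependentSet : Subset n → ℕ → Set
  IndependentSet X a = ∃ λ xs → length xs ≡ a × All (_∈ X) xs × AllPairs Apart xs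

  TriangleFree : Subset n → Set
  TriangleFree X = ∀ {x y z} → x ∈ X → y ∈ X → z ∈ X →
    adj H x y ≡ true → adj H y z ≡ true → adj H x z ≡ true → ⊥

  independent-mono : ∀ {X Y a} → (∀ {x} → x ∈ X → x ∈ Y) → IndependentSet X a → IndependentSet Y a
  independent-mono s (xs , l , i , p) = xs , l , All.map s i , p

  independent-take : ∀ {X a b} → b ≤ a → IndependentSet X a → IndependentSet X b
  independent-take {b = b} b≤a (xs , refl , i , p) =
    take b xs , trans (ListP.length-take b xs) (m≤n⇒m⊓n≡m b≤a) , AllP.take⁺ b i , AllPairsP.take⁺ b p

  elements-independent : ∀ X → (∀ {x y} → x ∈ X → y ∈ X → adj H x y ≡ false) → IndependentSet X (count X)
  elements-independent X ind = elements X , length-elements X , elements-∈ X ,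
    go (elements-∈ X) (elements-unique X)
    where
    go : ∀ {xs} → All (_∈ X) xs → AllPairs _≢_ xs → AllPairs Apart xs
    go [] [] = []
    go (xi ∷ i) (xu ∷ u) = All.zipWith (λ (yi , ne) → ne , ind xi yi) (i , xu) ∷ go i u

  nonneighbours : Subset n → Fin n → Subset n
  nonneighbours X v = (X - v) ∖ adj H v

  nonneighbours⁻ : ∀ {X v x} → x ∈ nonneighbours X v → x ∈ X × Apart v x
  nonneighbours⁻ {X} {v} p with ∈-∖⁻ {X = X - v} {adj H v} p
  ... | q , f with ∈-delete⁻ {X = X} q
  ... | xX , ne = xX , ne ∘ sym , f

  independent-cons : ∀ {X v a} → v ∈ X → IndependentSet (nonneighbours X v) a → IndependentSet X (suc a)
  independent-cons {X} {v} vX (xs , l , i , p) = v ∷ xs , cong suc l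
    , vX ∷ All.map (λ h → proj₁ (nonneighbours⁻ {X} h)) i
    , All.map (λ h → proj₂ (nonneighbours⁻ {X} h)) i ∷ p

  degree : Subset n → Fin n → ℕ
  degree X v = count (X ∩ adj H v)

  count-neighbours : ∀ {X v} → v ∈ X →
    count X ≡ suc (count ((X - v) ∩ adj H v) + count (nonneighbours X v))
  count-neighbours {X} {v} vX = trans (count-delete v vX) (cong suc (count-partition (∩-partition (X - v) (adj H v))))

  count-≤-degree : ∀ {X v} → v ∈ X → count X ≤ suc (degree X v + count (nonneighbours X v))
  count-≤-degree {X} {v} vX = ≤-trans (≤-reflexive (count-neighbours vX))
    (s≤s (+-monoˡ-≤ _ (count-mono {p = (X - v) ∩ adj H v} {q = X ∩ adj H v}
      λ {x} h → let (p , q) = ∧-true⁻ {(X - v) x} h in ∧-true (proj₁ (∈-delete⁻ {X = X} p)) q)))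

  neighbours-independent : ∀ {X v} → TriangleFree X → v ∈ X → IndependentSet (X ∩ adj H v) (degree X v)
  neighbours-independent {X} {v} tf vX = elements-independent _ λ {x} {y} p q →
    let (xX , vx) = ∧-true⁻ {X x} p ; (yX , vy) = ∧-true⁻ {X y} q in
    [ (λ xy → ⊥-elim (tf vX xX yX vx xy vy)) , id ]′ (∈⊎∉ (adj H x y))

  RamseyBound : ℕ → ℕ → Set
  RamseyBound q m = ∀ X → TriangleFree X → m ≤ count X → IndependentSet X q

  ramsey-zero : RamseyBound 0 0
  ramsey-zero X tf m≤ = [] , refl , [] , []

  -- If v has more than q neighbours, these are independent. Otherwise at least m vertices remain
  -- besides v and its neighbours, and v extends an independent set among them. This is R(3, q + 1)
  -- ≤ R(3, q) + q + 1.
  ramsey-suc : ∀ {q m} → RamseyBound q m → RamseyBound (suc q) (suc q + m)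
  ramsey-suc {q} {m} R X tf m≤ with count>0 {p = X} (≤-trans (s≤s z≤n) m≤)
  ... | v , vX with suc q ≤? degree X v
  ... | yes q<d = independent-take q<d
          (independent-mono (λ {x} h → proj₁ (∧-true⁻ {X x} h)) (neighbours-independent tf vX))
  ... | no q≮d = independent-cons vX (R (nonneighbours X v)
          (λ a b c → tf (proj₁ (nonneighbours⁻ {X} a)) (proj₁ (nonneighbours⁻ {X} b)) (proj₁ (nonneighbours⁻ {X} c)))
          (+-cancelˡ-≤ q _ _ (s≤s⁻¹ (begin
            suc q + m ≤⟨ m≤ ⟩
            count X ≤⟨ count-≤-degree vX ⟩
            suc (degree X v + count (nonneighbours X v)) ≤⟨ s≤s (+-monoˡ-≤ _ (s≤s⁻¹ (≰⇒> q≮d))) ⟩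
            suc (q + count (nonneighbours X v)) ∎))))
    where open ≤-Reasoning

  record Copy {p} (pat : Fin p → Fin p → Bool) (X : Subset n) : Set where
    field
      vertex : Fin p → Fin n
      injective : ∀ {i j} → vertex i ≡ vertex j → i ≡ j
      member : ∀ i → vertex i ∈ X
      edges : ∀ i j → pat i j ≡ true → adj H (vertex i) (vertex j) ≡ true

  copy-covers : ∀ {p pat X} (e : Copy {p} pat X) → count X ≡ p → ∀ {x} → x ∈ X → ∃ λ i → Copy.vertex e i ≡ x
  copy-covers {p} {pat} {X} e c {x} xX with FinP.any? (λ i → Copy.vertex e i FinP.≟ x)
  ... | yes h = h
  ... | no ¬h = contradiction (begin
      suc p ≡⟨ cong suc (sym (count-full p)) ⟩
      suc (count {p} λ _ → true) ≤⟨ s≤s (count-injection {q = X - x} (Copy.vertex e)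
          (λ {i} _ → ∈-delete {X = X} (Copy.member e i) λ h → ¬h (i , h)) λ _ _ → Copy.injective e) ⟩
      suc (count (X - x)) ≡⟨ sym (count-delete x xX) ⟩
      count X ≡⟨ c ⟩
      p ∎) (<-irrefl refl)
    where open ≤-Reasoning

  independent? : ∀ X a → Dec (IndependentSet X a)
  independent? X zero = yes ([] , refl , [] , [])
  independent? X (suc a) = map′
    (λ (v , vX , I) → independent-cons vX I)
    (λ { (v ∷ xs , l , vX ∷ i , vp ∷ p) → v , vX , xs , suc-injective l
        , All.zipWith (λ (xX , ne , f) → ∈-∖ {X = X - v} {adj H v} (∈-delete {X = X} xX (ne ∘ sym)) f) (i , vp) , p })
    (FinP.any? λ v → (X v BoolP.≟ true) ×-dec independent? (nonneighbours X v) a)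

-- Certified search for labelled subgraphs

-- A search tree for a copy of a pattern in a triangle-free graph in which vertices are labelled one
-- after the other, starting from a given labelled part.
data Tree (p : ℕ) : Set where
  independent : List ℕ → Tree p
  codegree : ℕ → ℕ → List ℕ → Tree p
  overfull : Tree p
  found : Vec ℕ p → Tree p
  split : ℕ → ℕ → Tree p → Tree p → Tree p
  newVertex : Tree p → Tree p
  newNeighbour : ℕ → Tree p → Tree p
  newCommon : ℕ → ℕ → Tree p → Tree p

Pairs : Set
Pairs = List (ℕ × ℕ)

holds? : Pairs → ℕ → ℕ → Bool
holds? [] i j = false
holds? ((a , b) ∷ E) i j = ((a ≡ᵇ i) ∧ (b ≡ᵇ j)) ∨ holds? E i j

insert : ℕ → ℕ → Pairs → Pairs
insert i j E = (i , j) ∷ (j , i) ∷ E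

allBelow : ℕ → (ℕ → Bool) → Bool
allBelow zero f = true
allBelow (suc k) f = f k ∧ allBelow k f

anyBelow : ℕ → (ℕ → Bool) → Bool
anyBelow zero f = false
anyBelow (suc k) f = f k ∨ anyBelow k f

filterBelow : ℕ → (ℕ → Bool) → List ℕ
filterBelow zero f = []
filterBelow (suc k) f = if f k then k ∷ filterBelow k f else filterBelow k f

allOf : List ℕ → (ℕ → Bool) → Bool
allOf [] f = true
allOf (k ∷ ks) f = f k ∧ allOf ks f

allPairsOf : List ℕ → (ℕ → ℕ → Bool) → Bool
allPairsOf [] f = true
allPairsOf (k ∷ ks) f = allOf ks (f k) ∧ allPairsOf ks f

-- In a graph on N vertices with all degrees equal to d, q = d + 1 is the size of an excluded
-- independent set and c an excluded codegree of two nonadjacent vertices.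
module Checker (N d c : ℕ) {p} (pat : Fin p → Fin p → Bool) where

  module Known (l : ℕ) (E F : Pairs) where
    edge? nonedge? distinct? apart? : ℕ → ℕ → Bool
    edge? = holds? E
    -- Labels with a known common neighbour are nonadjacent because there is no triangle; such
    -- nonedges are never recorded in `F`.
    nonedge? i j = holds? F i j ∨ anyBelow l (λ k → edge? i k ∧ edge? j k)
    distinct? i j = not (i ≡ᵇ j)
    apart? i j = distinct? i j ∧ nonedge? i j

    notNeighbour? : ℕ → ℕ → Bool
    notNeighbour? i k = nonedge? i k ∨ (i ≡ᵇ k)

    found? : Vec ℕ p → Fin p → Fin p → Bool
    found? ks i j = (lookup ks i <ᵇ l) ∧ (((i == j) ∨ distinct? (lookup ks i) (lookup ks j)) ∧
      (not (pat i j) ∨ edge? (lookup ks i) (lookup ks j)))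

  open Known

  -- The guards ensure that an added vertex is new. For `newNeighbour`, the relation of i to every
  -- label is settled and fewer than d labels are neighbours; for `newCommon`, no label can be
  -- adjacent to both i and j.
  check : Tree p → ℕ → Pairs → Pairs → Bool
  check (independent ks) l E F =
    (length ks ≡ᵇ suc d) ∧ (allOf ks (_<ᵇ l) ∧ allPairsOf ks (apart? l E F))
  check (codegree i j ks) l E F = ((i <ᵇ l) ∧ ((j <ᵇ l) ∧ apart? l E F i j)) ∧ ((length ks ≡ᵇ c) ∧
    (allOf ks (λ k → (k <ᵇ l) ∧ (edge? l E F i k ∧ edge? l E F j k)) ∧ allPairsOf ks (distinct? l E F)))
  check overfull l E F = N <ᵇ l
  check (found ks) l E F = does (FinP.all? λ i → FinP.all? λ j → found? l E F ks i j BoolP.≟ true)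
  check (split i j t u) l E F = ((i <ᵇ l) ∧ (j <ᵇ l)) ∧ (check t l (insert i j E) F ∧ check u l E (insert i j F))
  check (newVertex t) l E F = (l <ᵇ N) ∧ check t (suc l) E F
  check (newNeighbour i t) l E F = ((i <ᵇ l) ∧ (allBelow l (λ k → edge? l E F i k ∨ notNeighbour? l E F i k) ∧
    (length (filterBelow l (edge? l E F i)) <ᵇ d))) ∧ check t (suc l) (insert i l E) F
  check (newCommon i j t) l E F = ((i <ᵇ l) ∧ ((j <ᵇ l) ∧ (apart? l E F i j ∧
    allBelow l (λ k → notNeighbour? l E F i k ∨ notNeighbour? l E F j k)))) ∧
    check t (suc l) (insert i l (insert j l E)) F

-- Soundness of the search

∨-true⁻ : ∀ {a b} → a ∨ b ≡ true → a ≡ true ⊎ b ≡ true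
∨-true⁻ {true} _ = inj₁ refl
∨-true⁻ {false} e = inj₂ e

≡ᵇ-true⁻ : ∀ m n → (m ≡ᵇ n) ≡ true → m ≡ n
≡ᵇ-true⁻ m n e = ≡ᵇ⇒≡ m n (subst T (sym e) tt)

<ᵇ-true⁻ : ∀ m n → (m <ᵇ n) ≡ true → m < n
<ᵇ-true⁻ m n e = <ᵇ⇒< m n (subst T (sym e) tt)

distinct⁻ : ∀ m n → not (m ≡ᵇ n) ≡ true → m ≢ n
distinct⁻ m .m e refl = true≢false (trans (sym (T≡true (≡⇒≡ᵇ m m refl))) (not-true⁻ e))
  where
  T≡true : ∀ {b} → T b → b ≡ true
  T≡true {true} _ = refl

holds-sound : ∀ {E i j} {P : ℕ × ℕ → Set} → All P E → holds? E i j ≡ true → P (i , j)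
holds-sound {(a , b) ∷ E} {i} {j} (p ∷ ps) e with ∨-true⁻ {(a ≡ᵇ i) ∧ (b ≡ᵇ j)} e
... | inj₂ e′ = holds-sound ps e′
... | inj₁ e′ with ∧-true⁻ {a ≡ᵇ i} e′
... | e₁ , e₂ with ≡ᵇ-true⁻ a i e₁ | ≡ᵇ-true⁻ b j e₂
... | refl | refl = p

allBelow-sound : ∀ {f} l → allBelow l f ≡ true → ∀ {k} → k < l → f k ≡ true
allBelow-sound {f} (suc l) e {k} k<l with ∧-true⁻ {f l} e | m≤n⇒m<n∨m≡n (s≤s⁻¹ k<l)
... | _ , e′ | inj₁ k<l′ = allBelow-sound l e′ k<l′
... | e′ , _ | inj₂ refl = e′

anyBelow-sound : ∀ {f} l → anyBelow l f ≡ true → ∃ λ k → k < l × f k ≡ true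
anyBelow-sound {f} (suc l) e with ∨-true⁻ {f l} e
... | inj₁ e′ = l , n<1+n l , e′
... | inj₂ e′ = let (k , k<l , e″) = anyBelow-sound l e′ in k , m<n⇒m<1+n k<l , e″

allOf-sound : ∀ {f} ks → allOf ks f ≡ true → All (λ k → f k ≡ true) ks
allOf-sound [] e = []
allOf-sound {f} (k ∷ ks) e = let (p , q) = ∧-true⁻ {f k} e in p ∷ allOf-sound ks q

allPairsOf-sound : ∀ {f} ks → allPairsOf ks f ≡ true → AllPairs (λ j k → f j k ≡ true) ks
allPairsOf-sound [] e = []
allPairsOf-sound {f} (k ∷ ks) e = let (p , q) = ∧-true⁻ {allOf ks (f k)} e in
  allOf-sound ks p ∷ allPairsOf-sound ks q

filterBelow-∈ : ∀ {f} l {k} → k < l → f k ≡ true → Any (k ≡_) (filterBelow l f)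
filterBelow-∈ {f} (suc l) {k} k<l fk with f l in e | m≤n⇒m<n∨m≡n (s≤s⁻¹ k<l)
... | true | inj₂ refl = here refl
... | true | inj₁ k<l′ = there (filterBelow-∈ l k<l′ fk)
... | false | inj₂ refl = contradiction (trans (sym fk) e) λ ()
... | false | inj₁ k<l′ = filterBelow-∈ l k<l′ fk

-- d = e + 1, so that the excluded independent sets have e + 2 elements.
module Search {n} (H : Graph n) (X : Subset n) {e m m′ c : ℕ}
  (tf : Independence.TriangleFree H X) (no-independent : ¬ Independence.IndependentSet H X (suc (suc e)))
  (R : Independence.RamseyBound H (suc e) m) (m≤ : m + suc e ≤ count X)
  (R′ : Independence.RamseyBound H e m′) (m′≤ : m′ + (2 + (suc e + suc e)) ≤ count X + c)
  {p} (pat : Fin p → Fin p → Bool) where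

  open Independence H

  d : ℕ
  d = suc e

  -- Otherwise at least m vertices are nonadjacent to v, and R(3, d) ≤ m yields d independent ones
  -- among them, to which v can be added. Together with `degree≤d` this makes the graph d-regular.
  d≤degree : ∀ {v} → v ∈ X → d ≤ degree X v
  d≤degree {v} vX with d ≤? degree X v
  ... | yes h = h
  ... | no h = contradiction (independent-cons vX (R (nonneighbours X v)
          (λ a b c → tf (proj₁ (nonneighbours⁻ {X} a)) (proj₁ (nonneighbours⁻ {X} b)) (proj₁ (nonneighbours⁻ {X} c)))
          (+-cancelʳ-≤ d _ _ (begin
            m + d ≤⟨ m≤ ⟩
            count X ≤⟨ count-≤-degree vX ⟩
            suc (degree X v + count (nonneighbours X v)) ≤⟨ +-monoˡ-≤ _ (≰⇒> h) ⟩
            d + count (nonneighbours X v) ≡⟨ +-comm d _ ⟩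
            count (nonneighbours X v) + d ∎)))) no-independent
    where open ≤-Reasoning

  degree≤d : ∀ {v} → v ∈ X → degree X v ≤ d
  degree≤d {v} vX with degree X v ≤? d
  ... | yes h = h
  ... | no h = contradiction (independent-take (≰⇒> h)
    (independent-mono (λ {x} a → proj₁ (∧-true⁻ {X x} a)) (neighbours-independent tf vX))) no-independent

  -- If there were none, y and d neighbours of x would form an independent set of size d + 1.
  common-neighbour : ∀ {x y} → x ∈ X → y ∈ X → Apart x y →
    ∃ λ z → z ∈ X × adj H x z ≡ true × adj H y z ≡ true
  common-neighbour {x} {y} xX yX (x≢y , x≁y)
    with FinP.any? (λ z → (X z BoolP.≟ true) ×-dec (adj H x z BoolP.≟ true) ×-dec (adj H y z BoolP.≟ true))
  ... | yes h = h
  ... | no ¬h = contradiction (independent-cons yX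
      (independent-mono apart (independent-take (d≤degree xX) (neighbours-independent tf xX)))) no-independent
    where
    apart : ∀ {z} → z ∈ (X ∩ adj H x) → z ∈ nonneighbours X y
    apart {z} h with ∧-true⁻ {X z} h
    ... | zX , xz = ∈-∖ {X = X - y} {adj H y}
      (∈-delete {X = X} zX λ { refl → true≢false (trans (sym xz) x≁y) })
      ([ (λ yz → contradiction (z , zX , xz , yz) ¬h) , id ]′ (∈⊎∉ (adj H y z)))

  -- With c common neighbours, x and y have at most 2d - c neighbours in all, so at least m′ further
  -- vertices are adjacent to neither. Among these there are e independent ones, which x and y
  -- complete to an excluded set.
  codegree<c : ∀ {x y zs} → x ∈ X → y ∈ X → Apart x y → length zs ≡ c → AllPairs _≢_ zs →
    All (λ z → z ∈ X × adj H x z ≡ true × adj H y z ≡ true) zs → ⊥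
  codegree<c {x} {y} {zs} xX yX (x≢y , x≁y) lzs uzs zsX = no-independent
    (independent-cons xX (independent-cons y∈ (R′ Z (λ a b c → tf (Z⊆X a) (Z⊆X b) (Z⊆X c)) m′≤Z)))
    where
    open ≤-Reasoning
    Y Z B : Subset n
    Y = nonneighbours X x
    Z = nonneighbours Y y
    B = X ∩ adj H y
    y∈ : y ∈ Y
    y∈ = ∈-∖ {X = X - x} {adj H x} (∈-delete {X = X} yX (x≢y ∘ sym)) x≁y
    Z⊆X : ∀ {z} → z ∈ Z → z ∈ X
    Z⊆X h = proj₁ (nonneighbours⁻ {X} (proj₁ (nonneighbours⁻ {Y} h)))
    c+ : c + degree Y y ≤ d
    c+ = begin
      c + degree Y y ≤⟨ +-mono-≤
        (subst (_≤ count (B ∩ adj H x)) lzs (length≤count uzs (All.map (λ (a , b , c) → ∧-true (∧-true a c) b) zsX)))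
        (count-mono {p = Y ∩ adj H y} {q = B ∖ adj H x} λ {z} h →
          let (zY , yz) = ∧-true⁻ {Y z} h ; (zX , _ , xz) = nonneighbours⁻ {X} zY in ∈-∖ {X = B} {adj H x} (∧-true zX yz) xz) ⟩
      count (B ∩ adj H x) + count (B ∖ adj H x) ≡⟨ sym (count-partition (∩-partition B (adj H x))) ⟩
      degree X y ≤⟨ degree≤d yX ⟩
      d ∎
    m′≤Z : m′ ≤ count Z
    m′≤Z = +-cancelʳ-≤ (2 + (d + d)) _ _ (begin
      m′ + (2 + (d + d)) ≤⟨ m′≤ ⟩
      count X + c ≤⟨ +-monoˡ-≤ c (≤-trans (count-≤-degree xX) (s≤s (+-mono-≤ (degree≤d xX) (count-≤-degree y∈)))) ⟩
      suc (d + suc (degree Y y + count Z)) + c ≡⟨ cong (λ t → suc t + c) (+-suc d _) ⟩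
      2 + (d + (degree Y y + count Z) + c) ≡⟨ cong (2 +_) (+-assoc d _ c) ⟩
      2 + (d + (degree Y y + count Z + c)) ≡⟨ cong (λ t → 2 + (d + t)) (+-comm _ c) ⟩
      2 + (d + (c + (degree Y y + count Z))) ≡⟨ cong (λ t → 2 + (d + t)) (sym (+-assoc c _ _)) ⟩
      2 + (d + (c + degree Y y + count Z)) ≤⟨ +-monoʳ-≤ 2 (+-monoʳ-≤ d (+-monoˡ-≤ _ c+)) ⟩
      2 + (d + (d + count Z)) ≡⟨ cong (2 +_) (sym (+-assoc d d _)) ⟩
      2 + (d + d) + count Z ≡⟨ +-comm (2 + (d + d)) _ ⟩
      count Z + (2 + (d + d)) ∎)

  record Labelling (ρ : ℕ → Fin n) (l : ℕ) (E F : Pairs) : Set where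
    field
      member : ∀ {k} → k < l → ρ k ∈ X
      injective : ∀ {j k} → j < l → k < l → ρ j ≡ ρ k → j ≡ k
      edges : All (λ (i , j) → i < l × j < l × adj H (ρ i) (ρ j) ≡ true) E
      nonedges : All (λ (i , j) → i < l × j < l × adj H (ρ i) (ρ j) ≡ false) F

  extend : (ℕ → Fin n) → ℕ → Fin n → ℕ → Fin n
  extend ρ l z k = if k ≡ᵇ l then z else ρ k

  extend-old : ∀ {ρ l} z {k} → k < l → extend ρ l z k ≡ ρ k
  extend-old {l = l} z {k} k<l with k ≡ᵇ l in e
  ... | true = contradiction (≡ᵇ-true⁻ k l e) (<⇒≢ k<l)
  ... | false = refl

  extend-new : ∀ {ρ l} z → extend ρ l z l ≡ z
  extend-new {l = l} z with l ≡ᵇ l in e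
  ... | true = refl
  ... | false = contradiction refl (distinct⁻ l l (cong not e))

  module _ {ρ l E F} (L : Labelling ρ l E F) where
    open Labelling L
    open Checker.Known (count X) d c pat l E F

    edge-sound : ∀ {i j} → edge? i j ≡ true → adj H (ρ i) (ρ j) ≡ true
    edge-sound h = proj₂ (proj₂ (holds-sound edges h))

    nonedge-sound : ∀ {i j} → i < l → j < l → nonedge? i j ≡ true → adj H (ρ i) (ρ j) ≡ false
    nonedge-sound {i} {j} i<l j<l h with ∨-true⁻ {holds? F i j} h
    ... | inj₁ h′ = proj₂ (proj₂ (holds-sound nonedges h′))
    ... | inj₂ h′ with anyBelow-sound l h′
    ... | k , k<l , h″ with ∧-true⁻ {edge? i k} h″ | ∈⊎∉ (adj H (ρ i) (ρ j))
    ... | _ | inj₂ f = f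
    ... | ik , jk | inj₁ ij = ⊥-elim (tf (member i<l) (member j<l) (member k<l) ij (edge-sound jk) (edge-sound ik))

    apart-sound : ∀ {i j} → i < l → j < l → apart? i j ≡ true → Apart (ρ i) (ρ j)
    apart-sound {i} {j} i<l j<l h with ∧-true⁻ {distinct? i j} h
    ... | p , q = distinct⁻ i j p ∘ injective i<l j<l , nonedge-sound i<l j<l q

    notNeighbour-sound : ∀ {i k} → i < l → k < l → notNeighbour? i k ≡ true → adj H (ρ i) (ρ k) ≡ false
    notNeighbour-sound {i} {k} i<l k<l h with ∨-true⁻ {nonedge? i k} h
    ... | inj₁ h′ = nonedge-sound i<l k<l h′
    ... | inj₂ h′ = subst (λ t → adj H (ρ i) (ρ t) ≡ false) (≡ᵇ-true⁻ i k h′) (irrefl H (ρ i))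

    insert-edge : ∀ {i j} → i < l → j < l → adj H (ρ i) (ρ j) ≡ true → Labelling ρ l (insert i j E) F
    insert-edge i<l j<l h = record { member = member ; injective = injective ; nonedges = nonedges
      ; edges = (i<l , j<l , h) ∷ (j<l , i<l , trans (Graph.sym H _ _) h) ∷ edges }

    insert-nonedge : ∀ {i j} → i < l → j < l → adj H (ρ i) (ρ j) ≡ false → Labelling ρ l E (insert i j F)
    insert-nonedge i<l j<l h = record { member = member ; injective = injective ; edges = edges
      ; nonedges = (i<l , j<l , h) ∷ (j<l , i<l , trans (Graph.sym H _ _) h) ∷ nonedges }

    New : Fin n → Set
    New z = ∀ k → k < l → ρ k ≢ z

    new? : ∀ z → Dec (New z)
    new? z = map′
      (λ h k k<l → subst (λ t → ρ t ≢ z) (FinP.toℕ-fromℕ< k<l) (h (fromℕ< k<l)))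
      (λ h k → h (toℕ k) (FinP.toℕ<n k))
      (FinP.all? λ (k : Fin l) → ¬? (ρ (toℕ k) FinP.≟ z))

    old : ∀ {z} → ¬ New z → ∃ λ k → k < l × ρ k ≡ z
    old {z} ¬new with FinP.any? (λ (k : Fin l) → ρ (toℕ k) FinP.≟ z)
    ... | yes (k , e) = toℕ k , FinP.toℕ<n k , e
    ... | no h = contradiction (λ k k<l e → h (fromℕ< k<l , trans (cong ρ (FinP.toℕ-fromℕ< k<l)) e)) ¬new

    new-in : (Y : Subset n) (ks : List ℕ) → (∀ {k} → k < l → ρ k ∈ Y → Any (k ≡_) ks) →
      length ks < count Y → ∃ λ z → z ∈ Y × New z
    new-in Y ks cover h with FinP.any? (λ z → (Y z BoolP.≟ true) ×-dec new? z)
    ... | yes z = z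
    ... | no ¬z = contradiction h (≤⇒≯ (≤-trans (count≤length {p = Y} (map ρ ks) covered)
            (≤-reflexive (ListP.length-map ρ ks))))
      where
      covered : ∀ {x} → x ∈ Y → Any (x ≡_) (map ρ ks)
      covered {x} xY with new? x
      ... | yes new = contradiction (x , xY , new) ¬z
      ... | no ¬new with old ¬new
      ... | k , k<l , refl = AnyP.map⁺ (Any.map (cong ρ) (cover k<l xY))

    extend-labelling : ∀ {z} → z ∈ X → New z → Labelling (extend ρ l z) (suc l) E F
    extend-labelling {z} zX new = record
      { member = mem ; injective = inj ; edges = All.map facts edges ; nonedges = All.map facts nonedges }
      where
      mem : ∀ {k} → k < suc l → extend ρ l z k ∈ X
      mem k< with m≤n⇒m<n∨m≡n (s≤s⁻¹ k<)
      ... | inj₁ k<l = subst (_∈ X) (sym (extend-old {ρ} {l} z k<l)) (member k<l)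
      ... | inj₂ refl = subst (_∈ X) (sym (extend-new {ρ} {l} z)) zX
      inj : ∀ {j k} → j < suc l → k < suc l → extend ρ l z j ≡ extend ρ l z k → j ≡ k
      inj j< k< h with m≤n⇒m<n∨m≡n (s≤s⁻¹ j<) | m≤n⇒m<n∨m≡n (s≤s⁻¹ k<)
      ... | inj₁ j<l | inj₁ k<l = injective j<l k<l (trans (sym (extend-old {ρ} {l} z j<l)) (trans h (extend-old {ρ} {l} z k<l)))
      ... | inj₁ j<l | inj₂ refl = contradiction (trans (sym (extend-old {ρ} {l} z j<l)) (trans h (extend-new {ρ} {l} z))) (new _ j<l)
      ... | inj₂ refl | inj₁ k<l = contradiction (trans (sym (extend-old {ρ} {l} z k<l)) (trans (sym h) (extend-new {ρ} {l} z))) (new _ k<l)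
      ... | inj₂ refl | inj₂ refl = refl
      facts : ∀ {b} {ij : ℕ × ℕ} → (proj₁ ij < l × proj₂ ij < l × adj H (ρ (proj₁ ij)) (ρ (proj₂ ij)) ≡ b) →
        proj₁ ij < suc l × proj₂ ij < suc l × adj H (extend ρ l z (proj₁ ij)) (extend ρ l z (proj₂ ij)) ≡ b
      facts (i<l , j<l , h) = m<n⇒m<1+n i<l , m<n⇒m<1+n j<l ,
        trans (cong₂ (adj H) (extend-old {ρ} {l} z i<l) (extend-old {ρ} {l} z j<l)) h

  open Checker (count X) d c pat using (check)

  insert-new : ∀ {ρ l E F i z} (L : Labelling (extend ρ l z) (suc l) E F) → i < l →
    adj H (ρ i) z ≡ true → Labelling (extend ρ l z) (suc l) (insert i l E) F
  insert-new {ρ} {l} {z = z} L i<l h = insert-edge L (m<n⇒m<1+n i<l) (n<1+n _)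
    (trans (cong₂ (adj H) (extend-old {ρ} {l} z i<l) (extend-new {ρ} {l} z)) h)

  pairs-sound : ∀ {Q : ℕ → Set} {S : ℕ → ℕ → Set} {T : Fin n → Fin n → Set} (ρ : ℕ → Fin n) →
    (∀ {j k} → Q j → Q k → S j k → T (ρ j) (ρ k)) → ∀ {ks} → All Q ks → AllPairs S ks → AllPairs T (map ρ ks)
  pairs-sound ρ f [] [] = []
  pairs-sound ρ f (q ∷ qs) (s ∷ ss) =
    AllP.map⁺ (All.zipWith (λ (q′ , s′) → f q q′ s′) (qs , s)) ∷ pairs-sound ρ f qs ss

  -- The tree is a proof by cases. A leaf other than `found` contradicts the excluded independent
  -- set, the codegree bound or the number of vertices, so for a pattern that cannot occur an
  -- accepted tree is a refutation.
  check-sound : ∀ t {ρ l E F} → Labelling ρ l E F → check t l E F ≡ true → Copy pat X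
  check-sound (independent ks) {ρ} {l} {E} {F} L h
    with ∧-true⁻ {length ks ≡ᵇ suc d} h
  ... | len , h′ with ∧-true⁻ {allOf ks (_<ᵇ l)} h′
  ... | below , apart = contradiction (map ρ ks
      , trans (ListP.length-map ρ ks) (≡ᵇ-true⁻ (length ks) (suc d) len)
      , AllP.map⁺ (All.map (Labelling.member L) below′)
      , pairs-sound ρ (apart-sound L) below′ (allPairsOf-sound ks apart)) no-independent
    where
    below′ : All (_< l) ks
    below′ = All.map (λ {k} → <ᵇ-true⁻ k l) (allOf-sound ks below)
  check-sound (codegree i j ks) {ρ} {l} {E} {F} L h = ⊥-elim (codegree<c (member i<l) (member j<l)
      (apart-sound L i<l j<l apart)
      (trans (ListP.length-map ρ ks) (≡ᵇ-true⁻ (length ks) c len))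
      (pairs-sound ρ (λ {a} {b} a<l b<l ne → distinct⁻ a b ne ∘ injective a<l b<l)
        (All.map proj₁ common) (allPairsOf-sound ks distinct))
      (AllP.map⁺ (All.map (λ (k<l , ik , jk) → member k<l , ik , jk) common)))
    where
    open Labelling L
    open Checker.Known (count X) d c pat l E F
    common? : ℕ → Bool
    common? k = (k <ᵇ l) ∧ (edge? i k ∧ edge? j k)
    h₁ = ∧-true⁻ {(i <ᵇ l) ∧ ((j <ᵇ l) ∧ apart? i j)} h
    h₂ = ∧-true⁻ {i <ᵇ l} (proj₁ h₁)
    h₃ = ∧-true⁻ {j <ᵇ l} (proj₂ h₂)
    h₄ = ∧-true⁻ {length ks ≡ᵇ c} (proj₂ h₁)
    h₅ = ∧-true⁻ {allOf ks common?} (proj₂ h₄)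
    i<l = <ᵇ-true⁻ i l (proj₁ h₂)
    j<l = <ᵇ-true⁻ j l (proj₁ h₃)
    apart = proj₂ h₃
    len = proj₁ h₄
    distinct = proj₂ h₅
    common : All (λ k → k < l × adj H (ρ i) (ρ k) ≡ true × adj H (ρ j) (ρ k) ≡ true) ks
    common = All.map (λ {k} e → let (a , b) = ∧-true⁻ {k <ᵇ l} e ; (b₁ , b₂) = ∧-true⁻ {edge? i k} b in
      <ᵇ-true⁻ k l a , edge-sound L b₁ , edge-sound L b₂) (allOf-sound ks (proj₁ h₅))
  check-sound overfull {ρ} {l} L h = contradiction (<ᵇ-true⁻ (count X) l h) (≤⇒≯ (begin
      l ≡⟨ sym (count-full l) ⟩
      count {l} (λ _ → true) ≤⟨ count-injection {q = X} (ρ ∘ toℕ) (λ {k} _ → member (FinP.toℕ<n k))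
        (λ {j} {k} _ _ e → FinP.toℕ-injective (injective (FinP.toℕ<n j) (FinP.toℕ<n k) e)) ⟩
      count X ∎))
    where
    open Labelling L
    open ≤-Reasoning
  check-sound (found ks) {ρ} {l} {E} {F} L h = record
    { vertex = λ i → ρ (lookup ks i)
    ; injective = λ {i} {j} e → inj e (proj₁ (proj₂ (facts i j)))
    ; member = λ i → member (below i)
    ; edges = λ i j ij → edg ij (proj₂ (proj₂ (facts i j)))
    }
    where
    open Labelling L
    open Checker.Known (count X) d c pat l E F
    facts : ∀ i j → (lookup ks i <ᵇ l) ≡ true × ((i == j) ∨ distinct? (lookup ks i) (lookup ks j)) ≡ true ×
      (not (pat i j) ∨ edge? (lookup ks i) (lookup ks j)) ≡ true
    facts i j = let (a , b) = ∧-true⁻ {lookup ks i <ᵇ l} (does-true⁻ (FinP.all? _) h i j) in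
      a , ∧-true⁻ {(i == j) ∨ distinct? (lookup ks i) (lookup ks j)} b
    below : ∀ i → lookup ks i < l
    below i = <ᵇ-true⁻ (lookup ks i) l (proj₁ (facts i i))
    inj : ∀ {i j} → ρ (lookup ks i) ≡ ρ (lookup ks j) → ((i == j) ∨ distinct? (lookup ks i) (lookup ks j)) ≡ true → i ≡ j
    inj {i} {j} e h with ∨-true⁻ {i == j} h
    ... | inj₁ h′ = does-true⁻ (i FinP.≟ j) h′
    ... | inj₂ h′ = contradiction (injective (below i) (below j) e) (distinct⁻ (lookup ks i) (lookup ks j) h′)
    edg : ∀ {b i j} → b ≡ true → (not b ∨ edge? i j) ≡ true → adj H (ρ i) (ρ j) ≡ true
    edg refl h = edge-sound L h
  check-sound (split i j t u) {ρ} {l} {E} {F} L h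
    with ∧-true⁻ {(i <ᵇ l) ∧ (j <ᵇ l)} h
  ... | ij , tu with ∧-true⁻ {i <ᵇ l} ij | ∧-true⁻ {check t l (insert i j E) F} tu
  ... | i<l , j<l | th , uh with ∈⊎∉ (adj H (ρ i) (ρ j))
  ... | inj₁ e = check-sound t (insert-edge L (<ᵇ-true⁻ i l i<l) (<ᵇ-true⁻ j l j<l) e) th
  ... | inj₂ e = check-sound u (insert-nonedge L (<ᵇ-true⁻ i l i<l) (<ᵇ-true⁻ j l j<l) e) uh
  check-sound (newVertex t) {ρ} {l} {E} {F} L h =
    check-sound t (extend-labelling L (proj₁ (proj₂ z)) (proj₂ (proj₂ z))) (proj₂ h₁)
    where
    h₁ = ∧-true⁻ {l <ᵇ count X} h
    length-below : ∀ l → length (filterBelow l λ _ → true) ≡ l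
    length-below zero = refl
    length-below (suc l) = cong suc (length-below l)
    z : ∃ λ z → z ∈ X × New L z
    z = new-in L X (filterBelow l λ _ → true) (λ k<l _ → filterBelow-∈ l k<l refl)
      (subst (_< count X) (sym (length-below l)) (<ᵇ-true⁻ l (count X) (proj₁ h₁)))
  check-sound (newNeighbour i t) {ρ} {l} {E} {F} L h =
    check-sound t (insert-new (extend-labelling L (proj₁ zX) (proj₂ (proj₂ z))) i<l (proj₂ zX)) (proj₂ h₁)
    where
    open Labelling L
    open Checker.Known (count X) d c pat l E F
    known? : ℕ → Bool
    known? k = edge? i k ∨ notNeighbour? i k
    h₁ = ∧-true⁻ {(i <ᵇ l) ∧ (allBelow l known? ∧ (length (filterBelow l (edge? i)) <ᵇ d))} h
    h₂ = ∧-true⁻ {i <ᵇ l} (proj₁ h₁)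
    h₃ = ∧-true⁻ {allBelow l known?} (proj₂ h₂)
    i<l = <ᵇ-true⁻ i l (proj₁ h₂)
    cover : ∀ {k} → k < l → ρ k ∈ (X ∩ adj H (ρ i)) → Any (k ≡_) (filterBelow l (edge? i))
    cover {k} k<l e with ∨-true⁻ {edge? i k} (allBelow-sound l (proj₁ h₃) k<l)
    ... | inj₁ ik = filterBelow-∈ l k<l ik
    ... | inj₂ ik = contradiction (trans (sym (proj₂ (∧-true⁻ {X (ρ k)} e))) (notNeighbour-sound L i<l k<l ik)) λ ()
    z : ∃ λ z → z ∈ (X ∩ adj H (ρ i)) × New L z
    z = new-in L (X ∩ adj H (ρ i)) (filterBelow l (edge? i)) cover
      (≤-trans (<ᵇ-true⁻ (length (filterBelow l (edge? i))) d (proj₂ h₃)) (d≤degree (member i<l)))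
    zX = ∧-true⁻ {X (proj₁ z)} (proj₁ (proj₂ z))
  check-sound (newCommon i j t) {ρ} {l} {E} {F} L h =
    check-sound t (insert-new (insert-new (extend-labelling L zX new) j<l jz) i<l iz) (proj₂ h₁)
    where
    open Labelling L
    open Checker.Known (count X) d c pat l E F
    known? : ℕ → Bool
    known? k = notNeighbour? i k ∨ notNeighbour? j k
    h₁ = ∧-true⁻ {(i <ᵇ l) ∧ ((j <ᵇ l) ∧ (apart? i j ∧ allBelow l known?))} h
    h₂ = ∧-true⁻ {i <ᵇ l} (proj₁ h₁)
    h₃ = ∧-true⁻ {j <ᵇ l} (proj₂ h₂)
    h₄ = ∧-true⁻ {apart? i j} (proj₂ h₃)
    i<l = <ᵇ-true⁻ i l (proj₁ h₂)
    j<l = <ᵇ-true⁻ j l (proj₁ h₃)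
    zs = common-neighbour (member i<l) (member j<l) (apart-sound L i<l j<l (proj₁ h₄))
    z = proj₁ zs
    zX = proj₁ (proj₂ zs)
    iz = proj₁ (proj₂ (proj₂ zs))
    jz = proj₂ (proj₂ (proj₂ zs))
    new : New L z
    new k k<l e with ∨-true⁻ {notNeighbour? i k} (allBelow-sound l (proj₂ h₄) k<l)
    ... | inj₁ ik = true≢false (trans (sym iz) (subst (λ t → adj H (ρ i) t ≡ false) e (notNeighbour-sound L i<l k<l ik)))
    ... | inj₂ jk = true≢false (trans (sym jz) (subst (λ t → adj H (ρ j) t ≡ false) e (notNeighbour-sound L j<l k<l jk)))

-- Small Ramsey numbers

complement : ∀ {n} → Graph n → Graph n
complement G = record
  { adj = λ x y → not (adj G x y) ∧ not (x == y)
  ; sym = λ x y → cong₂ (λ a b → not a ∧ not b) (Graph.sym G x y) (==-sym x y)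
  ; irrefl = λ x → trans (cong (λ b → not (adj G x x) ∧ not b) (==-refl x)) (BoolP.∧-zeroʳ _)
  }
  where
  ==-sym : ∀ {m} (x y : Fin m) → (x == y) ≡ (y == x)
  ==-sym x y = bool-ext
    (λ e → subst (λ z → (z == x) ≡ true) (does-true⁻ (x FinP.≟ y) e) (==-refl x))
    (λ e → subst (λ z → (z == y) ≡ true) (does-true⁻ (y FinP.≟ x) e) (==-refl y))

shrink : ∀ {n} (X : Subset n) j → j ≤ count X → ∃ λ Y → (∀ {x} → x ∈ Y → x ∈ X) × count Y ≡ j
shrink {n} X j j≤ = go (count X ∸ j) X (trans (sym (m∸n+n≡m j≤)) (+-comm _ j))
  where
  go : ∀ k (X : Subset n) → count X ≡ j + k → ∃ λ Y → (∀ {x} → x ∈ Y → x ∈ X) × count Y ≡ j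
  go zero X e = X , id , trans e (+-identityʳ j)
  go (suc k) X e with count>0 {p = X} (≤-trans (s≤s z≤n) (≤-reflexive (sym (trans e (+-suc j k)))))
  ... | a , aX with go k (X - a) (suc-injective (trans (sym (count-delete a aX)) (trans e (+-suc j k))))
  ... | Y , Y⊆ , c = Y , (λ {x} h → proj₁ (∈-delete⁻ {X = X} (Y⊆ h))) , c

cycle₄ : Fin 4 → Fin 4 → Bool
cycle₄ i j = ((toℕ i + toℕ j) % 2) ≡ᵇ 1

-- The four trees were found by computer. The search for Q starts from a 4-cycle, whose existence is
-- shown separately, because this breaks most of the symmetry.
tree₄ : Tree 3
tree₄ =
  newVertex (newNeighbour 0 (newNeighbour 0 (newNeighbour 0 (newNeighbour 1 (split 4 2 (codegree 2 1 (0 ∷ 4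
  ∷ [])) (split 4 3 (codegree 3 1 (0 ∷ 4 ∷ [])) (newNeighbour 1 (split 5 2 (codegree 2 1 (0 ∷ 5 ∷ []))
  (split 5 3 (codegree 3 1 (0 ∷ 5 ∷ [])) (independent (2 ∷ 3 ∷ 4 ∷ 5 ∷ [])))))))))))

tree-C5 : Tree 5
tree-C5 =
  newVertex (newNeighbour 0 (newNeighbour 0 (newNeighbour 1 (split 3 2 (codegree 2 1 (0 ∷ 3 ∷ []))
  (newCommon 3 2 (found (0 ∷ 3 ∷ 2 ∷ 1 ∷ 4 ∷ [])))))))

tree-cycle₄ : Tree 4
tree-cycle₄ =
  newVertex (newNeighbour 0 (newNeighbour 0 (newNeighbour 0 (newNeighbour 0 (newNeighbour 1 (split 5 2
  (found (2 ∷ 0 ∷ 1 ∷ 5 ∷ [])) (split 5 3 (found (3 ∷ 0 ∷ 1 ∷ 5 ∷ [])) (split 5 4 (found (4 ∷ 0 ∷ 1 ∷ 5 ∷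
  [])) (newNeighbour 1 (split 6 2 (found (2 ∷ 0 ∷ 1 ∷ 6 ∷ [])) (split 6 3 (found (3 ∷ 0 ∷ 1 ∷ 6 ∷ []))
  (split 6 4 (found (4 ∷ 0 ∷ 1 ∷ 6 ∷ [])) (independent (2 ∷ 3 ∷ 4 ∷ 5 ∷ 6 ∷ []))))))))))))))

tree-Q : Tree 13
tree-Q =
  newNeighbour 0 (split 4 2 (codegree 2 0 (1 ∷ 3 ∷ 4 ∷ [])) (newCommon 4 2 (newNeighbour 0 (split 6 2
  (codegree 2 0 (1 ∷ 3 ∷ 6 ∷ [])) (newNeighbour 1 (split 7 3 (codegree 3 1 (0 ∷ 2 ∷ 7 ∷ [])) (newCommon 7 3
  (newNeighbour 1 (split 9 3 (codegree 3 1 (0 ∷ 2 ∷ 9 ∷ [])) (newNeighbour 2 (newNeighbour 3 (split 11 1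
  (independent (0 ∷ 2 ∷ 7 ∷ 9 ∷ 11 ∷ [])) (split 10 4 (split 7 4 (split 7 6 (codegree 7 0 (1 ∷ 4 ∷ 6 ∷ []))
  (split 11 4 (independent (0 ∷ 5 ∷ 7 ∷ 10 ∷ 11 ∷ [])) (split 11 7 (split 6 5 (split 10 6 (codegree 6 4 (0 ∷
  5 ∷ 10 ∷ [])) (split 11 5 (split 8 6 (split 9 5 (independent (2 ∷ 4 ∷ 6 ∷ 9 ∷ 11 ∷ [])) (split 10 9 (split
  9 6 (newVertex (split 12 1 (independent (0 ∷ 2 ∷ 7 ∷ 9 ∷ 12 ∷ [])) (split 12 2 (independent (1 ∷ 3 ∷ 5 ∷
  10 ∷ 12 ∷ [])) (split 12 3 (independent (0 ∷ 2 ∷ 8 ∷ 11 ∷ 12 ∷ [])) (split 12 4 (independent (0 ∷ 5 ∷ 7 ∷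
  10 ∷ 12 ∷ [])) (split 12 6 (independent (0 ∷ 2 ∷ 8 ∷ 9 ∷ 12 ∷ [])) (independent (1 ∷ 3 ∷ 4 ∷ 6 ∷ 12 ∷
  [])))))))) (split 11 9 (split 9 8 (codegree 9 7 (1 ∷ 8 ∷ 11 ∷ [])) (newCommon 9 6 (split 12 2 (independent
  (1 ∷ 3 ∷ 5 ∷ 10 ∷ 12 ∷ [])) (independent (0 ∷ 2 ∷ 8 ∷ 11 ∷ 12 ∷ []))))) (independent (2 ∷ 4 ∷ 6 ∷ 9 ∷ 11 ∷
  [])))) (independent (0 ∷ 5 ∷ 7 ∷ 9 ∷ 10 ∷ [])))) (independent (1 ∷ 4 ∷ 6 ∷ 8 ∷ 11 ∷ []))) (split 8 5
  (split 9 5 (independent (2 ∷ 4 ∷ 6 ∷ 8 ∷ 9 ∷ [])) (split 10 9 (split 11 6 (split 9 6 (newVertex (split 12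
  1 (independent (0 ∷ 2 ∷ 7 ∷ 9 ∷ 12 ∷ [])) (split 12 2 (independent (1 ∷ 3 ∷ 5 ∷ 10 ∷ 12 ∷ [])) (split 12 3
  (independent (0 ∷ 2 ∷ 8 ∷ 11 ∷ 12 ∷ [])) (split 12 4 (independent (0 ∷ 5 ∷ 7 ∷ 10 ∷ 12 ∷ [])) (split 12 6
  (independent (0 ∷ 2 ∷ 9 ∷ 11 ∷ 12 ∷ [])) (independent (1 ∷ 3 ∷ 4 ∷ 6 ∷ 12 ∷ [])))))))) (split 9 8 (split
  11 9 (codegree 9 7 (1 ∷ 8 ∷ 11 ∷ [])) (newCommon 9 6 (split 12 2 (independent (1 ∷ 3 ∷ 5 ∷ 10 ∷ 12 ∷ []))
  (independent (0 ∷ 2 ∷ 8 ∷ 11 ∷ 12 ∷ []))))) (independent (2 ∷ 4 ∷ 6 ∷ 8 ∷ 9 ∷ [])))) (independent (1 ∷ 4 ∷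
  6 ∷ 8 ∷ 11 ∷ []))) (independent (0 ∷ 5 ∷ 7 ∷ 9 ∷ 10 ∷ [])))) (split 9 5 (split 10 9 (codegree 9 2 (1 ∷ 5 ∷
  10 ∷ [])) (independent (3 ∷ 6 ∷ 7 ∷ 9 ∷ 10 ∷ []))) (newNeighbour 5 (split 12 1 (independent (0 ∷ 2 ∷ 7 ∷ 9
  ∷ 12 ∷ [])) (split 12 3 (independent (0 ∷ 2 ∷ 8 ∷ 11 ∷ 12 ∷ [])) (independent (1 ∷ 3 ∷ 4 ∷ 6 ∷ 12 ∷
  []))))))))) (split 10 6 (split 10 9 (split 9 5 (codegree 9 2 (1 ∷ 5 ∷ 10 ∷ [])) (independent (3 ∷ 5 ∷ 6 ∷
  7 ∷ 9 ∷ []))) (split 9 5 (split 11 5 (split 9 8 (split 9 6 (split 11 6 (newVertex (split 12 0 (independent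
  (1 ∷ 3 ∷ 4 ∷ 6 ∷ 12 ∷ [])) (split 12 1 (independent (0 ∷ 2 ∷ 7 ∷ 9 ∷ 12 ∷ [])) (split 12 2 (independent (1
  ∷ 3 ∷ 5 ∷ 10 ∷ 12 ∷ [])) (split 12 3 (independent (0 ∷ 2 ∷ 8 ∷ 11 ∷ 12 ∷ [])) (split 12 4 (independent (0
  ∷ 5 ∷ 7 ∷ 10 ∷ 12 ∷ [])) (split 12 6 (independent (0 ∷ 2 ∷ 9 ∷ 11 ∷ 12 ∷ [])) (independent (1 ∷ 3 ∷ 4 ∷ 6
  ∷ 12 ∷ []))))))))) (independent (1 ∷ 4 ∷ 6 ∷ 8 ∷ 11 ∷ []))) (split 11 6 (split 8 6 (codegree 6 3 (0 ∷ 8 ∷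
  11 ∷ [])) (newCommon 9 6 (split 12 2 (independent (1 ∷ 3 ∷ 5 ∷ 10 ∷ 12 ∷ [])) (independent (0 ∷ 2 ∷ 8 ∷ 11
  ∷ 12 ∷ []))))) (independent (2 ∷ 4 ∷ 6 ∷ 9 ∷ 11 ∷ [])))) (independent (0 ∷ 2 ∷ 8 ∷ 9 ∷ 11 ∷ []))) (split 8
  5 (split 11 9 (split 8 6 (split 11 6 (codegree 6 3 (0 ∷ 8 ∷ 11 ∷ [])) (split 9 6 (newVertex (split 12 0
  (independent (1 ∷ 3 ∷ 4 ∷ 6 ∷ 12 ∷ [])) (split 12 1 (independent (0 ∷ 2 ∷ 7 ∷ 9 ∷ 12 ∷ [])) (split 12 2
  (independent (1 ∷ 3 ∷ 5 ∷ 10 ∷ 12 ∷ [])) (split 12 3 (independent (0 ∷ 2 ∷ 8 ∷ 11 ∷ 12 ∷ [])) (split 12 4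
  (independent (0 ∷ 5 ∷ 7 ∷ 10 ∷ 12 ∷ [])) (split 12 6 (independent (0 ∷ 2 ∷ 8 ∷ 9 ∷ 12 ∷ [])) (independent
  (1 ∷ 3 ∷ 4 ∷ 6 ∷ 12 ∷ []))))))))) (newCommon 9 6 (split 12 2 (independent (1 ∷ 3 ∷ 5 ∷ 10 ∷ 12 ∷ []))
  (independent (0 ∷ 2 ∷ 8 ∷ 11 ∷ 12 ∷ [])))))) (split 9 6 (independent (1 ∷ 4 ∷ 6 ∷ 8 ∷ 11 ∷ []))
  (independent (2 ∷ 4 ∷ 6 ∷ 8 ∷ 9 ∷ [])))) (independent (0 ∷ 2 ∷ 8 ∷ 9 ∷ 11 ∷ []))) (newNeighbour 5 (split
  12 1 (independent (0 ∷ 2 ∷ 7 ∷ 9 ∷ 12 ∷ [])) (split 12 3 (independent (0 ∷ 2 ∷ 8 ∷ 11 ∷ 12 ∷ [])) (split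
  12 6 (split 12 7 (independent (0 ∷ 2 ∷ 8 ∷ 11 ∷ 12 ∷ [])) (independent (0 ∷ 2 ∷ 7 ∷ 9 ∷ 12 ∷ [])))
  (independent (1 ∷ 3 ∷ 4 ∷ 6 ∷ 12 ∷ [])))))))) (independent (0 ∷ 5 ∷ 7 ∷ 9 ∷ 10 ∷ [])))) (independent (1 ∷
  3 ∷ 5 ∷ 6 ∷ 10 ∷ [])))) (split 11 9 (newCommon 11 7 (split 11 6 (independent (1 ∷ 3 ∷ 4 ∷ 6 ∷ 12 ∷ []))
  (split 8 6 (split 12 0 (independent (1 ∷ 3 ∷ 4 ∷ 6 ∷ 12 ∷ [])) (split 12 2 (independent (1 ∷ 3 ∷ 5 ∷ 10 ∷
  12 ∷ [])) (split 9 8 (split 12 6 (split 6 5 (split 10 6 (independent (0 ∷ 5 ∷ 8 ∷ 10 ∷ 12 ∷ [])) (split 10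
  9 (split 11 5 (split 12 10 (found (0 ∷ 1 ∷ 9 ∷ 11 ∷ 5 ∷ 4 ∷ 7 ∷ 8 ∷ 3 ∷ 2 ∷ 10 ∷ 12 ∷ 6 ∷ []))
  (independent (0 ∷ 5 ∷ 8 ∷ 10 ∷ 12 ∷ []))) (independent (0 ∷ 5 ∷ 7 ∷ 10 ∷ 11 ∷ []))) (independent (3 ∷ 6 ∷
  7 ∷ 9 ∷ 10 ∷ [])))) (split 9 5 (split 10 6 (split 11 10 (split 12 5 (found (0 ∷ 1 ∷ 9 ∷ 11 ∷ 10 ∷ 4 ∷ 7 ∷
  8 ∷ 3 ∷ 2 ∷ 5 ∷ 12 ∷ 6 ∷ [])) (independent (0 ∷ 5 ∷ 8 ∷ 10 ∷ 12 ∷ []))) (independent (0 ∷ 5 ∷ 7 ∷ 10 ∷ 11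
  ∷ []))) (independent (1 ∷ 3 ∷ 5 ∷ 6 ∷ 10 ∷ []))) (independent (3 ∷ 5 ∷ 6 ∷ 7 ∷ 9 ∷ [])))) (independent (1
  ∷ 3 ∷ 4 ∷ 6 ∷ 12 ∷ []))) (independent (0 ∷ 2 ∷ 8 ∷ 9 ∷ 12 ∷ []))))) (independent (1 ∷ 4 ∷ 6 ∷ 8 ∷ 11 ∷
  []))))) (independent (0 ∷ 2 ∷ 7 ∷ 9 ∷ 11 ∷ [])))))) (split 9 4 (split 8 4 (independent (0 ∷ 5 ∷ 8 ∷ 9 ∷ 10
  ∷ [])) (split 9 6 (codegree 9 0 (1 ∷ 4 ∷ 6 ∷ [])) (split 11 4 (independent (0 ∷ 5 ∷ 9 ∷ 10 ∷ 11 ∷ []))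
  (split 11 9 (split 9 8 (split 11 7 (codegree 9 7 (1 ∷ 8 ∷ 11 ∷ [])) (split 10 8 (split 7 5 (split 8 6
  (independent (3 ∷ 6 ∷ 7 ∷ 9 ∷ 10 ∷ [])) (split 11 6 (split 7 6 (split 11 5 (newVertex (split 12 0
  (independent (1 ∷ 3 ∷ 4 ∷ 6 ∷ 12 ∷ [])) (split 12 1 (independent (0 ∷ 2 ∷ 7 ∷ 9 ∷ 12 ∷ [])) (split 12 2
  (independent (1 ∷ 3 ∷ 5 ∷ 10 ∷ 12 ∷ [])) (split 12 3 (independent (0 ∷ 2 ∷ 8 ∷ 11 ∷ 12 ∷ [])) (split 12 4
  (independent (0 ∷ 5 ∷ 9 ∷ 10 ∷ 12 ∷ [])) (split 12 6 (independent (0 ∷ 2 ∷ 7 ∷ 11 ∷ 12 ∷ [])) (independent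
  (1 ∷ 3 ∷ 4 ∷ 6 ∷ 12 ∷ []))))))))) (newCommon 11 5 (split 12 0 (independent (1 ∷ 3 ∷ 4 ∷ 6 ∷ 12 ∷ []))
  (independent (0 ∷ 2 ∷ 7 ∷ 9 ∷ 12 ∷ []))))) (split 10 6 (split 6 5 (codegree 6 4 (0 ∷ 5 ∷ 10 ∷ []))
  (newCommon 7 6 (split 12 2 (independent (1 ∷ 3 ∷ 5 ∷ 10 ∷ 12 ∷ [])) (independent (0 ∷ 2 ∷ 8 ∷ 11 ∷ 12 ∷
  []))))) (independent (3 ∷ 6 ∷ 7 ∷ 9 ∷ 10 ∷ [])))) (independent (1 ∷ 4 ∷ 6 ∷ 8 ∷ 11 ∷ [])))) (independent
  (0 ∷ 5 ∷ 7 ∷ 9 ∷ 10 ∷ []))) (split 8 5 (split 8 6 (independent (3 ∷ 5 ∷ 6 ∷ 7 ∷ 9 ∷ [])) (split 10 7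
  (split 11 6 (split 6 5 (split 10 6 (codegree 6 4 (0 ∷ 5 ∷ 10 ∷ [])) (split 7 6 (newVertex (split 12 1
  (independent (0 ∷ 2 ∷ 7 ∷ 9 ∷ 12 ∷ [])) (split 12 2 (independent (1 ∷ 3 ∷ 5 ∷ 10 ∷ 12 ∷ [])) (split 12 3
  (independent (0 ∷ 2 ∷ 8 ∷ 11 ∷ 12 ∷ [])) (split 12 4 (independent (0 ∷ 5 ∷ 9 ∷ 10 ∷ 12 ∷ [])) (split 12 6
  (independent (0 ∷ 2 ∷ 7 ∷ 11 ∷ 12 ∷ [])) (independent (1 ∷ 3 ∷ 4 ∷ 6 ∷ 12 ∷ [])))))))) (newCommon 7 6
  (split 12 2 (independent (1 ∷ 3 ∷ 5 ∷ 10 ∷ 12 ∷ [])) (independent (0 ∷ 2 ∷ 8 ∷ 11 ∷ 12 ∷ [])))))) (split 7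
  6 (independent (1 ∷ 3 ∷ 5 ∷ 6 ∷ 10 ∷ [])) (independent (3 ∷ 5 ∷ 6 ∷ 7 ∷ 9 ∷ [])))) (independent (1 ∷ 4 ∷ 6
  ∷ 8 ∷ 11 ∷ []))) (independent (0 ∷ 5 ∷ 7 ∷ 9 ∷ 10 ∷ [])))) (split 8 6 (split 11 6 (codegree 6 3 (0 ∷ 8 ∷
  11 ∷ [])) (independent (2 ∷ 4 ∷ 6 ∷ 7 ∷ 11 ∷ []))) (newNeighbour 8 (split 12 0 (independent (1 ∷ 3 ∷ 4 ∷ 6
  ∷ 12 ∷ [])) (split 12 2 (independent (0 ∷ 5 ∷ 9 ∷ 10 ∷ 12 ∷ [])) (independent (0 ∷ 2 ∷ 7 ∷ 9 ∷ 12 ∷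
  []))))))))) (newCommon 9 8 (split 8 6 (independent (1 ∷ 3 ∷ 4 ∷ 6 ∷ 12 ∷ [])) (split 11 6 (split 12 0
  (independent (1 ∷ 3 ∷ 4 ∷ 6 ∷ 12 ∷ [])) (split 12 2 (independent (1 ∷ 3 ∷ 5 ∷ 10 ∷ 12 ∷ [])) (split 11 7
  (split 12 6 (split 6 5 (split 10 6 (independent (0 ∷ 5 ∷ 10 ∷ 11 ∷ 12 ∷ [])) (split 10 7 (split 8 5 (split
  12 10 (found (0 ∷ 1 ∷ 7 ∷ 8 ∷ 5 ∷ 4 ∷ 9 ∷ 11 ∷ 3 ∷ 2 ∷ 10 ∷ 12 ∷ 6 ∷ [])) (independent (0 ∷ 5 ∷ 10 ∷ 11 ∷
  12 ∷ []))) (independent (0 ∷ 5 ∷ 8 ∷ 9 ∷ 10 ∷ []))) (independent (3 ∷ 6 ∷ 7 ∷ 9 ∷ 10 ∷ [])))) (split 7 5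
  (split 10 6 (split 10 8 (split 12 5 (found (0 ∷ 1 ∷ 7 ∷ 8 ∷ 10 ∷ 4 ∷ 9 ∷ 11 ∷ 3 ∷ 2 ∷ 5 ∷ 12 ∷ 6 ∷ []))
  (independent (0 ∷ 5 ∷ 10 ∷ 11 ∷ 12 ∷ []))) (independent (0 ∷ 5 ∷ 8 ∷ 9 ∷ 10 ∷ []))) (independent (1 ∷ 3 ∷
  5 ∷ 6 ∷ 10 ∷ []))) (independent (3 ∷ 5 ∷ 6 ∷ 7 ∷ 9 ∷ [])))) (independent (1 ∷ 3 ∷ 4 ∷ 6 ∷ 12 ∷ [])))
  (independent (0 ∷ 2 ∷ 7 ∷ 11 ∷ 12 ∷ []))))) (independent (1 ∷ 4 ∷ 6 ∷ 8 ∷ 11 ∷ [])))))) (split 9 8 (split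
  11 7 (newCommon 11 9 (split 11 6 (independent (1 ∷ 3 ∷ 4 ∷ 6 ∷ 12 ∷ [])) (split 8 6 (split 8 5
  (independent (3 ∷ 5 ∷ 6 ∷ 7 ∷ 9 ∷ [])) (split 10 8 (independent (3 ∷ 6 ∷ 7 ∷ 9 ∷ 10 ∷ [])) (split 12 0
  (independent (1 ∷ 3 ∷ 4 ∷ 6 ∷ 12 ∷ [])) (split 12 6 (split 6 5 (split 10 6 (independent (0 ∷ 5 ∷ 8 ∷ 10 ∷
  12 ∷ [])) (split 10 7 (split 11 5 (split 12 10 (found (0 ∷ 1 ∷ 7 ∷ 11 ∷ 5 ∷ 4 ∷ 9 ∷ 8 ∷ 3 ∷ 2 ∷ 10 ∷ 12 ∷
  6 ∷ [])) (independent (0 ∷ 5 ∷ 8 ∷ 10 ∷ 12 ∷ []))) (independent (0 ∷ 5 ∷ 8 ∷ 10 ∷ 11 ∷ []))) (independent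
  (3 ∷ 6 ∷ 7 ∷ 9 ∷ 10 ∷ [])))) (split 7 5 (split 10 6 (split 11 10 (split 12 5 (found (0 ∷ 1 ∷ 7 ∷ 11 ∷ 10 ∷
  4 ∷ 9 ∷ 8 ∷ 3 ∷ 2 ∷ 5 ∷ 12 ∷ 6 ∷ [])) (independent (0 ∷ 5 ∷ 8 ∷ 10 ∷ 12 ∷ []))) (independent (0 ∷ 5 ∷ 8 ∷
  10 ∷ 11 ∷ []))) (independent (1 ∷ 3 ∷ 5 ∷ 6 ∷ 10 ∷ []))) (independent (3 ∷ 5 ∷ 6 ∷ 7 ∷ 9 ∷ []))))
  (independent (1 ∷ 3 ∷ 4 ∷ 6 ∷ 12 ∷ [])))))) (independent (1 ∷ 4 ∷ 6 ∷ 8 ∷ 11 ∷ []))))) (independent (0 ∷ 2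
  ∷ 7 ∷ 9 ∷ 11 ∷ []))) (independent (0 ∷ 2 ∷ 8 ∷ 9 ∷ 11 ∷ []))))))) (split 8 4 (split 8 6 (codegree 8 0 (3 ∷
  4 ∷ 6 ∷ [])) (split 9 8 (split 11 5 (split 11 10 (codegree 10 5 (2 ∷ 4 ∷ 11 ∷ [])) (split 6 5 (split 10 6
  (codegree 6 4 (0 ∷ 5 ∷ 10 ∷ [])) (independent (1 ∷ 6 ∷ 8 ∷ 10 ∷ 11 ∷ []))) (split 10 6 (split 9 5 (split
  11 7 (split 9 6 (split 7 6 (codegree 6 1 (0 ∷ 7 ∷ 9 ∷ [])) (split 11 6 (newVertex (split 12 0 (independent
  (1 ∷ 3 ∷ 4 ∷ 6 ∷ 12 ∷ [])) (split 12 1 (independent (0 ∷ 2 ∷ 7 ∷ 9 ∷ 12 ∷ [])) (split 12 2 (independent (1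
  ∷ 3 ∷ 5 ∷ 10 ∷ 12 ∷ [])) (split 12 3 (independent (0 ∷ 2 ∷ 8 ∷ 11 ∷ 12 ∷ [])) (split 12 4 (independent (0
  ∷ 5 ∷ 8 ∷ 10 ∷ 12 ∷ [])) (split 12 6 (independent (0 ∷ 2 ∷ 9 ∷ 11 ∷ 12 ∷ [])) (independent (1 ∷ 3 ∷ 4 ∷ 6
  ∷ 12 ∷ []))))))))) (newCommon 11 6 (split 12 1 (independent (0 ∷ 2 ∷ 7 ∷ 9 ∷ 12 ∷ [])) (independent (1 ∷ 3
  ∷ 5 ∷ 10 ∷ 12 ∷ [])))))) (split 7 6 (independent (2 ∷ 4 ∷ 6 ∷ 9 ∷ 11 ∷ [])) (independent (2 ∷ 4 ∷ 6 ∷ 7 ∷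
  9 ∷ [])))) (independent (0 ∷ 2 ∷ 7 ∷ 9 ∷ 11 ∷ []))) (split 7 5 (split 11 9 (split 7 6 (split 9 6 (codegree
  6 1 (0 ∷ 7 ∷ 9 ∷ [])) (split 11 6 (newVertex (split 12 0 (independent (1 ∷ 3 ∷ 4 ∷ 6 ∷ 12 ∷ [])) (split 12
  1 (independent (0 ∷ 2 ∷ 7 ∷ 9 ∷ 12 ∷ [])) (split 12 2 (independent (1 ∷ 3 ∷ 5 ∷ 10 ∷ 12 ∷ [])) (split 12 3
  (independent (0 ∷ 2 ∷ 8 ∷ 11 ∷ 12 ∷ [])) (split 12 4 (independent (0 ∷ 5 ∷ 8 ∷ 10 ∷ 12 ∷ [])) (split 12 6
  (independent (0 ∷ 2 ∷ 7 ∷ 11 ∷ 12 ∷ [])) (independent (1 ∷ 3 ∷ 4 ∷ 6 ∷ 12 ∷ []))))))))) (newCommon 11 6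
  (split 12 1 (independent (0 ∷ 2 ∷ 7 ∷ 9 ∷ 12 ∷ [])) (independent (1 ∷ 3 ∷ 5 ∷ 10 ∷ 12 ∷ [])))))) (split 9
  6 (independent (2 ∷ 4 ∷ 6 ∷ 7 ∷ 11 ∷ [])) (independent (2 ∷ 4 ∷ 6 ∷ 7 ∷ 9 ∷ [])))) (independent (0 ∷ 2 ∷ 7
  ∷ 9 ∷ 11 ∷ []))) (newNeighbour 5 (split 12 1 (independent (0 ∷ 2 ∷ 7 ∷ 9 ∷ 12 ∷ [])) (split 12 3
  (independent (0 ∷ 2 ∷ 8 ∷ 11 ∷ 12 ∷ [])) (split 12 6 (split 12 7 (independent (0 ∷ 2 ∷ 8 ∷ 11 ∷ 12 ∷ []))
  (split 9 6 (independent (0 ∷ 2 ∷ 7 ∷ 9 ∷ 12 ∷ [])) (split 7 6 (split 11 7 (split 11 9 (codegree 9 7 (1 ∷ 8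
  ∷ 11 ∷ [])) (independent (2 ∷ 4 ∷ 6 ∷ 9 ∷ 11 ∷ []))) (independent (0 ∷ 2 ∷ 7 ∷ 11 ∷ 12 ∷ [])))
  (independent (2 ∷ 4 ∷ 6 ∷ 7 ∷ 9 ∷ []))))) (independent (1 ∷ 3 ∷ 4 ∷ 6 ∷ 12 ∷ [])))))))) (independent (1 ∷
  3 ∷ 5 ∷ 6 ∷ 10 ∷ []))))) (split 11 10 (split 10 6 (split 6 5 (codegree 6 4 (0 ∷ 5 ∷ 10 ∷ [])) (independent
  (1 ∷ 5 ∷ 6 ∷ 8 ∷ 11 ∷ []))) (split 6 5 (split 9 5 (split 7 6 (split 11 6 (newVertex (split 12 1
  (independent (0 ∷ 2 ∷ 7 ∷ 9 ∷ 12 ∷ [])) (split 12 2 (independent (1 ∷ 3 ∷ 5 ∷ 10 ∷ 12 ∷ [])) (split 12 3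
  (independent (0 ∷ 2 ∷ 8 ∷ 11 ∷ 12 ∷ [])) (split 12 4 (independent (0 ∷ 5 ∷ 8 ∷ 10 ∷ 12 ∷ [])) (split 12 6
  (independent (0 ∷ 2 ∷ 7 ∷ 11 ∷ 12 ∷ [])) (independent (1 ∷ 3 ∷ 4 ∷ 6 ∷ 12 ∷ [])))))))) (split 11 9 (split
  11 7 (codegree 9 7 (1 ∷ 8 ∷ 11 ∷ [])) (newCommon 11 6 (split 12 1 (independent (0 ∷ 2 ∷ 7 ∷ 9 ∷ 12 ∷ []))
  (independent (1 ∷ 3 ∷ 5 ∷ 10 ∷ 12 ∷ []))))) (independent (2 ∷ 4 ∷ 6 ∷ 9 ∷ 11 ∷ [])))) (independent (2 ∷ 4
  ∷ 6 ∷ 7 ∷ 9 ∷ []))) (split 7 5 (split 9 6 (split 11 6 (newVertex (split 12 1 (independent (0 ∷ 2 ∷ 7 ∷ 9 ∷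
  12 ∷ [])) (split 12 2 (independent (1 ∷ 3 ∷ 5 ∷ 10 ∷ 12 ∷ [])) (split 12 3 (independent (0 ∷ 2 ∷ 8 ∷ 11 ∷
  12 ∷ [])) (split 12 4 (independent (0 ∷ 5 ∷ 8 ∷ 10 ∷ 12 ∷ [])) (split 12 6 (independent (0 ∷ 2 ∷ 9 ∷ 11 ∷
  12 ∷ [])) (independent (1 ∷ 3 ∷ 4 ∷ 6 ∷ 12 ∷ [])))))))) (split 11 7 (split 11 9 (codegree 9 7 (1 ∷ 8 ∷ 11
  ∷ [])) (newCommon 11 6 (split 12 1 (independent (0 ∷ 2 ∷ 7 ∷ 9 ∷ 12 ∷ [])) (independent (1 ∷ 3 ∷ 5 ∷ 10 ∷
  12 ∷ []))))) (independent (2 ∷ 4 ∷ 6 ∷ 7 ∷ 11 ∷ [])))) (independent (2 ∷ 4 ∷ 6 ∷ 7 ∷ 9 ∷ [])))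
  (newNeighbour 5 (split 12 1 (independent (0 ∷ 2 ∷ 7 ∷ 9 ∷ 12 ∷ [])) (split 12 3 (independent (0 ∷ 2 ∷ 8 ∷
  11 ∷ 12 ∷ [])) (independent (1 ∷ 3 ∷ 4 ∷ 6 ∷ 12 ∷ []))))))) (independent (1 ∷ 3 ∷ 5 ∷ 6 ∷ 10 ∷ []))))
  (independent (0 ∷ 5 ∷ 8 ∷ 10 ∷ 11 ∷ [])))) (split 11 9 (newCommon 9 8 (split 9 6 (independent (1 ∷ 3 ∷ 4 ∷
  6 ∷ 12 ∷ [])) (split 7 6 (split 12 0 (independent (1 ∷ 3 ∷ 4 ∷ 6 ∷ 12 ∷ [])) (split 12 2 (independent (1 ∷
  3 ∷ 5 ∷ 10 ∷ 12 ∷ [])) (split 11 7 (split 7 5 (independent (1 ∷ 5 ∷ 6 ∷ 8 ∷ 11 ∷ [])) (split 10 7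
  (independent (1 ∷ 6 ∷ 8 ∷ 10 ∷ 11 ∷ [])) (split 12 6 (split 10 6 (split 9 5 (independent (0 ∷ 5 ∷ 7 ∷ 10 ∷
  12 ∷ [])) (split 10 9 (split 11 5 (split 12 5 (found (0 ∷ 1 ∷ 9 ∷ 12 ∷ 8 ∷ 3 ∷ 2 ∷ 10 ∷ 6 ∷ 7 ∷ 11 ∷ 5 ∷ 4
  ∷ [])) (independent (0 ∷ 5 ∷ 7 ∷ 10 ∷ 12 ∷ []))) (independent (0 ∷ 5 ∷ 8 ∷ 10 ∷ 11 ∷ []))) (independent (0
  ∷ 5 ∷ 7 ∷ 9 ∷ 10 ∷ [])))) (split 6 5 (split 10 9 (independent (0 ∷ 5 ∷ 7 ∷ 10 ∷ 12 ∷ [])) (split 9 5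
  (split 11 10 (split 12 10 (found (0 ∷ 1 ∷ 9 ∷ 12 ∷ 8 ∷ 3 ∷ 2 ∷ 5 ∷ 6 ∷ 7 ∷ 11 ∷ 10 ∷ 4 ∷ [])) (independent
  (0 ∷ 5 ∷ 7 ∷ 10 ∷ 12 ∷ []))) (independent (0 ∷ 5 ∷ 8 ∷ 10 ∷ 11 ∷ []))) (independent (0 ∷ 5 ∷ 7 ∷ 9 ∷ 10 ∷
  [])))) (independent (1 ∷ 3 ∷ 5 ∷ 6 ∷ 10 ∷ [])))) (independent (1 ∷ 3 ∷ 4 ∷ 6 ∷ 12 ∷ []))))) (independent
  (0 ∷ 2 ∷ 7 ∷ 11 ∷ 12 ∷ []))))) (independent (2 ∷ 4 ∷ 6 ∷ 7 ∷ 9 ∷ []))))) (independent (0 ∷ 2 ∷ 8 ∷ 9 ∷ 11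
  ∷ []))))) (split 11 4 (split 11 6 (codegree 11 0 (3 ∷ 4 ∷ 6 ∷ [])) (split 11 9 (split 11 7 (split 9 8
  (codegree 9 7 (1 ∷ 8 ∷ 11 ∷ [])) (split 7 6 (split 9 6 (codegree 6 1 (0 ∷ 7 ∷ 9 ∷ [])) (independent (2 ∷ 4
  ∷ 6 ∷ 8 ∷ 9 ∷ []))) (split 9 6 (split 10 7 (split 8 5 (split 8 6 (split 9 5 (newVertex (split 12 0
  (independent (1 ∷ 3 ∷ 4 ∷ 6 ∷ 12 ∷ [])) (split 12 1 (independent (0 ∷ 2 ∷ 7 ∷ 9 ∷ 12 ∷ [])) (split 12 2
  (independent (1 ∷ 3 ∷ 5 ∷ 10 ∷ 12 ∷ [])) (split 12 3 (independent (0 ∷ 2 ∷ 8 ∷ 11 ∷ 12 ∷ [])) (split 12 4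
  (independent (0 ∷ 5 ∷ 10 ∷ 11 ∷ 12 ∷ [])) (split 12 6 (independent (0 ∷ 2 ∷ 8 ∷ 9 ∷ 12 ∷ [])) (independent
  (1 ∷ 3 ∷ 4 ∷ 6 ∷ 12 ∷ []))))))))) (newCommon 9 5 (split 12 0 (independent (1 ∷ 3 ∷ 4 ∷ 6 ∷ 12 ∷ []))
  (independent (0 ∷ 2 ∷ 8 ∷ 11 ∷ 12 ∷ []))))) (split 10 6 (split 6 5 (codegree 6 4 (0 ∷ 5 ∷ 10 ∷ []))
  (newCommon 8 6 (split 12 1 (independent (0 ∷ 2 ∷ 7 ∷ 9 ∷ 12 ∷ [])) (independent (1 ∷ 3 ∷ 5 ∷ 10 ∷ 12 ∷
  []))))) (independent (1 ∷ 6 ∷ 8 ∷ 10 ∷ 11 ∷ [])))) (independent (0 ∷ 5 ∷ 8 ∷ 10 ∷ 11 ∷ []))) (split 7 5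
  (split 10 8 (split 6 5 (split 10 6 (codegree 6 4 (0 ∷ 5 ∷ 10 ∷ [])) (split 8 6 (newVertex (split 12 1
  (independent (0 ∷ 2 ∷ 7 ∷ 9 ∷ 12 ∷ [])) (split 12 2 (independent (1 ∷ 3 ∷ 5 ∷ 10 ∷ 12 ∷ [])) (split 12 3
  (independent (0 ∷ 2 ∷ 8 ∷ 11 ∷ 12 ∷ [])) (split 12 4 (independent (0 ∷ 5 ∷ 10 ∷ 11 ∷ 12 ∷ [])) (split 12 6
  (independent (0 ∷ 2 ∷ 8 ∷ 9 ∷ 12 ∷ [])) (independent (1 ∷ 3 ∷ 4 ∷ 6 ∷ 12 ∷ [])))))))) (newCommon 8 6
  (split 12 1 (independent (0 ∷ 2 ∷ 7 ∷ 9 ∷ 12 ∷ [])) (independent (1 ∷ 3 ∷ 5 ∷ 10 ∷ 12 ∷ [])))))) (split 8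
  6 (independent (1 ∷ 3 ∷ 5 ∷ 6 ∷ 10 ∷ [])) (independent (1 ∷ 5 ∷ 6 ∷ 8 ∷ 11 ∷ [])))) (independent (0 ∷ 5 ∷
  8 ∷ 10 ∷ 11 ∷ []))) (newNeighbour 7 (split 12 0 (independent (1 ∷ 3 ∷ 4 ∷ 6 ∷ 12 ∷ [])) (split 12 2
  (independent (0 ∷ 5 ∷ 10 ∷ 11 ∷ 12 ∷ [])) (independent (0 ∷ 2 ∷ 8 ∷ 11 ∷ 12 ∷ []))))))) (independent (2 ∷
  4 ∷ 6 ∷ 7 ∷ 9 ∷ []))))) (newCommon 11 7 (split 7 6 (independent (1 ∷ 3 ∷ 4 ∷ 6 ∷ 12 ∷ [])) (split 9 6
  (split 12 0 (independent (1 ∷ 3 ∷ 4 ∷ 6 ∷ 12 ∷ [])) (split 12 2 (independent (1 ∷ 3 ∷ 5 ∷ 10 ∷ 12 ∷ []))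
  (split 9 8 (split 10 9 (independent (1 ∷ 6 ∷ 8 ∷ 10 ∷ 11 ∷ [])) (split 12 6 (split 6 5 (split 10 7
  (independent (0 ∷ 5 ∷ 9 ∷ 10 ∷ 12 ∷ [])) (split 7 5 (split 10 8 (split 12 10 (found (0 ∷ 1 ∷ 7 ∷ 12 ∷ 11 ∷
  3 ∷ 2 ∷ 5 ∷ 6 ∷ 9 ∷ 8 ∷ 10 ∷ 4 ∷ [])) (independent (0 ∷ 5 ∷ 9 ∷ 10 ∷ 12 ∷ []))) (independent (0 ∷ 5 ∷ 8 ∷
  10 ∷ 11 ∷ []))) (independent (0 ∷ 5 ∷ 7 ∷ 9 ∷ 10 ∷ [])))) (split 8 5 (split 10 6 (split 10 7 (split 12 5
  (found (0 ∷ 1 ∷ 7 ∷ 12 ∷ 11 ∷ 3 ∷ 2 ∷ 10 ∷ 6 ∷ 9 ∷ 8 ∷ 5 ∷ 4 ∷ [])) (independent (0 ∷ 5 ∷ 9 ∷ 10 ∷ 12 ∷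
  []))) (independent (0 ∷ 5 ∷ 7 ∷ 9 ∷ 10 ∷ []))) (independent (1 ∷ 3 ∷ 5 ∷ 6 ∷ 10 ∷ []))) (independent (1 ∷
  5 ∷ 6 ∷ 8 ∷ 11 ∷ [])))) (independent (1 ∷ 3 ∷ 4 ∷ 6 ∷ 12 ∷ [])))) (independent (0 ∷ 2 ∷ 8 ∷ 9 ∷ 12 ∷
  []))))) (independent (2 ∷ 4 ∷ 6 ∷ 7 ∷ 9 ∷ [])))))) (split 9 8 (split 11 7 (newCommon 11 9 (split 9 6
  (independent (1 ∷ 3 ∷ 4 ∷ 6 ∷ 12 ∷ [])) (split 7 6 (split 7 5 (independent (1 ∷ 5 ∷ 6 ∷ 8 ∷ 11 ∷ []))
  (split 10 7 (independent (1 ∷ 6 ∷ 8 ∷ 10 ∷ 11 ∷ [])) (split 12 0 (independent (1 ∷ 3 ∷ 4 ∷ 6 ∷ 12 ∷ []))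
  (split 12 6 (split 6 5 (split 10 6 (independent (0 ∷ 5 ∷ 7 ∷ 10 ∷ 12 ∷ [])) (split 10 8 (split 9 5 (split
  12 10 (found (0 ∷ 1 ∷ 9 ∷ 12 ∷ 11 ∷ 3 ∷ 2 ∷ 5 ∷ 6 ∷ 7 ∷ 8 ∷ 10 ∷ 4 ∷ [])) (independent (0 ∷ 5 ∷ 7 ∷ 10 ∷
  12 ∷ []))) (independent (0 ∷ 5 ∷ 7 ∷ 9 ∷ 10 ∷ []))) (independent (1 ∷ 6 ∷ 8 ∷ 10 ∷ 11 ∷ [])))) (split 8 5
  (split 10 6 (split 10 9 (split 12 5 (found (0 ∷ 1 ∷ 9 ∷ 12 ∷ 11 ∷ 3 ∷ 2 ∷ 10 ∷ 6 ∷ 7 ∷ 8 ∷ 5 ∷ 4 ∷ []))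
  (independent (0 ∷ 5 ∷ 7 ∷ 10 ∷ 12 ∷ []))) (independent (0 ∷ 5 ∷ 7 ∷ 9 ∷ 10 ∷ []))) (independent (1 ∷ 3 ∷ 5
  ∷ 6 ∷ 10 ∷ []))) (independent (1 ∷ 5 ∷ 6 ∷ 8 ∷ 11 ∷ [])))) (independent (1 ∷ 3 ∷ 4 ∷ 6 ∷ 12 ∷ []))))))
  (independent (2 ∷ 4 ∷ 6 ∷ 7 ∷ 9 ∷ []))))) (independent (0 ∷ 2 ∷ 7 ∷ 9 ∷ 11 ∷ []))) (independent (0 ∷ 2 ∷ 8
  ∷ 9 ∷ 11 ∷ []))))) (newNeighbour 4 (split 12 1 (independent (0 ∷ 2 ∷ 7 ∷ 9 ∷ 12 ∷ [])) (split 12 3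
  (independent (0 ∷ 2 ∷ 8 ∷ 11 ∷ 12 ∷ [])) (independent (1 ∷ 3 ∷ 5 ∷ 10 ∷ 12 ∷ []))))))))) (split 10 6
  (split 9 4 (split 7 4 (codegree 4 1 (0 ∷ 7 ∷ 9 ∷ [])) (split 9 6 (codegree 9 0 (1 ∷ 4 ∷ 6 ∷ [])) (split 8
  4 (split 8 6 (codegree 8 0 (3 ∷ 4 ∷ 6 ∷ [])) (split 11 9 (split 10 8 (split 11 10 (codegree 10 3 (2 ∷ 8 ∷
  11 ∷ [])) (split 11 5 (split 7 5 (split 7 6 (split 11 6 (newVertex (split 12 0 (independent (1 ∷ 3 ∷ 4 ∷ 6
  ∷ 12 ∷ [])) (split 12 1 (independent (0 ∷ 2 ∷ 7 ∷ 9 ∷ 12 ∷ [])) (split 12 2 (independent (1 ∷ 3 ∷ 5 ∷ 10 ∷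
  12 ∷ [])) (split 12 3 (independent (0 ∷ 2 ∷ 8 ∷ 11 ∷ 12 ∷ [])) (split 12 4 (independent (0 ∷ 2 ∷ 8 ∷ 9 ∷
  12 ∷ [])) (split 12 6 (independent (0 ∷ 2 ∷ 7 ∷ 11 ∷ 12 ∷ [])) (independent (1 ∷ 3 ∷ 4 ∷ 6 ∷ 12 ∷
  []))))))))) (newCommon 11 6 (split 12 1 (independent (0 ∷ 2 ∷ 7 ∷ 9 ∷ 12 ∷ [])) (independent (1 ∷ 3 ∷ 5 ∷
  10 ∷ 12 ∷ []))))) (split 11 6 (newCommon 7 6 (split 12 2 (independent (1 ∷ 3 ∷ 5 ∷ 10 ∷ 12 ∷ []))
  (independent (0 ∷ 2 ∷ 8 ∷ 11 ∷ 12 ∷ [])))) (independent (2 ∷ 4 ∷ 6 ∷ 7 ∷ 11 ∷ [])))) (split 6 5 (split 7 6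
  (newVertex (split 12 1 (independent (0 ∷ 2 ∷ 7 ∷ 9 ∷ 12 ∷ [])) (split 12 2 (independent (1 ∷ 3 ∷ 5 ∷ 10 ∷
  12 ∷ [])) (split 12 3 (independent (0 ∷ 2 ∷ 8 ∷ 11 ∷ 12 ∷ [])) (split 12 4 (independent (0 ∷ 2 ∷ 8 ∷ 9 ∷
  12 ∷ [])) (split 12 6 (independent (0 ∷ 5 ∷ 7 ∷ 10 ∷ 12 ∷ [])) (independent (1 ∷ 3 ∷ 4 ∷ 6 ∷ 12 ∷
  [])))))))) (split 11 7 (newCommon 7 6 (split 12 2 (independent (1 ∷ 3 ∷ 5 ∷ 10 ∷ 12 ∷ [])) (independent (0
  ∷ 2 ∷ 8 ∷ 11 ∷ 12 ∷ [])))) (independent (2 ∷ 4 ∷ 6 ∷ 7 ∷ 11 ∷ [])))) (newNeighbour 5 (split 12 1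
  (independent (0 ∷ 2 ∷ 7 ∷ 9 ∷ 12 ∷ [])) (split 12 3 (independent (0 ∷ 2 ∷ 8 ∷ 11 ∷ 12 ∷ [])) (split 12 6
  (independent (1 ∷ 3 ∷ 4 ∷ 10 ∷ 12 ∷ [])) (independent (1 ∷ 3 ∷ 4 ∷ 6 ∷ 12 ∷ [])))))))) (split 6 5 (split 7
  5 (split 11 6 (newVertex (split 12 1 (independent (0 ∷ 2 ∷ 7 ∷ 9 ∷ 12 ∷ [])) (split 12 2 (independent (1 ∷
  3 ∷ 5 ∷ 10 ∷ 12 ∷ [])) (split 12 3 (independent (0 ∷ 2 ∷ 8 ∷ 11 ∷ 12 ∷ [])) (split 12 4 (independent (0 ∷
  2 ∷ 8 ∷ 9 ∷ 12 ∷ [])) (split 12 6 (independent (0 ∷ 5 ∷ 10 ∷ 11 ∷ 12 ∷ [])) (independent (1 ∷ 3 ∷ 4 ∷ 6 ∷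
  12 ∷ [])))))))) (newCommon 11 6 (split 12 1 (independent (0 ∷ 2 ∷ 7 ∷ 9 ∷ 12 ∷ [])) (independent (1 ∷ 3 ∷
  5 ∷ 10 ∷ 12 ∷ []))))) (newNeighbour 5 (split 12 1 (independent (0 ∷ 2 ∷ 7 ∷ 9 ∷ 12 ∷ [])) (split 12 3
  (independent (0 ∷ 2 ∷ 8 ∷ 11 ∷ 12 ∷ [])) (independent (1 ∷ 3 ∷ 4 ∷ 6 ∷ 12 ∷ [])))))) (split 11 6 (split 7
  6 (split 7 5 (newCommon 11 5 (split 12 0 (independent (1 ∷ 3 ∷ 4 ∷ 6 ∷ 12 ∷ [])) (independent (0 ∷ 2 ∷ 7 ∷
  9 ∷ 12 ∷ [])))) (independent (0 ∷ 5 ∷ 7 ∷ 10 ∷ 11 ∷ []))) (split 7 5 (newCommon 6 5 (split 12 1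
  (independent (0 ∷ 2 ∷ 7 ∷ 9 ∷ 12 ∷ [])) (independent (1 ∷ 4 ∷ 10 ∷ 11 ∷ 12 ∷ [])))) (independent (3 ∷ 5 ∷
  6 ∷ 7 ∷ 9 ∷ [])))) (independent (1 ∷ 5 ∷ 6 ∷ 8 ∷ 11 ∷ [])))))) (split 10 9 (split 10 7 (codegree 10 1 (2 ∷
  7 ∷ 9 ∷ [])) (newCommon 10 8 (split 12 0 (independent (1 ∷ 3 ∷ 4 ∷ 6 ∷ 12 ∷ [])) (independent (0 ∷ 2 ∷ 7 ∷
  9 ∷ 12 ∷ []))))) (independent (0 ∷ 5 ∷ 8 ∷ 9 ∷ 10 ∷ [])))) (independent (0 ∷ 2 ∷ 8 ∷ 9 ∷ 11 ∷ []))))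
  (split 11 4 (split 9 8 (split 11 6 (codegree 11 0 (3 ∷ 4 ∷ 6 ∷ [])) (split 11 7 (split 10 9 (split 10 7
  (codegree 9 7 (1 ∷ 8 ∷ 10 ∷ [])) (split 7 6 (split 6 5 (newVertex (split 12 1 (independent (0 ∷ 2 ∷ 7 ∷ 9
  ∷ 12 ∷ [])) (split 12 2 (independent (1 ∷ 3 ∷ 5 ∷ 10 ∷ 12 ∷ [])) (split 12 3 (independent (0 ∷ 2 ∷ 8 ∷ 11
  ∷ 12 ∷ [])) (split 12 4 (independent (0 ∷ 2 ∷ 9 ∷ 11 ∷ 12 ∷ [])) (split 12 6 (independent (0 ∷ 5 ∷ 7 ∷ 10
  ∷ 12 ∷ [])) (independent (1 ∷ 3 ∷ 4 ∷ 6 ∷ 12 ∷ [])))))))) (split 8 5 (newCommon 6 5 (split 12 1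
  (independent (0 ∷ 2 ∷ 7 ∷ 9 ∷ 12 ∷ [])) (independent (1 ∷ 4 ∷ 8 ∷ 10 ∷ 12 ∷ [])))) (independent (1 ∷ 5 ∷ 6
  ∷ 8 ∷ 11 ∷ [])))) (split 7 5 (split 6 5 (split 8 6 (newVertex (split 12 1 (independent (0 ∷ 2 ∷ 7 ∷ 9 ∷ 12
  ∷ [])) (split 12 2 (independent (1 ∷ 3 ∷ 5 ∷ 10 ∷ 12 ∷ [])) (split 12 3 (independent (0 ∷ 2 ∷ 8 ∷ 11 ∷ 12
  ∷ [])) (split 12 4 (independent (0 ∷ 2 ∷ 9 ∷ 11 ∷ 12 ∷ [])) (split 12 6 (independent (0 ∷ 5 ∷ 8 ∷ 10 ∷ 12
  ∷ [])) (independent (1 ∷ 3 ∷ 4 ∷ 6 ∷ 12 ∷ [])))))))) (newCommon 8 6 (split 12 1 (independent (0 ∷ 2 ∷ 7 ∷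
  9 ∷ 12 ∷ [])) (independent (1 ∷ 3 ∷ 5 ∷ 10 ∷ 12 ∷ []))))) (split 8 6 (newCommon 6 5 (split 12 1
  (independent (0 ∷ 2 ∷ 7 ∷ 9 ∷ 12 ∷ [])) (independent (1 ∷ 4 ∷ 8 ∷ 10 ∷ 12 ∷ [])))) (independent (1 ∷ 5 ∷ 6
  ∷ 8 ∷ 11 ∷ [])))) (newNeighbour 7 (split 12 0 (independent (1 ∷ 3 ∷ 4 ∷ 6 ∷ 12 ∷ [])) (split 12 2
  (independent (1 ∷ 3 ∷ 5 ∷ 10 ∷ 12 ∷ [])) (independent (0 ∷ 2 ∷ 8 ∷ 11 ∷ 12 ∷ [])))))))) (split 10 7
  (independent (0 ∷ 5 ∷ 9 ∷ 10 ∷ 11 ∷ [])) (split 7 5 (split 11 10 (split 10 8 (codegree 10 3 (2 ∷ 8 ∷ 11 ∷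
  [])) (newCommon 10 9 (split 12 0 (independent (1 ∷ 3 ∷ 4 ∷ 6 ∷ 12 ∷ [])) (independent (0 ∷ 2 ∷ 8 ∷ 11 ∷ 12
  ∷ []))))) (independent (0 ∷ 5 ∷ 9 ∷ 10 ∷ 11 ∷ []))) (independent (0 ∷ 5 ∷ 7 ∷ 9 ∷ 10 ∷ [])))))
  (independent (0 ∷ 2 ∷ 7 ∷ 9 ∷ 11 ∷ [])))) (independent (0 ∷ 2 ∷ 8 ∷ 9 ∷ 11 ∷ []))) (newNeighbour 4 (split
  12 1 (independent (0 ∷ 2 ∷ 7 ∷ 9 ∷ 12 ∷ [])) (split 12 2 (independent (1 ∷ 3 ∷ 5 ∷ 10 ∷ 12 ∷ [])) (split
  12 3 (independent (0 ∷ 2 ∷ 8 ∷ 11 ∷ 12 ∷ [])) (split 12 6 (independent (1 ∷ 3 ∷ 5 ∷ 10 ∷ 12 ∷ [])) (split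
  6 5 (split 12 7 (split 9 8 (split 10 7 (independent (1 ∷ 3 ∷ 5 ∷ 10 ∷ 12 ∷ [])) (split 11 7 (independent
  (0 ∷ 2 ∷ 8 ∷ 11 ∷ 12 ∷ [])) (split 11 9 (split 10 9 (independent (1 ∷ 4 ∷ 8 ∷ 10 ∷ 11 ∷ [])) (split 7 5
  (split 11 6 (split 10 8 (split 12 10 (split 12 11 (found (0 ∷ 1 ∷ 7 ∷ 12 ∷ 11 ∷ 3 ∷ 2 ∷ 5 ∷ 4 ∷ 9 ∷ 8 ∷ 10
  ∷ 6 ∷ [])) (independent (0 ∷ 2 ∷ 8 ∷ 11 ∷ 12 ∷ []))) (independent (0 ∷ 5 ∷ 9 ∷ 10 ∷ 12 ∷ [])))
  (independent (0 ∷ 5 ∷ 8 ∷ 10 ∷ 11 ∷ []))) (independent (2 ∷ 4 ∷ 6 ∷ 7 ∷ 11 ∷ []))) (independent (0 ∷ 5 ∷ 7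
  ∷ 9 ∷ 10 ∷ [])))) (independent (0 ∷ 2 ∷ 7 ∷ 9 ∷ 11 ∷ []))))) (independent (0 ∷ 2 ∷ 8 ∷ 9 ∷ 12 ∷ [])))
  (independent (0 ∷ 2 ∷ 7 ∷ 9 ∷ 12 ∷ []))) (independent (1 ∷ 3 ∷ 5 ∷ 6 ∷ 12 ∷ [])))))))))))) (split 11 4
  (split 8 4 (codegree 4 3 (0 ∷ 8 ∷ 11 ∷ [])) (split 11 6 (codegree 11 0 (3 ∷ 4 ∷ 6 ∷ [])) (split 7 4 (split
  7 6 (codegree 7 0 (1 ∷ 4 ∷ 6 ∷ [])) (split 11 9 (split 10 7 (split 10 9 (codegree 10 1 (2 ∷ 7 ∷ 9 ∷ []))
  (split 9 5 (split 6 5 (split 8 6 (newVertex (split 12 1 (independent (0 ∷ 2 ∷ 7 ∷ 9 ∷ 12 ∷ [])) (split 12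
  2 (independent (1 ∷ 3 ∷ 5 ∷ 10 ∷ 12 ∷ [])) (split 12 3 (independent (0 ∷ 2 ∷ 8 ∷ 11 ∷ 12 ∷ [])) (split 12
  4 (independent (0 ∷ 2 ∷ 7 ∷ 11 ∷ 12 ∷ [])) (split 12 6 (independent (0 ∷ 5 ∷ 8 ∷ 10 ∷ 12 ∷ []))
  (independent (1 ∷ 3 ∷ 4 ∷ 6 ∷ 12 ∷ [])))))))) (split 9 8 (newCommon 8 6 (split 12 1 (independent (0 ∷ 2 ∷
  7 ∷ 9 ∷ 12 ∷ [])) (independent (1 ∷ 3 ∷ 5 ∷ 10 ∷ 12 ∷ [])))) (independent (2 ∷ 4 ∷ 6 ∷ 8 ∷ 9 ∷ []))))
  (split 8 5 (split 8 6 (split 9 6 (newVertex (split 12 0 (independent (1 ∷ 3 ∷ 4 ∷ 6 ∷ 12 ∷ [])) (split 12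
  1 (independent (0 ∷ 2 ∷ 7 ∷ 9 ∷ 12 ∷ [])) (split 12 2 (independent (1 ∷ 3 ∷ 5 ∷ 10 ∷ 12 ∷ [])) (split 12 3
  (independent (0 ∷ 2 ∷ 8 ∷ 11 ∷ 12 ∷ [])) (split 12 4 (independent (0 ∷ 2 ∷ 7 ∷ 11 ∷ 12 ∷ [])) (split 12 6
  (independent (0 ∷ 2 ∷ 8 ∷ 9 ∷ 12 ∷ [])) (independent (1 ∷ 3 ∷ 4 ∷ 6 ∷ 12 ∷ []))))))))) (newCommon 9 6
  (split 12 2 (independent (1 ∷ 3 ∷ 5 ∷ 10 ∷ 12 ∷ [])) (independent (0 ∷ 2 ∷ 8 ∷ 11 ∷ 12 ∷ [])))))
  (newCommon 8 6 (split 12 1 (independent (0 ∷ 2 ∷ 7 ∷ 9 ∷ 12 ∷ [])) (independent (1 ∷ 3 ∷ 5 ∷ 10 ∷ 12 ∷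
  []))))) (newNeighbour 5 (split 12 1 (independent (0 ∷ 2 ∷ 7 ∷ 9 ∷ 12 ∷ [])) (split 12 3 (independent (0 ∷
  2 ∷ 8 ∷ 11 ∷ 12 ∷ [])) (split 12 6 (independent (1 ∷ 3 ∷ 4 ∷ 10 ∷ 12 ∷ [])) (independent (1 ∷ 3 ∷ 4 ∷ 6 ∷
  12 ∷ [])))))))) (split 6 5 (split 8 5 (split 9 6 (newVertex (split 12 1 (independent (0 ∷ 2 ∷ 7 ∷ 9 ∷ 12 ∷
  [])) (split 12 2 (independent (1 ∷ 3 ∷ 5 ∷ 10 ∷ 12 ∷ [])) (split 12 3 (independent (0 ∷ 2 ∷ 8 ∷ 11 ∷ 12 ∷
  [])) (split 12 4 (independent (0 ∷ 2 ∷ 7 ∷ 11 ∷ 12 ∷ [])) (split 12 6 (independent (0 ∷ 5 ∷ 9 ∷ 10 ∷ 12 ∷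
  [])) (independent (1 ∷ 3 ∷ 4 ∷ 6 ∷ 12 ∷ [])))))))) (split 9 8 (newCommon 9 6 (split 12 2 (independent (1 ∷
  3 ∷ 5 ∷ 10 ∷ 12 ∷ [])) (independent (0 ∷ 2 ∷ 8 ∷ 11 ∷ 12 ∷ [])))) (independent (2 ∷ 4 ∷ 6 ∷ 8 ∷ 9 ∷ []))))
  (newNeighbour 5 (split 12 1 (independent (0 ∷ 2 ∷ 7 ∷ 9 ∷ 12 ∷ [])) (split 12 3 (independent (0 ∷ 2 ∷ 8 ∷
  11 ∷ 12 ∷ [])) (independent (1 ∷ 3 ∷ 4 ∷ 6 ∷ 12 ∷ [])))))) (split 9 6 (split 8 6 (split 8 5 (newCommon 9 5
  (split 12 0 (independent (1 ∷ 3 ∷ 4 ∷ 6 ∷ 12 ∷ [])) (independent (0 ∷ 2 ∷ 8 ∷ 11 ∷ 12 ∷ []))))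
  (independent (0 ∷ 5 ∷ 8 ∷ 9 ∷ 10 ∷ []))) (split 8 5 (newCommon 6 5 (split 12 1 (independent (0 ∷ 2 ∷ 7 ∷ 9
  ∷ 12 ∷ [])) (independent (1 ∷ 4 ∷ 8 ∷ 10 ∷ 12 ∷ [])))) (independent (1 ∷ 5 ∷ 6 ∷ 8 ∷ 11 ∷ []))))
  (independent (3 ∷ 5 ∷ 6 ∷ 7 ∷ 9 ∷ [])))))) (split 10 9 (independent (0 ∷ 5 ∷ 7 ∷ 10 ∷ 11 ∷ [])) (split 11
  10 (split 10 8 (codegree 10 3 (2 ∷ 8 ∷ 11 ∷ [])) (newCommon 10 7 (split 12 0 (independent (1 ∷ 3 ∷ 4 ∷ 6 ∷
  12 ∷ [])) (independent (0 ∷ 2 ∷ 8 ∷ 11 ∷ 12 ∷ []))))) (independent (0 ∷ 5 ∷ 7 ∷ 10 ∷ 11 ∷ [])))))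
  (independent (0 ∷ 2 ∷ 7 ∷ 9 ∷ 11 ∷ [])))) (newNeighbour 4 (split 12 1 (independent (0 ∷ 2 ∷ 7 ∷ 9 ∷ 12 ∷
  [])) (split 12 2 (independent (1 ∷ 3 ∷ 5 ∷ 10 ∷ 12 ∷ [])) (split 12 3 (independent (0 ∷ 2 ∷ 8 ∷ 11 ∷ 12 ∷
  [])) (split 12 6 (independent (1 ∷ 3 ∷ 5 ∷ 10 ∷ 12 ∷ [])) (split 6 5 (split 12 7 (independent (0 ∷ 2 ∷ 8 ∷
  11 ∷ 12 ∷ [])) (split 11 7 (split 12 8 (split 9 8 (independent (0 ∷ 2 ∷ 7 ∷ 9 ∷ 12 ∷ [])) (split 10 8
  (independent (1 ∷ 3 ∷ 5 ∷ 10 ∷ 12 ∷ [])) (split 11 9 (split 11 10 (independent (3 ∷ 4 ∷ 7 ∷ 9 ∷ 10 ∷ []))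
  (split 8 5 (split 9 6 (split 10 7 (split 12 9 (split 12 10 (found (0 ∷ 1 ∷ 7 ∷ 8 ∷ 5 ∷ 6 ∷ 9 ∷ 11 ∷ 3 ∷ 2
  ∷ 10 ∷ 12 ∷ 4 ∷ [])) (independent (0 ∷ 5 ∷ 10 ∷ 11 ∷ 12 ∷ []))) (independent (0 ∷ 2 ∷ 7 ∷ 9 ∷ 12 ∷ [])))
  (independent (0 ∷ 5 ∷ 7 ∷ 9 ∷ 10 ∷ []))) (independent (2 ∷ 4 ∷ 6 ∷ 8 ∷ 9 ∷ []))) (independent (0 ∷ 5 ∷ 8 ∷
  10 ∷ 11 ∷ [])))) (independent (0 ∷ 2 ∷ 8 ∷ 9 ∷ 11 ∷ []))))) (independent (0 ∷ 2 ∷ 8 ∷ 11 ∷ 12 ∷ [])))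
  (independent (0 ∷ 2 ∷ 7 ∷ 11 ∷ 12 ∷ [])))) (independent (1 ∷ 3 ∷ 5 ∷ 6 ∷ 12 ∷ []))))))))))) (split 7 4
  (newNeighbour 4 (split 12 1 (independent (0 ∷ 2 ∷ 7 ∷ 9 ∷ 12 ∷ [])) (split 12 2 (independent (1 ∷ 3 ∷ 5 ∷
  10 ∷ 12 ∷ [])) (split 12 3 (independent (0 ∷ 2 ∷ 8 ∷ 11 ∷ 12 ∷ [])) (split 12 6 (independent (1 ∷ 3 ∷ 5 ∷
  10 ∷ 12 ∷ [])) (split 6 5 (split 12 9 (split 12 10 (split 11 7 (split 10 7 (independent (1 ∷ 4 ∷ 8 ∷ 10 ∷
  11 ∷ [])) (split 9 5 (split 11 6 (split 8 6 (independent (0 ∷ 5 ∷ 8 ∷ 10 ∷ 11 ∷ [])) (split 9 8 (split 10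
  8 (split 12 11 (found (0 ∷ 1 ∷ 9 ∷ 12 ∷ 11 ∷ 3 ∷ 2 ∷ 5 ∷ 4 ∷ 7 ∷ 8 ∷ 10 ∷ 6 ∷ [])) (independent (0 ∷ 2 ∷ 8
  ∷ 11 ∷ 12 ∷ []))) (independent (0 ∷ 5 ∷ 8 ∷ 10 ∷ 11 ∷ []))) (independent (2 ∷ 4 ∷ 6 ∷ 8 ∷ 9 ∷ []))))
  (split 8 6 (split 11 9 (split 11 10 (split 12 8 (found (0 ∷ 1 ∷ 9 ∷ 12 ∷ 8 ∷ 3 ∷ 2 ∷ 5 ∷ 4 ∷ 7 ∷ 11 ∷ 10 ∷
  6 ∷ [])) (independent (0 ∷ 2 ∷ 8 ∷ 11 ∷ 12 ∷ []))) (independent (0 ∷ 5 ∷ 8 ∷ 10 ∷ 11 ∷ []))) (independent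
  (2 ∷ 4 ∷ 6 ∷ 9 ∷ 11 ∷ []))) (independent (1 ∷ 4 ∷ 6 ∷ 8 ∷ 11 ∷ [])))) (independent (0 ∷ 5 ∷ 7 ∷ 9 ∷ 10 ∷
  [])))) (split 11 9 (independent (0 ∷ 2 ∷ 7 ∷ 11 ∷ 12 ∷ [])) (independent (0 ∷ 2 ∷ 7 ∷ 9 ∷ 11 ∷ []))))
  (independent (1 ∷ 3 ∷ 5 ∷ 10 ∷ 12 ∷ []))) (independent (0 ∷ 2 ∷ 7 ∷ 9 ∷ 12 ∷ []))) (independent (1 ∷ 3 ∷ 5
  ∷ 6 ∷ 12 ∷ [])))))))) (split 8 4 (newNeighbour 4 (split 12 1 (independent (0 ∷ 2 ∷ 7 ∷ 9 ∷ 12 ∷ []))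
  (split 12 3 (independent (0 ∷ 2 ∷ 8 ∷ 11 ∷ 12 ∷ [])) (split 12 6 (independent (1 ∷ 3 ∷ 5 ∷ 10 ∷ 12 ∷ []))
  (split 6 5 (split 12 10 (split 12 11 (split 10 8 (split 9 6 (independent (3 ∷ 4 ∷ 7 ∷ 9 ∷ 10 ∷ [])) (split
  10 9 (independent (0 ∷ 2 ∷ 8 ∷ 9 ∷ 12 ∷ [])) (independent (3 ∷ 4 ∷ 7 ∷ 9 ∷ 10 ∷ [])))) (split 11 5 (split
  7 5 (independent (2 ∷ 4 ∷ 6 ∷ 7 ∷ 11 ∷ [])) (split 9 5 (independent (2 ∷ 4 ∷ 6 ∷ 9 ∷ 11 ∷ [])) (split 9 8
  (split 7 6 (split 10 9 (split 11 7 (independent (0 ∷ 2 ∷ 7 ∷ 9 ∷ 12 ∷ [])) (split 11 9 (split 12 7 (found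
  (0 ∷ 1 ∷ 9 ∷ 11 ∷ 5 ∷ 6 ∷ 7 ∷ 8 ∷ 3 ∷ 2 ∷ 10 ∷ 12 ∷ 4 ∷ [])) (independent (0 ∷ 2 ∷ 7 ∷ 9 ∷ 12 ∷ [])))
  (independent (0 ∷ 2 ∷ 7 ∷ 9 ∷ 11 ∷ [])))) (independent (0 ∷ 5 ∷ 7 ∷ 9 ∷ 10 ∷ []))) (split 9 6 (split 10 7
  (split 11 7 (split 12 9 (found (0 ∷ 1 ∷ 7 ∷ 11 ∷ 5 ∷ 6 ∷ 9 ∷ 8 ∷ 3 ∷ 2 ∷ 10 ∷ 12 ∷ 4 ∷ [])) (independent
  (0 ∷ 2 ∷ 7 ∷ 9 ∷ 12 ∷ []))) (independent (2 ∷ 4 ∷ 6 ∷ 7 ∷ 11 ∷ []))) (independent (0 ∷ 5 ∷ 7 ∷ 9 ∷ 10 ∷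
  []))) (independent (2 ∷ 4 ∷ 6 ∷ 7 ∷ 9 ∷ [])))) (split 9 6 (independent (0 ∷ 5 ∷ 8 ∷ 9 ∷ 10 ∷ [])) (split 7
  6 (split 10 9 (independent (0 ∷ 2 ∷ 8 ∷ 9 ∷ 12 ∷ [])) (independent (0 ∷ 5 ∷ 7 ∷ 9 ∷ 10 ∷ [])))
  (independent (2 ∷ 4 ∷ 6 ∷ 7 ∷ 9 ∷ []))))))) (independent (0 ∷ 5 ∷ 8 ∷ 10 ∷ 11 ∷ [])))) (independent (0 ∷ 2
  ∷ 8 ∷ 11 ∷ 12 ∷ []))) (independent (1 ∷ 3 ∷ 5 ∷ 10 ∷ 12 ∷ []))) (independent (1 ∷ 3 ∷ 5 ∷ 6 ∷ 12 ∷
  []))))))) (newCommon 10 4 (split 12 1 (independent (0 ∷ 2 ∷ 7 ∷ 9 ∷ 12 ∷ [])) (split 12 3 (independent (0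
  ∷ 2 ∷ 8 ∷ 11 ∷ 12 ∷ [])) (newNeighbour 4 overfull)))))))) (independent (1 ∷ 3 ∷ 4 ∷ 6 ∷ 10 ∷
  []))))))))))))))))

-- In all four checks N = R(3, d) + d and N + c = R(3, d - 1) + 2 + 2d, which are the conditions for
-- regularity and for the codegree bound. The pattern here is a triangle, so acceptance shows that
-- no such graph on 9 vertices exists; classically this follows since 9 · 3 is odd.
tree₄-checks : Checker.check 9 3 2 (adj (K 3)) tree₄ 0 [] [] ≡ true
tree₄-checks = refl

tree-C5-checks : Checker.check 5 2 2 (adj (complement C5)) tree-C5 0 [] [] ≡ true
tree-C5-checks = refl

-- Without a 4-cycle, the three other neighbours of 0 and two further neighbours of its neighbour 1
-- would be five independent vertices.
tree-cycle₄-checks : Checker.check 13 4 3 cycle₄ tree-cycle₄ 0 [] [] ≡ true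
tree-cycle₄-checks = refl

tree-Q-checks : Checker.check 13 4 3 (adj (complement Q)) tree-Q 4
  (insert 0 1 (insert 1 2 (insert 2 3 (insert 3 0 [])))) [] ≡ true
tree-Q-checks = refl

module SmallRamsey {n} (H : Graph n) where
  open Independence H

  ramsey₁ : RamseyBound 1 1
  ramsey₁ = ramsey-suc ramsey-zero

  ramsey₂ : RamseyBound 2 3
  ramsey₂ = ramsey-suc ramsey₁

  ramsey₃ : RamseyBound 3 6
  ramsey₃ = ramsey-suc ramsey₂

  module _ {X : Subset n} {e m m′ c N : ℕ} (tf : TriangleFree X) (no : ¬ IndependentSet X (suc (suc e)))
    (R : RamseyBound (suc e) m) (R′ : RamseyBound e m′) (|X| : count X ≡ N)
    (m≤ : m + suc e ≤ N) (m′≤ : m′ + (2 + (suc e + suc e)) ≤ N + c) where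

    module Searching {p} (pat : Fin p → Fin p → Bool) = Search H X tf no R
      (subst (m + suc e ≤_) (sym |X|) m≤) R′ (subst (λ k → m′ + (2 + (suc e + suc e)) ≤ k + c) (sym |X|) m′≤) pat

    search : ∀ {p} {pat : Fin p → Fin p → Bool} (t : Tree p) → 0 < N →
      Checker.check N (suc e) c pat t 0 [] [] ≡ true → Copy pat X
    -- No label is in use yet, so some vertex of `X` serves as the value of ρ everywhere.
    search {pat = pat} t 0<N h = Searching.check-sound pat t {ρ = λ _ → proj₁ x}
      (record { member = λ () ; injective = λ () ; edges = [] ; nonedges = [] })
      (subst (λ k → Checker.check k (suc e) c pat t 0 [] [] ≡ true) (sym |X|) h)
      where
      x : ∃ λ x → x ∈ X
      x = count>0 (subst (0 <_) (sym |X|) 0<N)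

    search-from-cycle₄ : ∀ {p} {pat : Fin p → Fin p → Bool} (t : Tree p) → Copy cycle₄ X →
      Checker.check N (suc e) c pat t 4 (insert 0 1 (insert 1 2 (insert 2 3 (insert 3 0 [])))) [] ≡ true → Copy pat X
    search-from-cycle₄ {pat = pat} t C h = Searching.check-sound pat t {ρ = ρ}
      (Searching.insert-edge pat (Searching.insert-edge pat (Searching.insert-edge pat (Searching.insert-edge pat
        (record { member = λ k<4 → subst (_∈ X) (sym (ρ-< k<4)) (member _)
                ; injective = λ j<4 k<4 e → trans (sym (FinP.toℕ-fromℕ< j<4)) (trans (cong toℕ (injective
                    (trans (sym (ρ-< j<4)) (trans e (ρ-< k<4))))) (FinP.toℕ-fromℕ< k<4))
                ; edges = [] ; nonedges = [] })
        (s≤s (s≤s (s≤s (s≤s z≤n)))) (s≤s z≤n) (edges _ _ refl))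
        (s≤s (s≤s (s≤s z≤n))) (s≤s (s≤s (s≤s (s≤s z≤n)))) (edges _ _ refl))
        (s≤s (s≤s z≤n)) (s≤s (s≤s (s≤s z≤n))) (edges _ _ refl))
        (s≤s z≤n) (s≤s (s≤s z≤n)) (edges _ _ refl))
      (subst (λ k → Checker.check k (suc e) c pat t 4 _ [] ≡ true) (sym |X|) h)
      where
      open Copy C
      ρ : ℕ → Fin n
      ρ 0 = vertex zero
      ρ 1 = vertex (suc zero)
      ρ 2 = vertex (suc (suc zero))
      ρ _ = vertex (suc (suc (suc zero)))
      ρ-< : ∀ {k} (k<4 : k < 4) → ρ k ≡ vertex (fromℕ< k<4)
      ρ-< {0} _ = refl
      ρ-< {1} (s≤s (s≤s _)) = refl
      ρ-< {2} (s≤s (s≤s (s≤s _))) = refl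
      ρ-< {3} (s≤s (s≤s (s≤s (s≤s _)))) = refl
      ρ-< {suc (suc (suc (suc _)))} (s≤s (s≤s (s≤s (s≤s ()))))

  triangle-free⇒no-K₃ : ∀ {X} → TriangleFree X → ¬ Copy (adj (K 3)) X
  triangle-free⇒no-K₃ tf T = tf (member zero) (member (suc zero)) (member (suc (suc zero)))
    (edges _ _ refl) (edges _ _ refl) (edges _ _ refl)
    where open Copy T

  -- `ramsey-suc` gives only 10. The sharp value is used for classes of 9 vertices in `odd-bounded`
  -- and, through 9 + 4 = 13, for the regularity of the graph on 13 vertices. The search treats a
  -- fixed number of vertices, hence the restriction to exactly 9.
  ramsey₄ : RamseyBound 4 9
  ramsey₄ X tf 9≤ with independent? X 4 | shrink X 9 9≤
  ... | yes I | _ = I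
  ... | no ¬I | Y , Y⊆X , |Y| = ⊥-elim (triangle-free⇒no-K₃ tf′
          (search {e = 2} {c = 2} {N = 9} tf′ (¬I ∘ independent-mono Y⊆X) ramsey₃ ramsey₂ |Y| ≤-refl ≤-refl
            tree₄ (s≤s z≤n) tree₄-checks))
    where
    tf′ : TriangleFree Y
    tf′ a b c = tf (Y⊆X a) (Y⊆X b) (Y⊆X c)

  ramsey₅ : ∀ X → TriangleFree X → count X ≡ 5 → IndependentSet X 3 ⊎ Copy (adj (complement C5)) X
  ramsey₅ X tf |X| with independent? X 3
  ... | yes I = inj₁ I
  ... | no ¬I = inj₂ (search {e = 1} {c = 2} {N = 5} tf ¬I ramsey₂ ramsey₁ |X| ≤-refl ≤-refl tree-C5 (s≤s z≤n) tree-C5-checks)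

  ramsey₁₃ : ∀ X → TriangleFree X → count X ≡ 13 → IndependentSet X 5 ⊎ Copy (adj (complement Q)) X
  ramsey₁₃ X tf |X| with independent? X 5
  ... | yes I = inj₁ I
  ... | no ¬I = inj₂ (search-from-cycle₄ {e = 3} {c = 3} {N = 13} tf ¬I ramsey₄ ramsey₃ |X| ≤-refl ≤-refl tree-Q
          (search {e = 3} {c = 3} {N = 13} tf ¬I ramsey₄ ramsey₃ |X| ≤-refl ≤-refl tree-cycle₄ (s≤s z≤n) tree-cycle₄-checks) tree-Q-checks)

-- Vertex covers of triangle-free graphs

module CriticalClasses {n} (H : Graph n) where
  open Matchings H
  open Matching

  Separated : Subset n → Subset n → Set
  Separated C D = ∀ x y → x ∈ C → y ∈ D → adj H x y ≡ false

  matching-mono : ∀ {X Y M} → (∀ {x} → x ∈ X → x ∈ Y) → Matching X M → Matching Y M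
  matching-mono s m = record { involutive = involutive m ; edge = edge m ; inside = λ x ne → s (inside m x ne) }

  fixes-outside : ∀ {X M x} → Matching X M → X x ≡ false → M x ≡ x
  fixes-outside {M = M} {x} m x∉ with M x FinP.≟ x
  ... | yes e = e
  ... | no ne = contradiction (trans (sym (inside m x ne)) x∉) λ ()

  ¬missing-edge : ∀ {X k x y} → MatchingBound X k → x ∈ X → y ∈ X → adj H x y ≡ true → ¬ Missing X k x y
  ¬missing-edge ν xX yX xy (M , m , k≤ , Mx , My) with augment m xX yX xy Mx My
  ... | M′ , m′ , s = <⇒≱ (s≤s k≤) (≤-trans (≤-reflexive (sym s)) (ν M′ m′))

  <ᶠ-irrefl : ∀ {m} {x y : Fin m} → x ≡ y → (x <ᶠ y) ≡ false
  <ᶠ-irrefl {x = x} refl = dec-false (x FinP.<? x) (FinP.<-irrefl refl)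

  <ᶠ-total : ∀ {m} {x y : Fin m} → x ≢ y → #b (x <ᶠ y) + #b (y <ᶠ x) ≡ 1
  <ᶠ-total {x = x} {y} ne with FinP.<-cmp x y
  ... | tri< a _ b = cong₂ (λ p q → #b p + #b q) (dec-true (x FinP.<? y) a) (dec-false (y FinP.<? x) b)
  ... | tri≈ _ e _ = contradiction e ne
  ... | tri> b _ a = cong₂ (λ p q → #b p + #b q) (dec-false (x FinP.<? y) b) (dec-true (y FinP.<? x) a)

  -- Gallai's lemma: if each vertex is missed by a maximum matching, then "no maximum matching misses
  -- both" is transitive, so X splits off a class of odd size 2 k₁ + 1 on which maximum matchings have k₁ edges.
  gallai : ∀ {X k a b} → MatchingBound X k → (∀ v → v ∈ X → Missing X k v v) →
    a ∈ X → b ∈ X → adj H a b ≡ true →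
    ∃ λ C → ∃ λ D → ∃ λ k₁ → Partition X C D × Separated C D × 0 < k₁ × k₁ ≤ k ×
      count C ≡ suc (k₁ + k₁) × MatchingBound D (k ∸ k₁)
  gallai {X} {k} {a} {b} ν missable aX bX ab with missable a aX
  ... | M , m , k≤M , Ma , _ = C , X ∖ C , k₁ , ∖-partition X C C⊆X , separated , 0<k₁
      , m+n≤o⇒m≤o k₁ (bound id (empty-matching _)) , |C|
      , λ N m′ → subst (_≤ k ∸ k₁) (m+n∸m≡n k₁ (size N)) (∸-monoˡ-≤ k₁ (bound N m′))
    where
    C : Subset n
    -- The class of a under "no maximum matching misses both". The vertex a is put in by hand, since
    -- a maximum matching does miss a alone.
    C x = X x ∧ ((x == a) ∨ not (does (missing? X k a x)))
    C⊆X : ∀ {x} → x ∈ C → x ∈ X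
    C⊆X {x} h = proj₁ (∧-true⁻ {X x} h)
    C⁻ : ∀ {x} → x ∈ C → x ≡ a ⊎ ¬ Missing X k a x
    C⁻ {x} h with ∨-true⁻ {x == a} (proj₂ (∧-true⁻ {X x} h))
    ... | inj₁ e = inj₁ (does-true⁻ (x FinP.≟ a) e)
    ... | inj₂ e = inj₂ (does-false⁻ (missing? X k a x) (not-true⁻ e))
    C⁺ : ∀ {x} → x ∈ X → C x ≡ false → x ≢ a × Missing X k a x
    C⁺ {x} xX x∉ with x FinP.≟ a | missing? X k a x
    ... | yes _ | _ = contradiction (trans (sym x∉) (∧-true xX refl)) λ ()
    ... | no ne | yes p = ne , p
    ... | no _ | no _ = contradiction (trans (sym x∉) (∧-true xX refl)) λ ()
    separated : Separated C (X ∖ C)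
    separated x y xC yD with ∈⊎∉ (adj H x y) | ∈-∖⁻ {X = X} {C} yD
    ... | inj₂ f | _ = f
    ... | inj₁ xy | yX , y∉ with C⁻ xC | C⁺ yX y∉
    ... | inj₁ refl | _ , ay = contradiction ay (¬missing-edge ν aX yX xy)
    -- Some maximum matching misses a and y. By transitivity through x, one misses a and x, which x
    -- ∈ C excludes, or x and y, which the edge xy excludes by augmentation.
    ... | inj₂ ¬ax | y≢a , ay with missing-transitive ν (y≢a ∘ sym) (missable x (C⊆X xC)) ay
    ... | inj₁ ax = contradiction ax ¬ax
    ... | inj₂ xy′ = contradiction xy′ (¬missing-edge ν (C⊆X xC) yX xy)
    aC : a ∈ C
    aC with ∈⊎∉ (C a)
    ... | inj₁ e = e
    ... | inj₂ a∉ = contradiction refl (proj₁ (C⁺ aX a∉))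
    bC : b ∈ C
    bC with ∈⊎∉ (C b)
    ... | inj₁ e = e
    ... | inj₂ b∉ = contradiction (trans (sym ab) (separated a b aC (∈-∖ {X = X} {C} bX b∉))) λ ()
    moved : ∀ {x} → x ∈ C → x ≢ a → M x ≢ x
    moved xC ne e with C⁻ xC
    ... | inj₁ e′ = ne e′
    ... | inj₂ ¬ax = ¬ax (M , m , k≤M , Ma , e)
    closed : ∀ {x} → x ∈ C → M x ∈ C
    closed {x} xC with M x FinP.≟ x | ∈⊎∉ (C (M x))
    ... | _ | inj₁ h = h
    ... | yes e | _ = subst (_∈ C) (sym e) xC
    ... | no ne | inj₂ h = contradiction
      (trans (sym (edge m x ne)) (separated x (M x) xC (∈-∖ {X = X} {C} (image-inside m x ne) h))) λ ()
    -- `M` pairs off the vertices of C other than a; the smaller and the larger ends of these pairs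
    -- are equally many.
    lower upper : Subset n
    lower x = C x ∧ (M x <ᶠ x)
    upper x = C x ∧ (x <ᶠ M x)
    k₁ : ℕ
    k₁ = count lower
    M-injective : ∀ {x y} → M x ≡ M y → x ≡ y
    M-injective {x} {y} e = trans (sym (involutive m x)) (trans (cong M e) (involutive m y))
    lower≡upper : count lower ≡ count upper
    lower≡upper = ≤-antisym
      (count-injection {p = lower} {upper} M (λ {x} h → let (p , q) = ∧-true⁻ {C x} h in
        ∧-true (closed p) (trans (cong (M x <ᶠ_) (involutive m x)) q)) (λ _ _ → M-injective))
      (count-injection {p = upper} {lower} M (λ {x} h → let (p , q) = ∧-true⁻ {C x} h in
        ∧-true (closed p) (trans (cong (_<ᶠ M x) (involutive m x)) q)) (λ _ _ → M-injective))
    pairing : Partition (C - a) lower upper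
    pairing x = cases (x FinP.≟ a) (C x) refl
      where
      cases : (d : Dec (x ≡ a)) → ∀ c → C x ≡ c →
        #b (c ∧ not (does d)) ≡ #b (c ∧ (M x <ᶠ x)) + #b (c ∧ (x <ᶠ M x))
      cases d false _ = refl
      cases (yes refl) true _ = sym (cong₂ (λ p q → #b p + #b q) (<ᶠ-irrefl Ma) (<ᶠ-irrefl (sym Ma)))
      cases (no ne) true xC = sym (<ᶠ-total (moved xC ne))
    |C-a| : count (C - a) ≡ k₁ + k₁
    |C-a| = trans (count-partition pairing) (cong (k₁ +_) (sym lower≡upper))
    |C| : count C ≡ suc (k₁ + k₁)
    |C| = trans (count-delete a aC) (cong suc |C-a|)
    0<k₁ : 0 < k₁
    0<k₁ with k₁ in e
    ... | suc _ = s≤s z≤n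
    ... | zero = contradiction (length≤count {p = C - a} {b ∷ []} ([] ∷ [])
      (∈-delete {X = C} bC (adj⇒≢ ab ∘ sym) ∷ [])) (<⇒≱ (≤-reflexive (cong suc (trans |C-a| (cong (λ t → t + t) e)))))
    -- Using `M` on C and `N` outside gives a matching of `X` with k₁ + size N edges.
    bound : ∀ N → Matching (X ∖ C) N → k₁ + size N ≤ k
    bound N m′ = subst (_≤ k) (trans (sym (+-identityʳ _)) (trans (cong (size swap +_) (sym (count-∅ n)))
        (count-+-cong pointwise))) (ν swap swap-matching)
      where
      N-fixes : ∀ {x} → x ∈ C → N x ≡ x
      N-fixes {x} xC = fixes-outside m′ (trans (cong (λ t → X x ∧ not t) xC) (BoolP.∧-zeroʳ (X x)))
      open Swap (matching-mono (λ {x} h → proj₁ (∈-∖⁻ {X = X} {C} h)) m′) m C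
        (λ xC → subst (_∈ C) (sym (N-fixes xC)) xC) closed
      pointwise : ∀ x → #b (swap x <ᶠ x) + 0 ≡ #b (lower x) + #b (N x <ᶠ x)
      pointwise x with C x in xC
      ... | true = cong (#b (M x <ᶠ x) +_) (sym (cong #b (<ᶠ-irrefl (N-fixes xC))))
      ... | false = +-identityʳ _

module Structure {n} (H : Graph n) where
  open Independence H
  open SmallRamsey H
  open Matchings H
  open CriticalClasses H

  -- The complement of C5 is again a pentagon, and that of Q is the cubic residue graph modulo 13.
  Pentagons : ℕ → Subset n → Set
  Pentagons zero X = ∀ x y → x ∈ X → y ∈ X → adj H x y ≡ false
  Pentagons (suc f) X = ∃ λ C → ∃ λ D → Partition X C D × Separated C D × count C ≡ 5 ×
    Copy (adj (complement C5)) C × Pentagons f D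

  CubicResidues : Subset n → Set
  CubicResidues X = ∃ λ C → ∃ λ D → Partition X C D × count C ≡ 13 ×
    Copy (adj (complement Q)) C × Pentagons 0 D

  Extremal : ℕ → Subset n → Set
  Extremal k X = (∃ λ f → k ≡ f + f × Pentagons f X) ⊎ (k ≡ 6 × CubicResidues X)

  -- The bound says that the complement of the independent set, a vertex cover, has at most 3k/2 vertices.
  Bounded : (ℕ → Subset n → Set) → ℕ → Subset n → Set
  Bounded E k X = ∃ λ a → IndependentSet X a ×
    (2 * count X < 3 * k + 2 * a ⊎ (2 * count X ≤ 3 * k + 2 * a × E k X))

  OddExtremal : ℕ → Subset n → Set
  OddExtremal k C = (k ≡ 2 × Copy (adj (complement C5)) C) ⊎ (k ≡ 6 × Copy (adj (complement Q)) C)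

  -- Independent sets of size 2, 3, 3, 4, 4, 5 for k = 1, ..., 6 make the inequality strict. Only
  -- for k = 2 and k = 6 is the Ramsey number for that size larger than 2k + 1; there a set with one
  -- element less gives equality.
  odd-bounded : ∀ k C → TriangleFree C → 0 < k → k ≤ 6 → count C ≡ suc (k + k) → Bounded OddExtremal k C
  odd-bounded 0 C tf () k≤ |C|
  odd-bounded 1 C tf 0<k k≤ |C| rewrite |C| = 2 , ramsey₂ C tf (≤-reflexive (sym |C|)) , inj₁ ≤-refl
  odd-bounded 2 C tf 0<k k≤ |C| with ramsey₅ C tf |C|
  ... | inj₁ I rewrite |C| = 3 , I , inj₁ (m≤m+n 11 1)
  ... | inj₂ P rewrite |C| = 2 , ramsey₂ C tf (≤-trans (m≤m+n 3 2) (≤-reflexive (sym |C|))) , inj₂ (≤-refl , inj₁ (refl , P))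
  odd-bounded 3 C tf 0<k k≤ |C| rewrite |C| = 3 , ramsey₃ C tf (≤-trans (m≤m+n 6 1) (≤-reflexive (sym |C|))) , inj₁ ≤-refl
  odd-bounded 4 C tf 0<k k≤ |C| rewrite |C| = 4 , ramsey₄ C tf (≤-reflexive (sym |C|)) , inj₁ (m≤m+n 19 1)
  odd-bounded 5 C tf 0<k k≤ |C| rewrite |C| = 4 , ramsey₄ C tf (≤-trans (m≤m+n 9 2) (≤-reflexive (sym |C|))) , inj₁ ≤-refl
  odd-bounded 6 C tf 0<k k≤ |C| with ramsey₁₃ C tf |C|
  ... | inj₁ I rewrite |C| = 5 , I , inj₁ (m≤m+n 27 1)
  ... | inj₂ P rewrite |C| = 4 , ramsey₄ C tf (≤-trans (m≤m+n 9 4) (≤-reflexive (sym |C|))) , inj₂ (≤-refl , inj₂ (refl , P))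
  odd-bounded (suc (suc (suc (suc (suc (suc (suc k))))))) C tf 0<k (s≤s (s≤s (s≤s (s≤s (s≤s (s≤s ())))))) |C|

  independent-union : ∀ {X C D a b} → Partition X C D → Separated C D →
    IndependentSet C a → IndependentSet D b → IndependentSet X (a + b)
  independent-union {X} {C} {D} part sep (xs , lx , xC , xp) (ys , ly , yD , yp) =
    xs List.++ ys , trans (ListP.length-++ xs) (cong₂ _+_ lx ly)
    , AllP.++⁺ (All.map (partition-⊆ˡ {C = C} {D} part) xC) (All.map (partition-⊆ʳ {C = C} {D} part) yD)
    , AllPairsP.++⁺ xp yp (All.map (λ {x} xC → All.map (λ {y} yD →
        (λ { refl → partition-disjoint {X = X} {C} {D} part xC yD }) , sep x y xC yD) yD) xC)

  -- Both sides of the bound add up over separated parts, so a strict inequality in one part makes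
  -- the sum strict. Since k ≤ 6, the graph on 13 vertices cannot occur along with another
  -- exceptional class.
  combine : ∀ {X C D k₁ k₂} → k₁ + k₂ ≤ 6 → Partition X C D → Separated C D → count C ≡ suc (k₁ + k₁) →
    Bounded OddExtremal k₁ C → Bounded Extremal k₂ D → Bounded Extremal (k₁ + k₂) X
  combine {X} {C} {D} {k₁} {k₂} k≤6 part sep |C| (a , I , p) (b , J , q) =
    a + b , independent-union part sep I J , sum p q
    where
    lhs : 2 * count X ≡ 2 * count C + 2 * count D
    lhs = trans (cong (2 *_) (count-partition part)) (*-distribˡ-+ 2 (count C) (count D))
    rhs : (3 * k₁ + 2 * a) + (3 * k₂ + 2 * b) ≡ 3 * (k₁ + k₂) + 2 * (a + b)
    rhs = solve 4 (λ k₁ a k₂ b → (con 3 :* k₁ :+ con 2 :* a) :+ (con 3 :* k₂ :+ con 2 :* b)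
      := con 3 :* (k₁ :+ k₂) :+ con 2 :* (a :+ b)) refl k₁ a k₂ b
    lt : 2 * count C + 2 * count D < (3 * k₁ + 2 * a) + (3 * k₂ + 2 * b) → 2 * count X < 3 * (k₁ + k₂) + 2 * (a + b)
    lt = subst₂ _<_ (sym lhs) rhs
    extremal : OddExtremal k₁ C → Extremal k₂ D → Extremal (k₁ + k₂) X
    extremal (inj₁ (refl , P)) (inj₁ (f , refl , Ps)) =
      inj₁ (suc f , cong suc (sym (+-suc f f)) , C , D , part , sep , |C| , P , Ps)
    extremal (inj₁ (refl , P)) (inj₂ (refl , _)) = contradiction k≤6 (<⇒≱ (m≤m+n 7 1))
    extremal (inj₂ (refl , P)) (inj₁ (zero , refl , Ps)) = inj₂ (refl , C , D , part , |C| , P , Ps)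
    extremal (inj₂ (refl , P)) (inj₁ (suc f , refl , Ps)) = contradiction k≤6 (<⇒≱ (s≤s (m≤m+n 6 _)))
    extremal (inj₂ (refl , P)) (inj₂ (refl , _)) = contradiction k≤6 (<⇒≱ (m≤m+n 7 5))
    sum : 2 * count C < 3 * k₁ + 2 * a ⊎ (2 * count C ≤ 3 * k₁ + 2 * a × OddExtremal k₁ C) →
      2 * count D < 3 * k₂ + 2 * b ⊎ (2 * count D ≤ 3 * k₂ + 2 * b × Extremal k₂ D) →
      2 * count X < 3 * (k₁ + k₂) + 2 * (a + b) ⊎ (2 * count X ≤ 3 * (k₁ + k₂) + 2 * (a + b) × Extremal (k₁ + k₂) X)
    sum (inj₁ p) (inj₁ q) = inj₁ (lt (+-mono-<-≤ p (<⇒≤ q)))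
    sum (inj₁ p) (inj₂ (q , _)) = inj₁ (lt (+-mono-<-≤ p q))
    sum (inj₂ (p , _)) (inj₁ q) = inj₁ (lt (+-mono-≤-< p q))
    sum (inj₂ (p , e)) (inj₂ (q , e′)) = inj₂ (subst₂ _≤_ (sym lhs) rhs (+-mono-≤ p q) , extremal e e′)

  unmissed-bound : ∀ {X k v} → MatchingBound X (suc k) → ¬ Missing X (suc k) v v → MatchingBound (X - v) k
  unmissed-bound {X} {k} {v} ν ¬missing M m with size M ≤? k
  ... | yes h = h
  ... | no h = contradiction
    (M , matching-mono (λ p → proj₁ (∈-delete⁻ {X = X} p)) m , ≰⇒> h , fixes , fixes) ¬missing
    where
    fixes : M v ≡ v
    fixes = fixes-outside m (trans (cong (λ t → X v ∧ not t) (==-refl v)) (BoolP.∧-zeroʳ (X v)))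

  -- The vertex v joins the cover: 2|X| grows by 2 and the right-hand side by 3, so equality never
  -- arises in this way.
  essential : ∀ {X k v} → v ∈ X → Bounded Extremal k (X - v) → Bounded Extremal (suc k) X
  essential {X} {k} {v} vX (a , I , p) = a , independent-mono (λ h → proj₁ (∈-delete⁻ {X = X} h)) I , inj₁ (begin-strict
    2 * count X ≡⟨ cong (2 *_) (count-delete v vX) ⟩
    2 * suc (count (X - v)) ≡⟨ *-suc 2 _ ⟩
    2 + 2 * count (X - v) ≤⟨ +-monoʳ-≤ 2 ([ <⇒≤ , proj₁ ]′ p) ⟩
    2 + (3 * k + 2 * a) <⟨ n<1+n _ ⟩
    3 + (3 * k + 2 * a) ≡⟨ cong (_+ 2 * a) (sym (*-suc 3 k)) ⟩
    3 * suc k + 2 * a ∎)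
    where open ≤-Reasoning

  -- A vertex that lies in every maximum matching is deleted; if there is none, `gallai` splits off
  -- an odd class. In that case k drops by some k₁ > 0, so the recursion runs on a separate bound
  -- for k.
  bounded : ∀ k → k ≤ 6 → ∀ X → TriangleFree X → MatchingBound X k → Bounded Extremal k X
  bounded k = go (suc k) k ≤-refl
    where
    go : ∀ fuel k → k < fuel → k ≤ 6 → ∀ X → TriangleFree X → MatchingBound X k → Bounded Extremal k X
    go (suc fuel) k k<fuel k≤6 X tf ν
      with FinP.any? (λ x → FinP.any? (λ y → (X x BoolP.≟ true) ×-dec (X y BoolP.≟ true) ×-dec (adj H x y BoolP.≟ true)))
    ... | no ¬edge = count X , elements-independent X (λ {x} {y} → none x y) , cover k
      where
      none : Pentagons 0 X
      none x y xX yX with ∈⊎∉ (adj H x y)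
      ... | inj₁ xy = contradiction (x , y , xX , yX , xy) ¬edge
      ... | inj₂ f = f
      cover : ∀ k → 2 * count X < 3 * k + 2 * count X ⊎ (2 * count X ≤ 3 * k + 2 * count X × Extremal k X)
      cover zero = inj₂ (≤-refl , inj₁ (0 , refl , none))
      -- k is only an upper bound for the matching number and may be positive without any edge.
      cover (suc k) = inj₁ (m<n+m (2 * count X) {3 * suc k} (s≤s z≤n))
    go (suc fuel) zero k<fuel k≤6 X tf ν | yes (a , b , aX , bX , ab)
      with augment (empty-matching X) aX bX ab refl refl
    ... | M , m , s = contradiction (≤-trans (≤-reflexive (sym s)) (ν M m)) λ ()
    go (suc fuel) (suc k) k<fuel k≤6 X tf ν | yes (a , b , aX , bX , ab)
      with FinP.any? (λ v → (X v BoolP.≟ true) ×-dec ¬? (missing? X (suc k) v v))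
    ... | yes (v , vX , ¬missing) = essential vX (go fuel k (s≤s⁻¹ k<fuel) (<⇒≤ k≤6) (X - v)
            (λ p q r → tf (-⊆ p) (-⊆ q) (-⊆ r)) (unmissed-bound ν ¬missing))
      where
      -⊆ : ∀ {x} → x ∈ (X - v) → x ∈ X
      -⊆ h = proj₁ (∈-delete⁻ {X = X} h)
    ... | no ¬v with gallai ν missable aX bX ab
      where
      missable : ∀ v → v ∈ X → Missing X (suc k) v v
      missable v vX with missing? X (suc k) v v
      ... | yes h = h
      ... | no ¬h = contradiction (v , vX , ¬h) ¬v
    ... | C , D , k₁ , part , sep , 0<k₁ , k₁≤k , |C| , νD =
      subst (λ k → Bounded Extremal k X) (m+[n∸m]≡n k₁≤k)
        (combine (≤-trans (≤-reflexive (m+[n∸m]≡n k₁≤k)) k≤6) part sep |C|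
          (odd-bounded k₁ C (λ p q r → tf (C⊆ p) (C⊆ q) (C⊆ r)) 0<k₁ (≤-trans k₁≤k k≤6) |C|)
          (go fuel (suc k ∸ k₁) (≤-trans (m∸n<m 0<k₁) (s≤s⁻¹ k<fuel)) (≤-trans (m∸n≤m (suc k) k₁) k≤6) D
            (λ p q r → tf (D⊆ p) (D⊆ q) (D⊆ r)) νD))
      where
      C⊆ : ∀ {x} → x ∈ C → x ∈ X
      C⊆ = partition-⊆ˡ {C = C} {D} part
      D⊆ : ∀ {x} → x ∈ D → x ∈ X
      D⊆ = partition-⊆ʳ {C = C} {D} part
      m∸n<m : ∀ {m n} → 0 < n → suc m ∸ n < suc m
      m∸n<m {m} {suc n} _ = s≤s (m∸n≤m m n)

-- Colourings and cliques

complement-true : ∀ {n} (G : Graph n) {x y} → adj (complement G) x y ≡ true → adj G x y ≡ false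
complement-true G {x} {y} e = not-true⁻ (proj₁ (∧-true⁻ {not (adj G x y)} e))

complement-false : ∀ {n} (G : Graph n) {x y} → x ≢ y → adj (complement G) x y ≡ false → adj G x y ≡ true
complement-false G {x} {y} ne e with adj G x y
... | true = refl
... | false = contradiction (trans (sym e) (cong not (==-≢ ne))) λ ()

module Colourings {n} (G : Graph n) where
  H : Graph n
  H = complement G

  open Independence H
  open Matchings H
  open Matching
  open CriticalClasses H
  open Structure H

  Clique : Subset n → ℕ → Set
  Clique = IndependentSet

  Colouring : Subset n → ℕ → (Fin n → ℕ) → Set
  Colouring X m c = (∀ x → x ∈ X → c x < m) × (∀ x y → x ∈ X → y ∈ X → adj G x y ≡ true → c x ≢ c y)

  ChromaticAtLeast : Subset n → ℕ → Set
  ChromaticAtLeast X s = ∀ m c → Colouring X m c → s ≤ m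

  CliqueBound : Subset n → ℕ → ℕ → Set
  CliqueBound X s f = ∀ a → Clique X a → a + f ≤ s

  adj⇒distinct : ∀ {x y} → adj G x y ≡ true → x ≢ y
  adj⇒distinct {x} p refl = true≢false (trans (sym p) (irrefl G x))

  adj⇒nonadj : ∀ {x y} → adj G x y ≡ true → adj H x y ≡ true → ⊥
  adj⇒nonadj p q = true≢false (trans (sym p) (complement-true G q))

  -- Vertices matched in H are nonadjacent in G, so the edges of `M` and the vertices it misses
  -- serve as colour classes, each represented by its smallest vertex.
  matching-colouring : ∀ {X M} → Matching X M → ∃ λ m → ∃ λ c → Colouring X m c × m + size M ≡ count X
  matching-colouring {X} {M} m = count R , (λ x → rank R (rep x)) ,
    ((λ x xX → rank-< R (rep∈R xX)) ,
     (λ x y xX yX xy e → adj⇒rep≢ xy (rank-injective R (rep∈R xX) (rep∈R yX) e))) ,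
    trans (+-comm (count R) (size M)) (sym (count-partition part))
    where
    R : Subset n
    R x = X x ∧ not (M x <ᶠ x)
    rep : Fin n → Fin n
    rep x = if M x <ᶠ x then M x else x
    <⇒≢ᶠ : ∀ {x} → (M x <ᶠ x) ≡ true → M x ≢ x
    <⇒≢ᶠ lt e = true≢false (trans (sym lt) (<ᶠ-irrefl e))
    part : Partition X (λ x → M x <ᶠ x) R
    part x with M x <ᶠ x in e
    ... | true = trans (cong #b (inside m x (<⇒≢ᶠ e))) (cong (λ b → 1 + #b b) (sym (BoolP.∧-zeroʳ (X x))))
    ... | false = cong #b (sym (BoolP.∧-identityʳ (X x)))
    rep∈R : ∀ {x} → x ∈ X → rep x ∈ R
    rep∈R {x} xX with M x <ᶠ x in e
    ... | true = ∧-true (image-inside m x (<⇒≢ᶠ e)) (cong not (trans (cong (_<ᶠ M x) (involutive m x))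
          (dec-false (x FinP.<? M x) (FinP.<-asym (does-true⁻ (M x FinP.<? x) e)))))
    ... | false = ∧-true xX (cong not e)
    adj⇒rep≢ : ∀ {x y} → adj G x y ≡ true → rep x ≢ rep y
    adj⇒rep≢ {x} {y} xy e with M x <ᶠ x in p | M y <ᶠ y in q
    ... | true | true = adj⇒distinct xy (trans (sym (involutive m x)) (trans (cong M e) (involutive m y)))
    ... | true | false = adj⇒nonadj xy (subst (λ t → adj H x t ≡ true) e (edge m x (<⇒≢ᶠ p)))
    ... | false | true = adj⇒nonadj (trans (Graph.sym G y x) xy)
          (subst (λ t → adj H y t ≡ true) (sym e) (edge m y (<⇒≢ᶠ q)))
    ... | false | false = adj⇒distinct xy e

  chromatic-matching : ∀ {X s} → ChromaticAtLeast X s → MatchingBound X (count X ∸ s)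
  chromatic-matching {X} {s} χ M m with matching-colouring m
  ... | k , c , col , e = m+n≤o⇒m≤o∸n (size M)
    (≤-trans (+-monoʳ-≤ (size M) (χ k c col)) (≤-reflexive (trans (+-comm (size M) k) e)))

  chromatic≤count : ∀ {X s} → ChromaticAtLeast X s → s ≤ count X
  chromatic≤count {X} {s} χ with matching-colouring (empty-matching X)
  ... | k , c , col , e = ≤-trans (χ k c col) (m+n≤o⇒m≤o k (≤-reflexive e))

  -- A vertex whose neighbourhood contains no clique of size q can be added to one of the t colour classes.
  Rigid : Subset n → ℕ → ℕ → Set
  Rigid X t q = ∃ λ c → Colouring X t c ×
    (∀ A → (∃ λ j → j < t × (∀ x → x ∈ X → c x ≡ j → A x ≡ false)) ⊎ Clique (X ∩ A) q)

  rigid-clique : ∀ {X} → Pentagons 0 X → Rigid X (count X) (count X)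
  rigid-clique {X} none = rank X ,
    ((λ x xX → rank-< X xX) , λ x y xX yX xy e → adj⇒distinct xy (rank-injective X xX yX e)) , missing
    where
    missing : ∀ A → (∃ λ j → j < count X × (∀ x → x ∈ X → rank X x ≡ j → A x ≡ false)) ⊎ Clique (X ∩ A) (count X)
    missing A with FinP.any? (λ x → (X x BoolP.≟ true) ×-dec (A x BoolP.≟ false))
    ... | yes (x , xX , xA) = inj₁ (rank X x , rank-< X xX ,
          λ y yX e → subst (λ t → A t ≡ false) (sym (rank-injective X yX xX e)) xA)
    ... | no ¬x = inj₂ (independent-mono X⊆ (elements-independent X λ {x} {y} → none x y))
      where
      X⊆ : ∀ {x} → x ∈ X → x ∈ (X ∩ A)
      X⊆ {x} xX with ∈⊎∉ (A x)
      ... | inj₁ xA = ∧-true xX xA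
      ... | inj₂ xA = contradiction (x , xX , xA) ¬x

  -- The classes are {0, 2}, {1, 4} and {3}. A set meeting all of them contains 3; it contains 2 or
  -- 4, next to 3 on the pentagon, or else both 0 and 1. Two vertices with a common H-neighbour are
  -- adjacent in G, as H has no triangle here.
  rigid-pentagon : ∀ {X} → TriangleFree X → count X ≡ 5 → Copy (adj (complement C5)) X → Rigid X 3 2
  rigid-pentagon {X} tf |X| P = c , (below , proper) , missing
    where
    open Copy P
    class : Fin 5 → Fin 3
    class 0F = zero
    class 1F = suc zero
    class 2F = zero
    class 3F = suc (suc zero)
    class 4F = suc zero
    class-edges : ∀ i j → class i ≡ class j → i ≡ j ⊎ adj (complement C5) i j ≡ true
    class-edges = toWitness {a? = FinP.all? λ i → FinP.all? λ j → (class i FinP.≟ class j) →-dec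
      ((i FinP.≟ j) ⊎-dec (adj (complement C5) i j BoolP.≟ true))} _
    c : Fin n → ℕ
    c x with FinP.any? (λ i → vertex i FinP.≟ x)
    ... | yes (i , _) = toℕ (class i)
    ... | no _ = 0
    c-vertex : ∀ i → c (vertex i) ≡ toℕ (class i)
    c-vertex i with FinP.any? (λ j → vertex j FinP.≟ vertex i)
    ... | yes (j , e) = cong (toℕ ∘ class) (injective e)
    ... | no ¬h = contradiction (i , refl) ¬h
    below : ∀ x → x ∈ X → c x < 3
    below x xX with copy-covers P |X| xX
    ... | i , refl = subst (_< 3) (sym (c-vertex i)) (FinP.toℕ<n (class i))
    proper : ∀ x y → x ∈ X → y ∈ X → adj G x y ≡ true → c x ≢ c y
    proper x y xX yX xy e with copy-covers P |X| xX | copy-covers P |X| yX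
    ... | i , refl | j , refl with class-edges i j (FinP.toℕ-injective (trans (sym (c-vertex i)) (trans e (c-vertex j))))
    ... | inj₁ refl = adj⇒distinct xy refl
    ... | inj₂ ij = adj⇒nonadj xy (edges i j ij)
    module _ (A : Subset n) where
      pair : ∀ i j k → i ≢ j → adj (complement C5) i k ≡ true → adj (complement C5) j k ≡ true →
        A (vertex i) ≡ true → A (vertex j) ≡ true → Clique (X ∩ A) 2
      pair i j k i≢j ik jk iA jA = vertex i ∷ vertex j ∷ [] , refl , ∧-true (member i) iA ∷ ∧-true (member j) jA ∷ []
        , ((i≢j ∘ injective , nonadj) ∷ []) ∷ [] ∷ []
        where
        nonadj : adj H (vertex i) (vertex j) ≡ false
        nonadj with ∈⊎∉ (adj H (vertex i) (vertex j))
        ... | inj₂ f = f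
        ... | inj₁ ij = ⊥-elim (tf (member i) (member j) (member k) ij (edges j k jk) (edges i k ik))
      avoid : ∀ a → (∀ i → class i ≡ a → A (vertex i) ≡ false) →
        ∃ λ j → j < 3 × (∀ x → x ∈ X → c x ≡ j → A x ≡ false)
      avoid a h = toℕ a , FinP.toℕ<n a , λ x xX e → avoids xX e
        where
        avoids : ∀ {x} → x ∈ X → c x ≡ toℕ a → A x ≡ false
        avoids xX e with copy-covers P |X| xX
        ... | i , refl = h i (FinP.toℕ-injective (trans (sym (c-vertex i)) e))
      missing : (∃ λ j → j < 3 × (∀ x → x ∈ X → c x ≡ j → A x ≡ false)) ⊎ Clique (X ∩ A) 2
      missing with ∈⊎∉ (A (vertex 3F)) | ∈⊎∉ (A (vertex 2F)) | ∈⊎∉ (A (vertex 4F)) | ∈⊎∉ (A (vertex 0F)) | ∈⊎∉ (A (vertex 1F))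
      ... | inj₂ a | _ | _ | _ | _ = inj₁ (avoid (suc (suc zero)) λ { 3F _ → a ; 4F () })
      ... | inj₁ a | inj₁ b | _ | _ | _ = inj₂ (pair 3F 2F 0F (λ ()) refl refl a b)
      ... | inj₁ a | _ | inj₁ b | _ | _ = inj₂ (pair 3F 4F 1F (λ ()) refl refl a b)
      ... | inj₁ _ | inj₂ a | inj₂ _ | inj₂ b | _ = inj₁ (avoid zero λ { 0F _ → b ; 2F _ → a ; 4F () })
      ... | inj₁ _ | inj₂ _ | inj₂ a | inj₁ _ | inj₂ b = inj₁ (avoid (suc zero) λ { 1F _ → b ; 4F _ → a })
      ... | inj₁ _ | inj₂ _ | inj₂ _ | inj₁ a | inj₁ b = inj₂ (pair 0F 1F 3F (λ ()) refl refl a b)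

  -- The colours of `D` are shifted by t₁. A set that meets all classes does so in each part, and
  -- the two cliques unite because H has no edge between the parts.
  rigid-join : ∀ {X C D t₁ q₁ t₂ q₂} → Partition X C D → Separated C D →
    Rigid C t₁ q₁ → Rigid D t₂ q₂ → Rigid X (t₁ + t₂) (q₁ + q₂)
  rigid-join {X} {C} {D} {t₁} {q₁} {t₂} {q₂} part sep (c₁ , (b₁ , p₁) , m₁) (c₂ , (b₂ , p₂) , m₂) =
    c , (below , proper) , missing
    where
    c : Fin n → ℕ
    c x = if C x then c₁ x else t₁ + c₂ x
    split-∈ : ∀ {x} → x ∈ X → (x ∈ C × c x ≡ c₁ x) ⊎ (x ∈ D × c x ≡ t₁ + c₂ x)
    split-∈ {x} xX with partition-∈ {C = C} {D} part xX
    ... | inj₁ xC = inj₁ (xC , cong (λ b → if b then c₁ x else t₁ + c₂ x) xC)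
    ... | inj₂ xD with C x in e
    ... | true = ⊥-elim (partition-disjoint {X = X} {C} {D} part e xD)
    ... | false = inj₂ (xD , refl)
    below : ∀ x → x ∈ X → c x < t₁ + t₂
    below x xX with split-∈ xX
    ... | inj₁ (xC , e) = subst (_< t₁ + t₂) (sym e) (≤-trans (b₁ x xC) (m≤m+n t₁ t₂))
    ... | inj₂ (xD , e) = subst (_< t₁ + t₂) (sym e) (+-monoʳ-< t₁ (b₂ x xD))
    ≢-high : ∀ {x y} → x ∈ C → c₁ x ≢ t₁ + c₂ y
    ≢-high {x} xC e = <⇒≱ (b₁ x xC) (≤-trans (m≤m+n t₁ _) (≤-reflexive (sym e)))
    proper : ∀ x y → x ∈ X → y ∈ X → adj G x y ≡ true → c x ≢ c y
    proper x y xX yX xy e with split-∈ xX | split-∈ yX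
    ... | inj₁ (xC , e₁) | inj₁ (yC , e₂) = p₁ x y xC yC xy (trans (sym e₁) (trans e e₂))
    ... | inj₁ (xC , e₁) | inj₂ (yD , e₂) = ≢-high {x} {y} xC (trans (sym e₁) (trans e e₂))
    ... | inj₂ (xD , e₁) | inj₁ (yC , e₂) = ≢-high {y} {x} yC (trans (sym e₂) (trans (sym e) e₁))
    ... | inj₂ (xD , e₁) | inj₂ (yD , e₂) = p₂ x y xD yD xy (+-cancelˡ-≡ t₁ _ _ (trans (sym e₁) (trans e e₂)))
    missing : ∀ A → (∃ λ j → j < t₁ + t₂ × (∀ x → x ∈ X → c x ≡ j → A x ≡ false)) ⊎ Clique (X ∩ A) (q₁ + q₂)
    missing A with m₁ A | m₂ A
    ... | inj₁ (j , j< , h) | _ = inj₁ (j , ≤-trans j< (m≤m+n t₁ t₂) , avoids)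
      where
      avoids : ∀ x → x ∈ X → c x ≡ j → A x ≡ false
      avoids x xX e with split-∈ xX
      ... | inj₁ (xC , e₁) = h x xC (trans (sym e₁) e)
      ... | inj₂ (xD , e₁) = contradiction (≤-trans (m≤m+n t₁ (c₂ x)) (≤-reflexive (trans (sym e₁) e))) (<⇒≱ j<)
    ... | inj₂ _ | inj₁ (j , j< , h) = inj₁ (t₁ + j , +-monoʳ-< t₁ j< , avoids)
      where
      avoids : ∀ x → x ∈ X → c x ≡ t₁ + j → A x ≡ false
      avoids x xX e with split-∈ xX
      ... | inj₁ (xC , e₁) = contradiction (trans (sym e) e₁ ) (λ e′ →
              <⇒≱ (b₁ x xC) (≤-trans (m≤m+n t₁ j) (≤-reflexive e′)))
      ... | inj₂ (xD , e₁) = h x xD (+-cancelˡ-≡ t₁ _ _ (trans (sym e₁) e))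
    ... | inj₂ K₁ | inj₂ K₂ = inj₂ (independent-union part′
        (λ x y p q → sep x y (proj₁ (∧-true⁻ {C x} p)) (proj₁ (∧-true⁻ {D y} q))) K₁ K₂)
      where
      part′ : Partition (X ∩ A) (C ∩ A) (D ∩ A)
      part′ x with A x
      ... | true = trans (cong #b (BoolP.∧-identityʳ (X x))) (trans (part x)
              (sym (cong₂ (λ p q → #b p + #b q) (BoolP.∧-identityʳ (C x)) (BoolP.∧-identityʳ (D x)))))
      ... | false = trans (cong #b (BoolP.∧-zeroʳ (X x)))
              (sym (cong₂ (λ p q → #b p + #b q) (BoolP.∧-zeroʳ (C x)) (BoolP.∧-zeroʳ (D x))))

  -- Each pentagon contributes 3 colours, 2 vertices of a clique and 5 vertices. The last equation
  -- later identifies t with the chromatic bound s.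
  rigid-pentagons : ∀ f {X} → TriangleFree X → Pentagons f X →
    ∃ λ t → ∃ λ q → Rigid X t q × t ≡ q + f × count X ≡ t + (f + f)
  rigid-pentagons zero {X} tf none = count X , count X , rigid-clique none , sym (+-identityʳ _) , sym (+-identityʳ _)
  rigid-pentagons (suc f) {X} tf (C , D , part , sep , |C| , P , Ps)
    with rigid-pentagons f (λ a b c → tf (D⊆ a) (D⊆ b) (D⊆ c)) Ps
    where
    D⊆ : ∀ {x} → x ∈ D → x ∈ X
    D⊆ = partition-⊆ʳ {C = C} {D} part
  ... | t , q , R , t≡ , |D| = 3 + t , 2 + q
    , rigid-join part sep (rigid-pentagon (λ a b c → tf (C⊆ a) (C⊆ b) (C⊆ c)) |C| P) R
    , cong (2 +_) (trans (cong suc t≡) (sym (+-suc q f)))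
    , trans (count-partition part) (trans (cong₂ _+_ |C| |D|)
        (solve 2 (λ t f → con 5 :+ (t :+ (f :+ f)) := con 3 :+ t :+ (con 1 :+ f :+ (con 1 :+ f))) refl t f))
    where
    C⊆ : ∀ {x} → x ∈ C → x ∈ X
    C⊆ = partition-⊆ˡ {C = C} {D} part

  StableSet : Subset n → Set
  StableSet S = ∀ x y → x ∈ S → y ∈ S → adj G x y ≡ false

  -- A vertex v of `S` whose neighbours met every class would be adjacent to a clique of size q and
  -- extend it to size q + 1. So each v fits into some class, and several may enter the same one
  -- since `S` is stable.
  recolour : ∀ {X S t q} → (∀ {x} → x ∈ S → x ∈ X) → StableSet S → ¬ Clique X (suc q) →
    Rigid (X ∖ S) t q → ∃ λ c → Colouring X t c
  recolour {X} {S} {t} {q} S⊆X stable ¬K (c , (below , proper) , missing) = c′ , below′ , proper′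
    where
    free : Fin n → ℕ
    free v with missing (adj G v)
    ... | inj₁ (j , _) = j
    -- A default value; for vertices of `S` this case is excluded in `free-spec`.
    ... | inj₂ _ = 0
    free-spec : ∀ {v} → v ∈ S → free v < t × (∀ x → x ∈ (X ∖ S) → c x ≡ free v → adj G v x ≡ false)
    free-spec {v} vS with missing (adj G v)
    ... | inj₁ (_ , h) = h
    ... | inj₂ K = contradiction (independent-cons (S⊆X vS) (independent-mono near K)) ¬K
      where
      near : ∀ {x} → x ∈ ((X ∖ S) ∩ adj G v) → x ∈ nonneighbours X v
      near {x} h with ∧-true⁻ {(X ∖ S) x} h
      ... | xXS , vx = ∈-∖ {X = X - v} {adj H v} (∈-delete {X = X} (proj₁ (∈-∖⁻ {X = X} {S} xXS)) (adj⇒distinct vx ∘ sym)) nonadj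
        where
        nonadj : adj H v x ≡ false
        nonadj with ∈⊎∉ (adj H v x)
        ... | inj₁ e = ⊥-elim (adj⇒nonadj vx e)
        ... | inj₂ e = e
    c′ : Fin n → ℕ
    c′ x = if S x then free x else c x
    split-∈ : ∀ {x} → x ∈ X → (x ∈ S × c′ x ≡ free x) ⊎ (x ∈ (X ∖ S) × c′ x ≡ c x)
    split-∈ {x} xX with S x in e
    ... | true = inj₁ (refl , refl)
    ... | false = inj₂ (trans (BoolP.∧-identityʳ (X x)) xX , refl)
    below′ : ∀ x → x ∈ X → c′ x < t
    below′ x xX with split-∈ xX
    ... | inj₁ (xS , e) = subst (_< t) (sym e) (proj₁ (free-spec xS))
    ... | inj₂ (xX′ , e) = subst (_< t) (sym e) (below x xX′)
    proper′ : ∀ x y → x ∈ X → y ∈ X → adj G x y ≡ true → c′ x ≢ c′ y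
    proper′ x y xX yX xy e with split-∈ xX | split-∈ yX
    ... | inj₁ (xS , _) | inj₁ (yS , _) = true≢false (trans (sym xy) (stable x y xS yS))
    ... | inj₁ (xS , e₁) | inj₂ (yX′ , e₂) =
      true≢false (trans (sym xy) (proj₂ (free-spec xS) y yX′ (trans (sym e₂) (trans (sym e) e₁))))
    ... | inj₂ (xX′ , e₁) | inj₁ (yS , e₂) =
      true≢false (trans (sym xy) (trans (Graph.sym G x y) (proj₂ (free-spec yS) x xX′ (trans (sym e₁) (trans e e₂)))))
    ... | inj₂ (xX′ , e₁) | inj₂ (yX′ , e₂) = proper x y xX′ yX′ xy (trans (sym e₁) (trans e e₂))

  chromatic-remove : ∀ {X S s} → (∀ {x} → x ∈ S → x ∈ X) → StableSet S → ChromaticAtLeast X (suc s) → ChromaticAtLeast (X ∖ S) s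
  chromatic-remove {X} {S} S⊆X stable χ m c (below , proper) = s≤s⁻¹ (χ (suc m) c′ (below′ , proper′))
    where
    c′ : Fin n → ℕ
    c′ x = if S x then m else c x
    below′ : ∀ x → x ∈ X → c′ x < suc m
    below′ x xX with S x in e
    ... | true = ≤-refl
    ... | false = m<n⇒m<1+n (below x (∈-∖ {X = X} {S} xX e))
    proper′ : ∀ x y → x ∈ X → y ∈ X → adj G x y ≡ true → c′ x ≢ c′ y
    proper′ x y xX yX xy e with S x in xS | S y in yS
    ... | true | true = true≢false (trans (sym xy) (stable x y xS yS))
    ... | true | false = <⇒≢ (below y (∈-∖ {X = X} {S} yX yS)) (sym e)
    ... | false | true = <⇒≢ (below x (∈-∖ {X = X} {S} xX xS)) e
    ... | false | false = proper x y (∈-∖ {X = X} {S} xX xS) (∈-∖ {X = X} {S} yX yS) xy e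

  DeficiencyExtremal : ℕ → ℕ → Subset n → Set
  DeficiencyExtremal f s X = TriangleFree X × count X ≡ s + (f + f) × (Pentagons f X ⊎ (f ≡ 3 × CubicResidues X))

double-injective : ∀ {m n} → m + m ≡ n + n → m ≡ n
double-injective {zero} {zero} e = refl
double-injective {zero} {suc n} ()
double-injective {suc m} {zero} ()
double-injective {suc m} {suc n} e = cong suc (double-injective
  (suc-injective (trans (sym (+-suc m m)) (trans (suc-injective e) (+-suc n n)))))

module ChromaticDeficiency {n} (G : Graph n) where
  open Colourings G
  open Independence H
  open Matchings H
  open CriticalClasses H
  open Structure H

  -- For |X| = s + k the cover bound reads 2 (s - a) ≤ k, and s - a ≥ f.
  deficiency≤ : ∀ {s k a f} → a + f ≤ s → 2 * (s + k) ≤ 3 * k + 2 * a → f + f ≤ k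
  deficiency≤ {s} {k} {a} {f} a+f≤s h = +-cancelʳ-≤ (2 * k + 2 * a) (f + f) k (begin
    f + f + (2 * k + 2 * a) ≡⟨ solve 3 (λ f k a → f :+ f :+ (con 2 :* k :+ con 2 :* a) := con 2 :* ((a :+ f) :+ k)) refl f k a ⟩
    2 * ((a + f) + k) ≤⟨ *-monoʳ-≤ 2 (+-monoˡ-≤ k a+f≤s) ⟩
    2 * (s + k) ≤⟨ h ⟩
    3 * k + 2 * a ≡⟨ solve 2 (λ k a → con 3 :* k :+ con 2 :* a := k :+ (con 2 :* k :+ con 2 :* a)) refl k a ⟩
    k + (2 * k + 2 * a) ∎)
    where open ≤-Reasoning

  deficiency< : ∀ {s k a f} → a + f ≤ s → 2 * (s + k) < 3 * k + 2 * a → f + f < k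
  deficiency< {s} {k} {a} {f} a+f≤s h = +-cancelʳ-≤ (2 * k + 2 * a) (suc (f + f)) k (begin
    suc (f + f + (2 * k + 2 * a)) ≡⟨ cong suc (solve 3 (λ f k a → f :+ f :+ (con 2 :* k :+ con 2 :* a) := con 2 :* ((a :+ f) :+ k)) refl f k a) ⟩
    suc (2 * ((a + f) + k)) ≤⟨ s≤s (*-monoʳ-≤ 2 (+-monoˡ-≤ k a+f≤s)) ⟩
    suc (2 * (s + k)) ≤⟨ h ⟩
    3 * k + 2 * a ≡⟨ solve 2 (λ k a → con 3 :* k :+ con 2 :* a := k :+ (con 2 :* k :+ con 2 :* a)) refl k a ⟩
    k + (2 * k + 2 * a) ∎)
    where open ≤-Reasoning

  triangle? : ∀ X → (∃ λ x → ∃ λ y → ∃ λ z → x ∈ X × y ∈ X × z ∈ X ×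
    adj H x y ≡ true × adj H y z ≡ true × adj H x z ≡ true) ⊎ TriangleFree X
  triangle? X with FinP.any? (λ x → FinP.any? (λ y → FinP.any? (λ z →
    (X x BoolP.≟ true) ×-dec (X y BoolP.≟ true) ×-dec (X z BoolP.≟ true) ×-dec
    (adj H x y BoolP.≟ true) ×-dec (adj H y z BoolP.≟ true) ×-dec (adj H x z BoolP.≟ true))))
  ... | yes t = inj₁ t
  ... | no ¬t = inj₂ λ a b c d e f → ¬t (_ , _ , _ , a , b , c , d , e , f)

  no-edges : ∀ {X x y} → MatchingBound X 0 → x ∈ X → y ∈ X → adj H x y ≡ true → ⊥
  no-edges {X} ν xX yX xy with augment (empty-matching X) xX yX xy refl refl
  ... | M , m , e = contradiction (≤-trans (≤-reflexive (sym e)) (ν M m)) λ ()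

  -- The excess k = |X| - s bounds the matching number of H. A strict cover bound would give 2f < k,
  -- against k ≤ 2f; equality forces k = 2f and the extremal shape.
  triangle-free-extremal : ∀ {f X s} → f ≤ 3 → ChromaticAtLeast X s → CliqueBound X s f → count X ≤ s + (f + f) →
    TriangleFree X → DeficiencyExtremal f s X
  triangle-free-extremal {f} {X} {s} f≤3 χ ω |X|≤ tf = tf , extremal (bounded k k≤6 X tf (chromatic-matching χ))
    where
    k : ℕ
    k = count X ∸ s
    |X| : count X ≡ s + k
    |X| = sym (m+[n∸m]≡n (chromatic≤count χ))
    k≤ : k ≤ f + f
    k≤ = ≤-trans (∸-monoˡ-≤ s |X|≤) (≤-reflexive (m+n∸m≡n s (f + f)))
    k≤6 : k ≤ 6
    k≤6 = ≤-trans k≤ (+-mono-≤ f≤3 f≤3)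
    extremal : Bounded Extremal k X → count X ≡ s + (f + f) × (Pentagons f X ⊎ (f ≡ 3 × CubicResidues X))
    extremal (a , I , inj₁ h) = contradiction k≤
      (<⇒≱ (deficiency< {a = a} {f} (ω a I) (subst (λ c → 2 * c < 3 * k + 2 * a) |X| h)))
    extremal (a , I , inj₂ (h , E)) = trans |X| (cong (s +_) k≡) , shape E
      where
      k≡ : k ≡ f + f
      k≡ = ≤-antisym k≤ (deficiency≤ {a = a} {f} (ω a I) (subst (λ c → 2 * c ≤ 3 * k + 2 * a) |X| h))
      shape : Extremal k X → Pentagons f X ⊎ (f ≡ 3 × CubicResidues X)
      shape (inj₁ (f′ , k≡′ , P)) = inj₁ (subst (λ t → Pentagons t X) (double-injective (trans (sym k≡′) k≡)) P)
      shape (inj₂ (k≡6 , P)) = inj₂ (double-injective (trans (sym k≡) k≡6) , P)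

  -- An upper bound in the hypotheses and an equality in the conclusion yield the lower bound for
  -- |X| and the structure together. Deleting a triangle of H lowers s and f by 1 and |X| by 3,
  -- which preserves the hypotheses.
  extremal : ∀ f → f ≤ 3 → ∀ X s → ChromaticAtLeast X s → CliqueBound X s f → count X ≤ s + (f + f) → DeficiencyExtremal f s X
  extremal f f≤3 X s χ ω |X|≤ with triangle? X
  extremal f f≤3 X s χ ω |X|≤ | inj₂ tf = triangle-free-extremal f≤3 χ ω |X|≤ tf
  extremal zero f≤3 X s χ ω |X|≤ | inj₁ (x , y , z , xX , yX , zX , xy , yz , xz) = ⊥-elim (no-edges ν xX yX xy)
    where
    ν : MatchingBound X 0
    ν = subst (MatchingBound X) (m≤n⇒m∸n≡0 (≤-trans |X|≤ (≤-reflexive (+-identityʳ s)))) (chromatic-matching χ)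
  extremal (suc f) f≤3 X zero χ ω |X|≤ | inj₁ _ = contradiction (ω 0 ([] , refl , [] , [])) λ ()
  extremal (suc f) f≤3 X (suc s) χ ω |X|≤ | inj₁ (x , y , z , xX , yX , zX , xy , yz , xz) =
    contradicts (extremal f (<⇒≤ f≤3) (X ∖ S) s (chromatic-remove S⊆X stable χ) ω′ |X∖S|≤)
    where
    S : Subset n
    S w = (w == x) ∨ ((w == y) ∨ (w == z))
    S⁻ : ∀ {w} → w ∈ S → w ≡ x ⊎ w ≡ y ⊎ w ≡ z
    S⁻ {w} h with ∨-true⁻ {w == x} h
    ... | inj₁ e = inj₁ (does-true⁻ (w FinP.≟ x) e)
    ... | inj₂ h′ with ∨-true⁻ {w == y} h′
    ... | inj₁ e = inj₂ (inj₁ (does-true⁻ (w FinP.≟ y) e))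
    ... | inj₂ e = inj₂ (inj₂ (does-true⁻ (w FinP.≟ z) e))
    S⊆X : ∀ {w} → w ∈ S → w ∈ X
    S⊆X {w} h with S⁻ {w} h
    ... | inj₁ refl = xX
    ... | inj₂ (inj₁ refl) = yX
    ... | inj₂ (inj₂ refl) = zX
    nonadj : ∀ {v w} → adj H v w ≡ true → adj G v w ≡ false
    nonadj = complement-true G
    flip : ∀ {v w} → adj H v w ≡ true → adj G w v ≡ false
    flip {v} {w} e = trans (Graph.sym G w v) (nonadj e)
    stable : StableSet S
    stable v w vS wS with S⁻ {v} vS | S⁻ {w} wS
    ... | inj₁ refl | inj₁ refl = irrefl G x
    ... | inj₁ refl | inj₂ (inj₁ refl) = nonadj xy
    ... | inj₁ refl | inj₂ (inj₂ refl) = nonadj xz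
    ... | inj₂ (inj₁ refl) | inj₁ refl = flip xy
    ... | inj₂ (inj₁ refl) | inj₂ (inj₁ refl) = irrefl G y
    ... | inj₂ (inj₁ refl) | inj₂ (inj₂ refl) = nonadj yz
    ... | inj₂ (inj₂ refl) | inj₁ refl = flip xz
    ... | inj₂ (inj₂ refl) | inj₂ (inj₁ refl) = flip yz
    ... | inj₂ (inj₂ refl) | inj₂ (inj₂ refl) = irrefl G z
    ∖S⊆ : ∀ {w} → w ∈ (X ∖ S) → w ∈ X
    ∖S⊆ h = proj₁ (∈-∖⁻ {X = X} {S} h)
    ω′ : CliqueBound (X ∖ S) s f
    ω′ a K = s≤s⁻¹ (≤-trans (≤-reflexive (sym (+-suc a f))) (ω a (independent-mono ∖S⊆ K)))
    3≤|S| : 3 ≤ count S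
    3≤|S| = length≤count {p = S} {x ∷ y ∷ z ∷ []}
      ((adj⇒≢ xy ∷ adj⇒≢ xz ∷ []) ∷ (adj⇒≢ yz ∷ []) ∷ [] ∷ [])
      (cong (_∨ ((x == y) ∨ (x == z))) (==-refl x) ∷
       trans (cong (λ b → (y == x) ∨ (b ∨ (y == z))) (==-refl y)) (BoolP.∨-zeroʳ (y == x)) ∷
       trans (cong (λ b → (z == x) ∨ ((z == y) ∨ b)) (==-refl z))
         (trans (cong ((z == x) ∨_) (BoolP.∨-zeroʳ (z == y))) (BoolP.∨-zeroʳ (z == x))) ∷ [])
    |X∖S|≤ : count (X ∖ S) ≤ s + (f + f)
    |X∖S|≤ = +-cancelˡ-≤ 3 _ _ (begin
      3 + count (X ∖ S) ≤⟨ +-monoˡ-≤ _ 3≤|S| ⟩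
      count S + count (X ∖ S) ≡⟨ sym (count-partition (∖-partition X S S⊆X)) ⟩
      count X ≤⟨ |X|≤ ⟩
      suc s + (suc f + suc f) ≡⟨ solve 2 (λ s f → con 1 :+ s :+ (con 1 :+ f :+ (con 1 :+ f)) := con 3 :+ (s :+ (f :+ f))) refl s f ⟩
      3 + (s + (f + f)) ∎)
      where open ≤-Reasoning
    contradicts : DeficiencyExtremal f s (X ∖ S) → DeficiencyExtremal (suc f) (suc s) X
    -- The remaining graph has f ≤ 2, so only pentagons can occur in it.
    contradicts (_ , _ , inj₂ (refl , _)) = contradiction f≤3 (<⇒≱ ≤-refl)
    contradicts (tf , |X∖S| , inj₁ P) with rigid-pentagons f tf P
    -- Counting the remaining vertices in two ways gives t = s, so the recoloured graph has s
    -- colours, one too few.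
    ... | t , q , R , t≡ , |X∖S|′ with +-cancelʳ-≡ (f + f) t s (trans (sym |X∖S|′) |X∖S|)
    ... | refl with recolour S⊆X stable ¬K R
      where
      ¬K : ¬ Clique X (suc q)
      ¬K K = <⇒≱ (n<1+n (suc s)) (≤-trans (≤-reflexive (cong suc (trans (cong suc t≡) (sym (+-suc q f))))) (ω (suc q) K))
    ... | c , col = contradiction (χ s c col) (<⇒≱ (n<1+n s))

-- Homomorphisms and joins

-- The map takes the membership proof as an argument, so it is defined on `X` only and empty targets
-- are allowed.
HomomorphismOn : ∀ {n m} → Graph n → Subset n → Graph m → Set
HomomorphismOn {n} {m} G X T = Σ (∀ x → x ∈ X → Fin m) λ h →
  ∀ x y (p : x ∈ X) (q : y ∈ X) → adj G x y ≡ true → adj T (h x p) (h y q) ≡ true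

-- Edge colourings are pulled back along the map. Monochromatic cliques are carried forward
-- injectively, since adjacent vertices have adjacent and hence distinct images.
arrows-homomorphism : ∀ {n m r} {G : Graph n} {T : Graph m} {a : Fin r → ℕ} →
  HomomorphismOn G (λ _ → true) T → Arrows G a → Arrows T a
arrows-homomorphism {G = G} {T} (h , hom) arrows c
  with arrows (record { col = λ x y → col c (h x refl) (h y refl) ; colSym = λ x y → colSym c (h x refl) (h y refl) })
... | i , f , (inj , clique) , mono = i , (λ x → h (f x) refl)
  , ((λ {x} {y} → hf-injective x y) , λ x y ne → hom _ _ refl refl (clique x y ne)) , mono
  where
  hf-injective : ∀ x y → h (f x) refl ≡ h (f y) refl → x ≡ y
  hf-injective x y e with x FinP.≟ y
  ... | yes e′ = e′
  ... | no ne = contradiction (trans (sym (hom _ _ refl refl (clique x y ne)))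
          (trans (cong (adj T (h (f x) refl)) (sym e)) (irrefl T _))) λ ()

K-adj : ∀ {m} {i j : Fin m} → toℕ i ≢ toℕ j → adj (K m) i j ≡ true
K-adj {i = i} {j} ne with toℕ i ≡ᵇ toℕ j in e
... | true = contradiction (≡ᵇ-true⁻ (toℕ i) (toℕ j) e) ne
... | false = refl

module _ {m k} (S : Graph m) (T : Graph k) where

  join-left : ∀ {u v x y} → splitAt m u ≡ inj₁ x → splitAt m v ≡ inj₁ y → adj (S ⊕ T) u v ≡ adj S x y
  join-left p q rewrite p | q = refl

  join-right : ∀ {u v x y} → splitAt m u ≡ inj₂ x → splitAt m v ≡ inj₂ y → adj (S ⊕ T) u v ≡ adj T x y
  join-right p q rewrite p | q = refl

  join-across : ∀ {u v x y} → splitAt m u ≡ inj₁ x → splitAt m v ≡ inj₂ y → adj (S ⊕ T) u v ≡ true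
  join-across p q rewrite p | q = refl

module Homomorphisms {n} (G : Graph n) where
  open Colourings G
  open Independence H
  open Structure H

  hom-join : ∀ {m k} {S : Graph m} {T : Graph k} {X C D} → (∀ {x} → x ∈ X → x ∈ C ⊎ x ∈ D) →
    HomomorphismOn G C S → HomomorphismOn G D T → HomomorphismOn G X (S ⊕ T)
  hom-join {m} {k} {S} {T} {X} {C} {D} cover (g , gh) (h , hh) = (λ x p → place (cover p)) , λ x y p q → edge (cover p) (cover q)
    where
    place : ∀ {x} → x ∈ C ⊎ x ∈ D → Fin (m + k)
    place (inj₁ p) = g _ p ↑ˡ k
    place (inj₂ p) = m ↑ʳ h _ p
    edge : ∀ {x y} (p : x ∈ C ⊎ x ∈ D) (q : y ∈ C ⊎ y ∈ D) → adj G x y ≡ true → adj (S ⊕ T) (place p) (place q) ≡ true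
    edge (inj₁ p) (inj₁ q) xy = trans (join-left S T (FinP.splitAt-↑ˡ m (g _ p) k) (FinP.splitAt-↑ˡ m (g _ q) k)) (gh _ _ p q xy)
    edge (inj₁ p) (inj₂ q) xy = join-across S T (FinP.splitAt-↑ˡ m (g _ p) k) (FinP.splitAt-↑ʳ m k (h _ q))
    edge (inj₂ p) (inj₁ q) xy = trans (Graph.sym (S ⊕ T) (m ↑ʳ h _ p) (g _ q ↑ˡ k))
      (join-across S T (FinP.splitAt-↑ˡ m (g _ q) k) (FinP.splitAt-↑ʳ m k (h _ p)))
    edge (inj₂ p) (inj₂ q) xy = trans (join-right S T (FinP.splitAt-↑ʳ m k (h _ p)) (FinP.splitAt-↑ʳ m k (h _ q))) (hh _ _ p q xy)

  hom-colouring : ∀ {X m c} → Colouring X m c → HomomorphismOn G X (K m)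
  hom-colouring (below , proper) = (λ x p → fromℕ< (below x p)) , λ x y p q xy →
    K-adj (subst₂ _≢_ (sym (FinP.toℕ-fromℕ< (below x p))) (sym (FinP.toℕ-fromℕ< (below y q))) (proper x y p q xy))

  -- By counting, the labelling is onto `X`, and its inverse is the homomorphism: an edge of G is no
  -- edge of H, so its labels are nonadjacent in the complement of `T`.
  hom-copy : ∀ {p X} {T : Graph p} → count X ≡ p → Copy (adj (complement T)) X → HomomorphismOn G X T
  hom-copy {p} {X} {T} |X| P = (λ x xX → proj₁ (copy-covers P |X| xX)) , λ x y xX yX xy →
    edge (copy-covers P |X| xX) (copy-covers P |X| yX) xy
    where
    open Copy P
    edge : ∀ {x y} (i : ∃ λ i → vertex i ≡ x) (j : ∃ λ j → vertex j ≡ y) → adj G x y ≡ true →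
      adj T (proj₁ i) (proj₁ j) ≡ true
    edge (i , refl) (j , refl) xy with ∈⊎∉ (adj T i j)
    ... | inj₁ e = e
    ... | inj₂ e = ⊥-elim (adj⇒nonadj xy (edges i j (∧-true (cong not e) (cong not (==-≢ i≢j)))))
      where
      i≢j : i ≢ j
      i≢j i≡j = adj⇒distinct xy (cong vertex i≡j)

  hom-clique : ∀ {X} → Pentagons 0 X → HomomorphismOn G X (K (count X))
  hom-clique none = hom-colouring (proj₁ (proj₂ (rigid-clique none)))

  hom-pentagons : ∀ {X} → Pentagons 3 X → ∃ λ d → count X ≡ 15 + d × HomomorphismOn G X (K d ⊕ (C5 ⊕ (C5 ⊕ C5)))
  hom-pentagons {X} (C₁ , D₁ , part₁ , _ , |C₁| , P₁ , C₂ , D₂ , part₂ , _ , |C₂| , P₂ , C₃ , D₃ , part₃ , _ , |C₃| , P₃ , none) =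
    count D₃ ,
    trans (count-partition part₁) (cong₂ _+_ |C₁| (trans (count-partition part₂) (cong₂ _+_ |C₂|
      (trans (count-partition part₃) (cong (_+ count D₃) |C₃|))))) ,
    hom-join {C = D₃} {C₁₂₃} cover (hom-clique none)
      (hom-join {X = C₁₂₃} {C₁} {C₂₃} (λ {x} → ∨-true⁻ {C₁ x}) (hom-copy {T = C5} |C₁| P₁) (hom-join {X = C₂₃} {C₂} {C₃} (λ {x} → ∨-true⁻ {C₂ x}) (hom-copy {T = C5} |C₂| P₂) (hom-copy {T = C5} |C₃| P₃)))
    where
    C₂₃ C₁₂₃ : Subset n
    C₂₃ x = C₂ x ∨ C₃ x
    C₁₂₃ x = C₁ x ∨ C₂₃ x
    ∨ʳ : ∀ {a b} → b ≡ true → a ∨ b ≡ true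
    ∨ʳ {a} refl = BoolP.∨-zeroʳ a
    ∨ˡ : ∀ {a b} → a ≡ true → a ∨ b ≡ true
    ∨ˡ refl = refl
    cover : ∀ {x} → x ∈ X → x ∈ D₃ ⊎ x ∈ C₁₂₃
    cover {x} xX with partition-∈ {C = C₁} {D₁} part₁ xX
    ... | inj₁ p = inj₂ (∨ˡ p)
    ... | inj₂ xD₁ with partition-∈ {C = C₂} {D₂} part₂ xD₁
    ... | inj₁ p = inj₂ (∨ʳ {C₁ x} (∨ˡ p))
    ... | inj₂ xD₂ with partition-∈ {C = C₃} {D₃} part₃ xD₂
    ... | inj₁ p = inj₂ (∨ʳ {C₁ x} (∨ʳ {C₂ x} p))
    ... | inj₂ p = inj₁ p

  hom-cubicResidues : ∀ {X} → CubicResidues X → ∃ λ d → count X ≡ 13 + d × HomomorphismOn G X (K d ⊕ Q)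
  hom-cubicResidues {X} (C , D , part , |C| , P , none) =
    count D , trans (count-partition part) (cong (_+ count D) |C|) ,
    hom-join {C = D} {C} (λ xX → swap⊎ (partition-∈ {C = C} {D} part xX)) (hom-clique none) (hom-copy {T = Q} |C| P)
    where
    swap⊎ : ∀ {A B : Set} → A ⊎ B → B ⊎ A
    swap⊎ = [ inj₂ , inj₁ ]′

-- Clique numbers of joins

allPairs-lookup : ∀ {A : Set} {R : A → A → Set} → (∀ {x y} → R x y → R y x) → ∀ {xs} → AllPairs R xs →
  ∀ i j → i ≢ j → R (List.lookup xs i) (List.lookup xs j)
allPairs-lookup symmetric (p ∷ ps) zero zero ne = contradiction refl ne
allPairs-lookup symmetric (p ∷ ps) zero (suc j) ne = All.lookup p (∈-lookup j)
allPairs-lookup symmetric (p ∷ ps) (suc i) zero ne = symmetric (All.lookup p (∈-lookup i))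
allPairs-lookup symmetric (p ∷ ps) (suc i) (suc j) ne = allPairs-lookup symmetric ps i j (ne ∘ cong suc)

select : ∀ {n j} (p : Subset n) → j ≤ count p →
  ∃ λ (g : Fin j → Fin n) → (∀ {x y} → x ≢ y → g x ≢ g y) × (∀ x → g x ∈ p)
select {j = j} p j≤ = List.lookup (elements p) ∘ index
  , (λ ne → allPairs-lookup (λ ne → ne ∘ sym) (elements-unique p) _ _ (ne ∘ FinP.inject≤-injective _ _ _ _))
  , λ x → All.lookup (elements-∈ p) (∈-lookup (index x))
  where
  index : Fin j → Fin (length (elements p))
  index x = inject≤ x (subst (j ≤_) (sym (length-elements p)) j≤)

adjacent⇒clique : ∀ {n k} (G : Graph n) {f : Fin k → Fin n} →
  (∀ x y → x ≢ y → adj G (f x) (f y) ≡ true) → IsClique G k f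
adjacent⇒clique G {f} h = (λ {x} {y} e → injective x y e) , h
  where
  injective : ∀ x y → f x ≡ f y → x ≡ y
  injective x y e with x FinP.≟ y
  ... | yes e′ = e′
  ... | no ne = contradiction (trans (sym (h x y ne)) (trans (cong (adj G (f x)) (sym e)) (irrefl G (f x)))) λ ()

onLeft : ∀ m {k} → Fin (m + k) → Bool
onLeft m u = [ (λ _ → true) , (λ _ → false) ]′ (splitAt m u)

onLeft-true : ∀ m {k} (u : Fin (m + k)) → onLeft m u ≡ true → ∃ λ x → splitAt m u ≡ inj₁ x
onLeft-true m u e with splitAt m u
... | inj₁ x = x , refl

onLeft-false : ∀ m {k} (u : Fin (m + k)) → onLeft m u ≡ false → ∃ λ x → splitAt m u ≡ inj₂ x
onLeft-false m u e with splitAt m u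
... | inj₂ x = x , refl

-- Of p + q + 1 pairwise adjacent vertices, more than p lie on the left or more than q on the right.
cliqueLT-join : ∀ {m k p q} {S : Graph m} {T : Graph k} → CliqueLT S (suc p) → CliqueLT T (suc q) → CliqueLT (S ⊕ T) (suc (p + q))
cliqueLT-join {m} {k} {p} {q} {S} {T} ¬S ¬T (f , _ , clique) = case suc p ≤? count left of λ
  { (yes p<) → from-left (select left p<)
  ; (no p≮) → from-right (select right (q< p≮)) }
  where
  left right : Subset (suc (p + q))
  left x = onLeft m (f x)
  right x = not (left x)
  q< : ¬ suc p ≤ count left → suc q ≤ count right
  q< p≮ = +-cancelˡ-≤ p _ _ (begin
    p + suc q ≡⟨ +-suc p q ⟩
    suc (p + q) ≡⟨ sym (count-full (suc (p + q))) ⟩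
    count {suc (p + q)} (λ _ → true) ≡⟨ count-partition {C = left} {right} (∖-partition (λ _ → true) left λ _ → refl) ⟩
    count left + count right ≤⟨ +-monoˡ-≤ _ (s≤s⁻¹ (≰⇒> p≮)) ⟩
    p + count right ∎)
    where open ≤-Reasoning
  from-left : (∃ λ (g : Fin (suc p) → Fin (suc (p + q))) → (∀ {x y} → x ≢ y → g x ≢ g y) × (∀ x → g x ∈ left)) → ⊥
  from-left (g , distinct , g∈) = ¬S (proj₁ ∘ part , adjacent⇒clique S λ x y ne →
    trans (sym (join-left S T (proj₂ (part x)) (proj₂ (part y)))) (clique _ _ (distinct ne)))
    where
    part : ∀ i → ∃ λ x → splitAt m (f (g i)) ≡ inj₁ x
    part i = onLeft-true m (f (g i)) (g∈ i)
  from-right : (∃ λ (g : Fin (suc q) → Fin (suc (p + q))) → (∀ {x y} → x ≢ y → g x ≢ g y) × (∀ x → g x ∈ right)) → ⊥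
  from-right (g , distinct , g∈) = ¬T (proj₁ ∘ part , adjacent⇒clique T λ x y ne →
    trans (sym (join-right S T (proj₂ (part x)) (proj₂ (part y)))) (clique _ _ (distinct ne)))
    where
    part : ∀ i → ∃ λ x → splitAt m (f (g i)) ≡ inj₂ x
    part i = onLeft-false m (f (g i)) (not-true⁻ (g∈ i))

cliqueLT-K : ∀ n → CliqueLT (K n) (suc n)
cliqueLT-K n (f , injective , _) with FinP.pigeonhole (n<1+n n) f
... | i , j , i<j , e = FinP.<-irrefl (injective e) i<j

independent-full? : ∀ {n} (G : Graph n) q → Dec (Independence.IndependentSet (complement G) (λ _ → true) q)
independent-full? G q = Independence.independent? (complement G) (λ _ → true) q

-- A clique is an independent set of the complement, and the decision procedure for these can be
-- evaluated on C5 and Q.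
cliqueLT-decided : ∀ {n q} (G : Graph n) → does (independent-full? G q) ≡ false → CliqueLT G q
cliqueLT-decided {q = q} G h (f , injective , clique) = does-false⁻ (independent-full? G q) h
  (List.tabulate f , ListP.length-tabulate f , All.universal (λ _ → refl) _ ,
   AllPairsP.tabulate⁺ λ {x} {y} ne → (ne ∘ injective) ,
     cong (λ b → not b ∧ not (f x == f y)) (clique x y ne))

cliqueLT-C5 : CliqueLT C5 3
cliqueLT-C5 = cliqueLT-decided C5 refl

cliqueLT-Q : CliqueLT Q 5
cliqueLT-Q = cliqueLT-decided Q refl

-- The Folkman number

module Arrowing {n r} {G : Graph n} {a : Fin r → ℕ} {R : ℕ} (ramsey : IsRamseyNumber a R)
  (arrows : Arrows G a) (ω : CliqueLT G (R ∸ 2)) where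
  open Colourings G
  open Independence H
  open Structure H
  open Homomorphisms G
  open ChromaticDeficiency G

  V : Subset n
  V _ = true

  chromatic : ChromaticAtLeast V R
  chromatic m c col = proj₂ ramsey m (arrows-homomorphism (hom-colouring col) arrows)

  clique-bound : CliqueBound V R 3
  clique-bound b (xs , refl , _ , ps) with length xs + 3 ≤? R
  ... | yes h = h
  ... | no h = contradiction (List.lookup xs ∘ index , adjacent⇒clique G λ x y ne → adjacent (ne ∘ FinP.inject≤-injective _ _ x y)) ω
    where
    -- A clique with more than R - 3 vertices has at least `R ∸ 2` of them, and its first ones
    -- contradict `ω`.
    short : R ∸ 2 ≤ length xs
    short = m≤n+o⇒m∸n≤o R 2 (s≤s⁻¹ (≤-trans (≰⇒> h) (≤-reflexive (+-comm (length xs) 3))))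
    index : Fin (R ∸ 2) → Fin (length xs)
    index x = inject≤ x short
    adjacent : ∀ {i j} → i ≢ j → adj G (List.lookup xs i) (List.lookup xs j) ≡ true
    adjacent ne with allPairs-lookup (λ (ne , f) → ne ∘ sym , trans (Graph.sym H _ _) f) ps _ _ ne
    ... | distinct , f = complement-false G distinct f

  extremal-structure : n ≤ R + 6 → DeficiencyExtremal 3 R V
  extremal-structure n≤ = extremal 3 ≤-refl V R chromatic clique-bound (subst (_≤ R + 6) (sym (count-full n)) n≤)

  -- Even for n < R + 6 the structure result applies, and it forces n = R + 6.
  order≥ : R + 6 ≤ n
  order≥ with n ≤? R + 6
  ... | no h = <⇒≤ (≰⇒> h)
  ... | yes h = ≤-reflexive (trans (sym (proj₁ (proj₂ (extremal-structure h)))) (count-full n))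

  extremal-arrows : n ≡ R + 6 → (7 ≤ R × Arrows (K (R ∸ 7) ⊕ Q) a) ⊎ (9 ≤ R × Arrows (K (R ∸ 9) ⊕ (C5 ⊕ (C5 ⊕ C5))) a)
  extremal-arrows e with extremal-structure (≤-reflexive e)
  ... | _ , |V| , inj₂ (_ , P) = inj₁ (cubicResidues (hom-cubicResidues P))
    where
    cubicResidues : (∃ λ d → count V ≡ 13 + d × HomomorphismOn G V (K d ⊕ Q)) → 7 ≤ R × Arrows (K (R ∸ 7) ⊕ Q) a
    cubicResidues (d , |V|′ , h) = subst (7 ≤_) (sym R≡) (m≤m+n 7 d) ,
      subst (λ t → Arrows (K (t ∸ 7) ⊕ Q) a) (sym R≡) (arrows-homomorphism h arrows)
      where
      R≡ : R ≡ 7 + d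
      R≡ = +-cancelˡ-≡ 6 _ _ (trans (+-comm 6 R) (trans (sym |V|) |V|′))
  ... | _ , |V| , inj₁ P = inj₂ (pentagons (hom-pentagons P))
    where
    pentagons : (∃ λ d → count V ≡ 15 + d × HomomorphismOn G V (K d ⊕ (C5 ⊕ (C5 ⊕ C5)))) →
      9 ≤ R × Arrows (K (R ∸ 9) ⊕ (C5 ⊕ (C5 ⊕ C5))) a
    pentagons (d , |V|′ , h) = subst (9 ≤_) (sym R≡) (m≤m+n 9 d) ,
      subst (λ t → Arrows (K (t ∸ 9) ⊕ (C5 ⊕ (C5 ⊕ C5))) a) (sym R≡) (arrows-homomorphism h arrows)
      where
      R≡ : R ≡ 9 + d
      R≡ = +-cancelˡ-≡ 6 _ _ (trans (+-comm 6 R) (trans (sym |V|) |V|′))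

folkman : ∀ {r N R} {a : Fin r → ℕ} (G : Graph N) → IsRamseyNumber a R → N ≡ R + 6 →
  Arrows G a → CliqueLT G (R ∸ 2) → IsFolkmanNumber a (R ∸ 2) (R + 6)
folkman G ramsey refl arrows ω = (G , arrows , ω) , λ m G′ arrows′ ω′ → Arrowing.order≥ ramsey arrows′ ω′

theorem4p2 : (r : ℕ) → 2 ≤ r → (a : Fin r → ℕ) → (∀ i → 3 ≤ a i) →
    (R : ℕ) → IsRamseyNumber a R →
    (IsFolkmanNumber a (R ∸ 2) (R + 6) ⇔
    ((7 ≤ R × Arrows (K (R ∸ 7) ⊕ Q) a) ⊎
    (9 ≤ R × Arrows (K (R ∸ 9) ⊕ (C5 ⊕ (C5 ⊕ C5))) a)))
theorem4p2 r 2≤r a 3≤a R ramsey = mk⇔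
  (λ ((G , arrows , ω) , _) → Arrowing.extremal-arrows ramsey arrows ω refl)
  λ { (inj₁ (7≤R , arrows)) → folkman (K (R ∸ 7) ⊕ Q) ramsey (order 7 7≤R) arrows
        (subst (CliqueLT (K (R ∸ 7) ⊕ Q)) (clique 4 7≤R) (cliqueLT-join (cliqueLT-K (R ∸ 7)) cliqueLT-Q))
    ; (inj₂ (9≤R , arrows)) → folkman (K (R ∸ 9) ⊕ (C5 ⊕ (C5 ⊕ C5))) ramsey (order 9 9≤R) arrows
        (subst (CliqueLT (K (R ∸ 9) ⊕ (C5 ⊕ (C5 ⊕ C5)))) (clique 6 9≤R)
          (cliqueLT-join (cliqueLT-K (R ∸ 9)) (cliqueLT-join cliqueLT-C5 (cliqueLT-join cliqueLT-C5 cliqueLT-C5)))) }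
  where
  -- Here b + 6 is the order of the second factor: 7 + 6 = 13 for Q and 9 + 6 = 15 for the three
  -- pentagons.
  order : ∀ b → b ≤ R → R ∸ b + (b + 6) ≡ R + 6
  order b b≤R = trans (sym (+-assoc (R ∸ b) b 6)) (cong (_+ 6) (m∸n+n≡m b≤R))
  -- Here b bounds the clique number of the second factor, 4 for Q and 2 + 2 + 2 for the pentagons;
  -- the join then has clique number at most R - 3.
  clique : ∀ b → 3 + b ≤ R → suc (R ∸ (3 + b) + b) ≡ R ∸ 2
  clique b b≤R = begin
    suc (R ∸ (3 + b) + b) ≡⟨ sym (+-suc _ b) ⟩
    R ∸ (2 + suc b) + suc b ≡⟨ cong (_+ suc b) (sym (∸-+-assoc R 2 (suc b))) ⟩
    R ∸ 2 ∸ suc b + suc b ≡⟨ m∸n+n≡m (m+n≤o⇒m≤o∸n (suc b) (≤-trans (≤-reflexive (+-comm (suc b) 2)) b≤R)) ⟩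
    R ∸ 2 ∎
    where open ≡-Reasoning
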